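{- Let $p$ be a prime and let $X$ be a strongly connected digraph of order $r$ (i.e. with $r$ vertices). Let $\alpha$ be the $\mathbb{Z}_p$-valued voltage assignment that sends all edges of $X$ to an element $\tau\in\mathbb{Z}_p^\times$. Let $(X_n)_{n\ge0}$ be the $\mathbb{Z}_p$-tower that arises from $\alpha$. If $n$ is an integer such that $\varphi(p^n)>r$, where $\varphi$ denotes Euler's totient function, then $\delta(X_n)=\delta(X_{n-1})$. In particular, $\delta(X_n)$ is uniformly bounded. Furthermore, $\delta(X_n)$ is constant for all $n$ if $p-1>r$.
   Context: **Digraphs.** A digraph $X$ consists of finite sets $V(X)$ (vertices) and $\mathbb{E}(X)$ (directed edges) with an incidence map $e\mapsto(o(e),t(e))\in V(X)\times V(X)$ (origin, terminus). It is strongly connected if for all $(v,v')$ there is a directed path from $v$ to $v'$. Given a voltage assignment $\alpha:\mathbb{E}(X)\to\mathbb{Z}_p$, the tower arising from $\alpha$ is given by the derived digraphs $X_n$ with vertices $V(X)\times\mathbb{Z}/p^n\mathbb{Z}$, edges $\mathbb{E}(X)\times\mathbb{Z}/p^n\mathbb{Z}$, and $(e,\sigma)$ going from $(o(e),\sigma)$ to $(t(e),\sigma+\alpha(e))$. **Defect.** For a digraph $Y$ with vertices $v_1,\dots,v_s$, let $A_Y$ be the matrix whose $(i,j)$-entry is the number of edges from $v_j$ to $v_i$. The zeta function is $Z_Y(u)=\prod_{[C]}(1-u^{|[C]|})^{ -1}$, where $[C]$ runs over equivalence classes (under cyclic permutation) of directed cycles (closed directed paths) that are not an $m$-fold multiple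 of another cycle for any $m\ge2$, and $|[C]|$ is the number of edges; it equals the rational function $\det(\mathrm{Id}-uA_Y)^{ -1}$. Put $\mathcal{BF}(Y)=\mathbb{Z}^s/(\mathrm{Id}-A_Y)\mathbb{Z}^s$, $b(Y)=\mathrm{rank}_{\mathbb{Z}}\mathcal{BF}(Y)$, $a(Y)=-\mathrm{ord}_{u=1}Z_Y(u)$, and $\delta(Y)=a(Y)-b(Y)$. -}

module Defs where

open import Algebra.Bundles using (AbelianGroup)
import Algebra.Construct.Pointwise as Pointwise
import Algebra.Properties.Group as GroupProperties
import Algebra.Properties.Monoid.Mult as Mult
import Algebra.Properties.Semiring.Sum as SemiringSum
import Algebra.Properties.CommutativeMonoid.Sum as CommutativeMonoidSum
open import Data.Bool.Base using (if_then_else_)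
open import Data.Empty using (⊥)
open import Data.Fin.Base as Fin using (Fin; toℕ; fromℕ<)
import Data.Fin.Properties as Fin
open import Data.Integer.Base using (ℤ; +_; -[1+_]; 0ℤ; 1ℤ; -_) renaming (_+_ to _+ᶻ_; _*_ to _*ᶻ_; _-_ to _-ᶻ_)
import Data.Integer.Properties as ℤ
open import Data.Integer.Tactic.RingSolver using (solve-∀)
open import Data.List.Base using (List; []; _∷_; [_]; _++_; map; filter; length; allFin; upTo; take; drop; replicate; concat; concatMap; cartesianProductWith; deduplicate; foldr)
import Data.List.Properties as List
open import Data.List.Relation.Unary.Linked using (Linked; linked?)
open import Data.Nat.Base using (ℕ; zero; suc; _+_; _*_; _∸_; _^_; _≤_; _<_; s≤s; NonZero)
open import Data.Nat.Coprimality using (coprime?)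
open import Data.Nat.Divisibility using (_∣?_)
open import Data.Nat.DivMod using (_mod_)
import Data.Nat.Properties as ℕ
open import Data.Product using (Σ; ∃; ∃-syntax; _×_; _,_)
open import Data.Product.Function.NonDependent.Propositional using (_×-↔_)
open import Function.Base using (_∘_)
open import Function.Bundles using (_↔_; Inverse)
open import Function.Construct.Composition using (_↔-∘_)
open import Function.Construct.Identity using (↔-id)
open import Function.Construct.Symmetry using (↔-sym)
open import Function.Properties.Inverse using (Inverse⇒Injection)
open import Level using (0ℓ; _⊔_)
open import Relation.Binary.Construct.Closure.ReflexiveTransitive using (Star)
open import Relation.Binary.Definitions using (DecidableEquality)
open import Relation.Binary.PropositionalEquality using (_≡_; refl; sym; trans; cong; cong₂; subst; module ≡-Reasoning)
open import Relation.Nullary using (¬_; Dec; does; no)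
open import Relation.Nullary.Decidable using (map′; _×-dec_; ¬?; via-injection)

open SemiringSum ℤ.+-*-semiring using (sum; sum-syntax; sum-cong-≗; ∑-distrib-+)

φ : ℕ → ℕ
φ m = length (filter (λ k → coprime? k m) (map suc (upTo m)))

------------------------------------------------------------------------
-- p-adic integers

-- The integers mod p^n are represented by their remainders, Fin (p ^ n).

module _ {p : ℕ} .{{_ : NonZero p}} (n : ℕ) where

  reduce : ℕ → Fin (p ^ n)
  reduce a = _mod_ a (p ^ n) {{ℕ.m^n≢0 p n}}

  addMod mulMod : Fin (p ^ n) → Fin (p ^ n) → Fin (p ^ n)
  addMod i j = reduce (toℕ i + toℕ j)
  mulMod i j = reduce (toℕ i * toℕ j)

-- The inverse limit of the rings ℤ/pⁿ.
record ℤₚ (p : ℕ) .{{_ : NonZero p}} : Set where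
  field
    residue  : ∀ n → Fin (p ^ n)
    coherent : ∀ n → reduce n (toℕ (residue (suc n))) ≡ residue n

open ℤₚ public

IsUnit : ∀ {p} .{{_ : NonZero p}} → ℤₚ p → Set
IsUnit {p} τ = Σ (ℤₚ p) λ υ → ∀ n → mulMod n (residue τ n) (residue υ n) ≡ reduce n 1

------------------------------------------------------------------------
-- Digraphs and derived digraphs

record Digraph : Set₁ where
  field
    V E   : Set
    order : ℕ
    size  : ℕ
    enumV : V ↔ Fin order
    enumE : E ↔ Fin size
    o t   : E → V

  Step : V → V → Set
  Step v w = ∃[ e ] (o e ≡ v × t e ≡ w)

  StronglyConnected : Set
  StronglyConnected = ∀ v w → Star Step v w

  _≟V_ : DecidableEquality V
  _≟V_ = via-injection (Inverse⇒Injection enumV) Fin._≟_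

  _≟E_ : DecidableEquality E
  _≟E_ = via-injection (Inverse⇒Injection enumE) Fin._≟_

  vertex : Fin order → V
  vertex = Inverse.from enumV

  edges : List E
  edges = map (Inverse.from enumE) (allFin size)

derived : ∀ {p} .{{_ : NonZero p}} (X : Digraph) → (Digraph.E X → ℤₚ p) → ℕ → Digraph
derived {p} X α n = record
  { V     = V × Fin (p ^ n)
  ; E     = E × Fin (p ^ n)
  ; order = order * p ^ n
  ; size  = size * p ^ n
  ; enumV = ↔-sym Fin.*↔× ↔-∘ (enumV ×-↔ ↔-id _)
  ; enumE = ↔-sym Fin.*↔× ↔-∘ (enumE ×-↔ ↔-id _)
  ; o     = λ (e , σ) → o e , σ
  ; t     = λ (e , σ) → t e , addMod n σ (residue (α e) n)
  }
  where open Digraph X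

------------------------------------------------------------------------
-- Directed cycles

-- Cycles are written as lists of edges, in the order of traversal.

module _ (Y : Digraph) where
  open Digraph Y

  IsCycle : List E → Set
  IsCycle []       = ⊥
  IsCycle (e ∷ es) = Linked (λ f g → t f ≡ o g) (e ∷ es ++ [ e ])

  isCycle? : ∀ w → Dec (IsCycle w)
  isCycle? []       = no λ ()
  isCycle? (e ∷ es) = linked? (λ f g → t f ≟V o g) (e ∷ es ++ [ e ])

  IsMultiple : List E → Set
  IsMultiple w = ∃[ m ] ∃[ c ] (2 ≤ m × IsCycle c × w ≡ concat (replicate m c))

  Rotation : List E → List E → Set
  Rotation w w′ = ∃ λ (k : Fin (suc (length w))) → w′ ≡ drop (toℕ k) w ++ take (toℕ k) w

  rotation? : ∀ w w′ → Dec (Rotation w w′)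
  rotation? w w′ = Fin.any? λ k → List.≡-dec _≟E_ w′ (drop (toℕ k) w ++ take (toℕ k) w)

  -- Deciding IsMultiple: if w = cᵐ then m ≤ |w| and c is a prefix of w,
  -- so that finitely many pairs (m , c) have to be tried.

  private
    length-concat-replicate : ∀ m (c : List E) → length (concat (replicate m c)) ≡ m * length c
    length-concat-replicate zero    c = refl
    length-concat-replicate (suc m) c =
      trans (List.length-++ c) (cong (λ l → length c + l) (length-concat-replicate m c))

    take-length-++ : ∀ (c d : List E) → take (length c) (c ++ d) ≡ c
    take-length-++ []      d = refl
    take-length-++ (e ∷ c) d = cong (e ∷_) (take-length-++ c d)

    BoundedMultiple : List E → Set
    BoundedMultiple w = ∃ λ (m : Fin (suc (length w))) → ∃ λ (k : Fin (suc (length w))) →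
      2 ≤ toℕ m × IsCycle (take (toℕ k) w) × w ≡ concat (replicate (toℕ m) (take (toℕ k) w))

    bounded : ∀ w → IsMultiple w → BoundedMultiple w
    bounded _ (_     , []     , _   , ()  , _)
    bounded _ (suc m , e ∷ es , 2≤m , cyc , refl) =
      fromℕ< m<  , fromℕ< k< ,
      subst (2 ≤_) (sym m≡) 2≤m ,
      subst IsCycle (sym c≡) cyc ,
      cong₂ (λ j d → concat (replicate j d)) (sym m≡) (sym c≡)
      where
      c w : List E
      c = e ∷ es
      w = concat (replicate (suc m) c)
      len : length w ≡ suc m * length c
      len = length-concat-replicate (suc m) c
      m< : suc m < suc (length w)
      m< = s≤s (subst (suc m ≤_) (sym len) (ℕ.m≤m*n (suc m) (length c)))
      k< : length c < suc (length w)
      k< = s≤s (subst (length c ≤_) (sym len) (ℕ.m≤m+n (length c) (m * length c)))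
      m≡ : toℕ (fromℕ< m<) ≡ suc m
      m≡ = Fin.toℕ-fromℕ< m<
      c≡ : take (toℕ (fromℕ< k<)) w ≡ c
      c≡ = trans (cong (λ k → take k w) (Fin.toℕ-fromℕ< k<))
                 (take-length-++ c (concat (replicate m c)))

  isMultiple? : ∀ w → Dec (IsMultiple w)
  isMultiple? w = map′ (λ (m , k , q) → toℕ m , take (toℕ k) w , q) (bounded w)
    (Fin.any? λ m → Fin.any? λ k →
      (2 ℕ.≤? toℕ m) ×-dec isCycle? (take (toℕ k) w)
        ×-dec List.≡-dec _≟E_ w (concat (replicate (toℕ m) (take (toℕ k) w))))

  words : ℕ → List (List E)
  words zero    = [ [] ]
  words (suc l) = cartesianProductWith _∷_ edges (words l)

  -- One representative of each class [C] with |[C]| = l.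
  primitiveClasses : ℕ → List (List E)
  primitiveClasses l =
    deduplicate rotation? (filter (λ w → isCycle? w ×-dec ¬? (isMultiple? w)) (words l))

------------------------------------------------------------------------
-- Power series and orders of rational functions

Series : Set
Series = ℕ → ℤ

one : Series
one zero    = 1ℤ
one (suc _) = 0ℤ

infixl 7 _⊛_
_⊛_ : Series → Series → Series
(f ⊛ g) n = ∑[ i < suc n ] (f (toℕ i) *ᶻ g (n ∸ toℕ i))

infixr 8 _^ˢ_
_^ˢ_ : Series → ℕ → Series
f ^ˢ zero    = one
f ^ˢ (suc k) = f ⊛ f ^ˢ k

-- Polynomials are lists of coefficients, constant term first.
Polynomial : Set
Polynomial = List ℤ

coeff : Polynomial → Series
coeff []      _       = 0ℤ
coeff (a ∷ _) zero    = a
coeff (_ ∷ P) (suc n) = coeff P n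

eval : Polynomial → ℤ → ℤ
eval P x = foldr (λ a b → a +ᶻ x *ᶻ b) 0ℤ P

-- F is the expansion at u = 0 of a rational function
-- (u - c)ᵐ P(u) / ((u - c)ˡ Q(u)) with P(c), Q(c) ≠ 0 and k = m - l.
HasOrderAt : ℤ → Series → ℤ → Set
HasOrderAt c F k =
  ∃[ m ] ∃[ l ] ∃[ P ] ∃[ Q ]
    ( ¬ eval P c ≡ 0ℤ
    × ¬ eval Q c ≡ 0ℤ
    × (∀ n → (X-c ^ˢ l ⊛ coeff Q ⊛ F) n ≡ (X-c ^ˢ m ⊛ coeff P) n)
    × k ≡ + m -ᶻ + l )
  where
  X-c : Series
  X-c = coeff (- c ∷ 1ℤ ∷ [])

-- (1 - uˡ)⁻¹ = Σⱼ uˡʲ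
geometric : ℕ → Series
geometric l n = if does (l ∣? n) then 1ℤ else 0ℤ

-- The factors with |[C]| > n are ≡ 1 modulo uⁿ⁺¹, so the coefficient of uⁿ
-- in the infinite product is that of the product over |[C]| ≤ n.
zeta : Digraph → Series
zeta Y n = foldr _⊛_ one (map (geometric ∘ length) (concatMap (primitiveClasses Y) (map suc (upTo n)))) n

------------------------------------------------------------------------
-- Cokernels and ranks

Matrix : ℕ → ℕ → Set
Matrix m n = Fin m → Fin n → ℤ

infixr 7 _*ᵛ_
_*ᵛ_ : ∀ {m n} → Matrix m n → (Fin n → ℤ) → (Fin m → ℤ)
_*ᵛ_ {n = n} M z i = ∑[ j < n ] (M i j *ᶻ z j)

private
  module ℤ₊ = GroupProperties (AbelianGroup.group ℤ.+-0-abelianGroup)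

  *ᵛ-+ : ∀ {m n} (M : Matrix m n) y z i → (M *ᵛ λ j → y j +ᶻ z j) i ≡ (M *ᵛ y) i +ᶻ (M *ᵛ z) i
  *ᵛ-+ M y z i = trans (sum-cong-≗ (λ j → ℤ.*-distribˡ-+ (M i j) (y j) (z j)))
                       (∑-distrib-+ (λ j → M i j *ᶻ y j) (λ j → M i j *ᶻ z j))

  *ᵛ-0 : ∀ {m n} (M : Matrix m n) i → (M *ᵛ λ _ → 0ℤ) i ≡ 0ℤ
  *ᵛ-0 M i = ℤ₊.identityʳ-unique _ _ (sym (*ᵛ-+ M (λ _ → 0ℤ) (λ _ → 0ℤ) i))

  *ᵛ-neg : ∀ {m n} (M : Matrix m n) z i → (M *ᵛ λ j → - z j) i ≡ - (M *ᵛ z) i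
  *ᵛ-neg M z i = ℤ₊.inverseʳ-unique _ _ (begin
    (M *ᵛ z) i +ᶻ (M *ᵛ λ j → - z j) i ≡⟨ *ᵛ-+ M z (λ j → - z j) i ⟨
    (M *ᵛ λ j → z j +ᶻ - z j) i        ≡⟨ sum-cong-≗ (λ j → cong (M i j *ᶻ_) (ℤ.+-inverseʳ (z j))) ⟩
    (M *ᵛ λ _ → 0ℤ) i                  ≡⟨ *ᵛ-0 M i ⟩
    0ℤ                                 ∎)
    where open ≡-Reasoning

-- ℤᵐ / M ℤⁿ, as a setoid quotient of ℤᵐ.
coker : ∀ {m n} → Matrix m n → AbelianGroup 0ℓ 0ℓ
coker {m} {n} M = record
  { Carrier = Fin m → ℤ
  ; _≈_     = _≈_
  ; _∙_     = ℤᵐ._∙_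
  ; ε       = ℤᵐ.ε
  ; _⁻¹     = ℤᵐ._⁻¹
  ; isAbelianGroup = record
    { isGroup = record
      { isMonoid = record
        { isSemigroup = record
          { isMagma = record
            { isEquivalence = record
              { refl  = λ {x} → ≡⇒≈ {x} {x} λ _ → refl
              ; sym   = λ {x} {y} (z , eq) → (λ j → - z j) , λ i →
                  trans (swap (x i) (y i)) (trans (cong -_ (eq i)) (sym (*ᵛ-neg M z i)))
              ; trans = λ {x} {y} {w} (z , eq) (z′ , eq′) → (λ j → z j +ᶻ z′ j) , λ i →
                  trans (split (x i) (y i) (w i)) (trans (cong₂ _+ᶻ_ (eq i) (eq′ i)) (sym (*ᵛ-+ M z z′ i)))
              }
            ; ∙-cong = λ {x} {y} {v} {w} (z , eq) (z′ , eq′) → (λ j → z j +ᶻ z′ j) , λ i →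
                trans (interchange (x i) (y i) (v i) (w i)) (trans (cong₂ _+ᶻ_ (eq i) (eq′ i)) (sym (*ᵛ-+ M z z′ i)))
            }
          ; assoc = λ x y z → ≡⇒≈ (ℤᵐ.assoc x y z)
          }
        ; identity = (λ x → ≡⇒≈ (ℤᵐ.identityˡ x)) , (λ x → ≡⇒≈ (ℤᵐ.identityʳ x))
        }
      ; inverse = (λ x → ≡⇒≈ (ℤᵐ.inverseˡ x)) , (λ x → ≡⇒≈ (ℤᵐ.inverseʳ x))
      ; ⁻¹-cong = λ {x} {y} (z , eq) → (λ j → - z j) , λ i →
          trans (sym (ℤ.neg-distrib-+ (x i) (- y i))) (trans (cong -_ (eq i)) (sym (*ᵛ-neg M z i)))
      }
    ; comm = λ x y → ≡⇒≈ (ℤᵐ.comm x y)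
    }
  }
  where
  module ℤᵐ = AbelianGroup (Pointwise.abelianGroup (Fin m) ℤ.+-0-abelianGroup)

  _≈_ : (Fin m → ℤ) → (Fin m → ℤ) → Set
  x ≈ y = ∃[ z ] (∀ i → x i -ᶻ y i ≡ (M *ᵛ z) i)

  ≡⇒≈ : ∀ {x y} → (∀ i → x i ≡ y i) → x ≈ y
  ≡⇒≈ {x} {y} eq = (λ _ → 0ℤ) , λ i → trans (ℤ.i≡j⇒i-j≡0 (eq i)) (sym (*ᵛ-0 M i))

  swap : ∀ x y → y -ᶻ x ≡ - (x -ᶻ y)
  swap = solve-∀

  split : ∀ x y w → x -ᶻ w ≡ (x -ᶻ y) +ᶻ (y -ᶻ w)
  split = solve-∀

  interchange : ∀ x y v w → (x +ᶻ v) -ᶻ (y +ᶻ w) ≡ (x -ᶻ y) +ᶻ (v -ᶻ w)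
  interchange = solve-∀

module _ {c ℓ} (G : AbelianGroup c ℓ) where
  open AbelianGroup G
  open Mult monoid using () renaming (_×_ to _×ᴳ_)
  open CommutativeMonoidSum commutativeMonoid using () renaming (sum to sumᴳ)

  _·_ : ℤ → Carrier → Carrier
  (+ n)    · g = n ×ᴳ g
  -[1+ n ] · g = (suc n ×ᴳ g) ⁻¹

  Independent : ∀ {k} → (Fin k → Carrier) → Set ℓ
  Independent {k} g = ∀ (a : Fin k → ℤ) → sumᴳ (λ i → a i · g i) ≈ ε → ∀ i → a i ≡ 0ℤ

  HasRank : ℕ → Set (c ⊔ ℓ)
  HasRank b = (∃ λ (g : Fin b → Carrier) → Independent g)
            × (∀ k (g : Fin k → Carrier) → Independent g → k ≤ b)

------------------------------------------------------------------------
-- The defect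

adjacency : (Y : Digraph) → Matrix (Digraph.order Y) (Digraph.order Y)
adjacency Y i j = + length (filter (λ e → (o e ≟V vertex j) ×-dec (t e ≟V vertex i)) edges)
  where open Digraph Y

Id : ∀ {s} → Matrix s s
Id i j = if does (i Fin.≟ j) then 1ℤ else 0ℤ

BF : Digraph → AbelianGroup 0ℓ 0ℓ
BF Y = coker (λ i j → Id i j -ᶻ adjacency Y i j)

-- δ(Y) = d.  As a(Y) and b(Y) are determined by properties rather than by an
-- algorithm, so is δ(Y).
HasDefect : Digraph → ℤ → Set
HasDefect Y d = ∃[ k ] ∃[ b ] (HasOrderAt 1ℤ (zeta Y) k × HasRank (BF Y) b × d ≡ (- k) -ᶻ + b)

{-# OPTIONS --safe #-}
module Submission where

-- Write q = pⁿ, let A be the adjacency matrix of X and r its order.  As τ is a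
-- unit, Xₙ is X times a directed cycle of length q.  Hence the closed walks of
-- length m in Xₙ number q tr(Aᵐ) if q ∣ m and 0 otherwise; as every cycle is a
-- power of a unique primitive one, this gives u Z′/Z for Z = Z(Xₙ), and Jacobi's
-- formula gives Z = 1 / det(1 - u^q A^q).  Likewise BF(Xₙ) ≅ ℤʳ / (1 - A^q).
-- Passing from n to n + 1 multiplies 1 - u^q A^q by Φ(uA), where Φ is the
-- cyclotomic polynomial of order pⁿ⁺¹.  If deg Φ > r then Φ(A) is injective on ℤʳ:
-- a vector v in its kernel is killed by a polynomial of degree ≤ r (Krylov), and
-- since Φ is Eisenstein in u - 1 this forces p ∣ v, so that v = 0 by descent.
-- Then det Φ(A) ≠ 0 and neither the order at u = 1 nor the rank changes.

open import Defs
open import Algebra.Bundles using (AbelianGroup; CommutativeRing)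
import Algebra.Construct.Pointwise as Pointwise
import Algebra.Morphism.RingMonomorphism as RingMonomorphism
import Algebra.Properties.Ring as RingProperties
import Algebra.Properties.Semiring.Exp as Exponentiation
import Algebra.Properties.Semiring.Mult as SemiringMult
import Algebra.Properties.Semiring.Sum as SemiringSum
import Algebra.Solver.Ring as RingSolver
open import Algebra.Solver.Ring.AlmostCommutativeRing using (fromCommutativeRing; _-Raw-AlmostCommutative⟶_)
open import Algebra.Structures using (IsCommutativeRing)
open import Data.Bool.Base using (if_then_else_)
open import Data.Empty using (⊥; ⊥-elim)
open import Data.Fin.Base as Fin using (Fin; zero; suc; toℕ; fromℕ<; inject₁; punchIn; punchOut; combine; remQuot)
import Data.Fin.Properties as Fin
open import Data.Integer.Base using (ℤ; +_; -[1+_]; 0ℤ; 1ℤ; -_; ∣_∣; _⊖_) renaming (_+_ to _+ᶻ_; _*_ to _*ᶻ_; _-_ to _-ᶻ_)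
open import Data.Integer.Divisibility.Signed using (divides; ∣ᵤ⇒∣; ∣⇒∣ᵤ) renaming (_∣_ to _∣ᶻ_; _∣?_ to _∣ᶻ?_)
import Data.Integer.Divisibility.Signed as ℤ∣
import Data.Integer.Properties as ℤ
open import Data.Integer.Tactic.RingSolver using (solve-∀)
open import Data.List.Base using (List; []; _∷_; [_]; _++_; map; filter; length; upTo; take; drop; replicate; concat; concatMap; cartesianProductWith; deduplicate; foldr; tabulate; applyUpTo)
import Data.List.Properties as List
open import Data.List.Membership.Propositional using (_∈_; lose; find)
open import Data.List.Membership.Propositional.Properties using (∈-∃++; ∈-++⁺ˡ; ∈-++⁺ʳ; ∈-++⁻; ∈-map⁺; ∈-map⁻; ∈-filter⁺; ∈-filter⁻; ∈-concatMap⁺; ∈-concatMap⁻; ∈-applyUpTo⁺; ∈-applyUpTo⁻; ∈-upTo⁺; ∈-cartesianProductWith⁺; ∈-cartesianProductWith⁻; ∈-allFin)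
open import Data.List.Relation.Unary.All as All using (All; []; _∷_)
import Data.List.Relation.Unary.All.Properties as All
open import Data.List.Relation.Unary.AllPairs as AllPairs using (AllPairs; []; _∷_)
import Data.List.Relation.Unary.AllPairs.Properties as AllPairs
open import Data.List.Relation.Unary.Any using (here; there)
open import Data.List.Relation.Unary.Linked as Linked using (Linked; []; [-]; _∷_)
open import Data.List.Relation.Unary.Unique.Propositional using (Unique)
import Data.List.Relation.Unary.Unique.Propositional.Properties as Unique
open import Data.Maybe.Base using (Maybe; just; nothing)
open import Data.Nat.Base as ℕ using (ℕ; zero; suc; _+_; _*_; _∸_; _^_; _≤_; _<_; _>_; z≤n; s≤s; NonZero)
import Data.Nat.Properties as ℕ
open import Data.Nat.Combinatorics using (_C_; nCk+nC[k+1]≡[n+1]C[k+1]; nCn≡1; nCk≡nC[n∸k]; k>n⇒nCk≡0)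
open import Data.Nat.Coprimality using (coprime?)
import Data.Nat.Divisibility as ℕ∣
import Data.Nat.DivMod as ℕ%
open import Data.Nat.DivMod using (_%_; _mod_)
open import Data.Nat.Primality using (Prime; euclidsLemma; prime⇒nonTrivial; prime⇒nonZero)
open import Data.Product using (∃; ∃-syntax; _×_; _,_; proj₁; proj₂)
open import Data.Sum.Base using (_⊎_; inj₁; inj₂)
open import Data.Vec.Functional using (updateAt; insertAt)
open import Data.Vec.Functional.Properties using (updateAt-updates; updateAt-minimal; insertAt-lookup; insertAt-punchIn)
open import Function.Base using (_∘_; const; case_of_)
open import Function.Bundles using (_⇔_; mk⇔; Equivalence; Inverse)
open import Level using (0ℓ; _⊔_)
import Relation.Binary.Reasoning.Setoid as SetoidReasoning
open import Relation.Binary.Definitions using (tri<; tri≈; tri>)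
open import Relation.Binary.PropositionalEquality as ≡ using (_≡_; _≢_; module ≡-Reasoning)
open import Relation.Nullary using (¬_; Dec; yes; no; does)
open import Relation.Nullary.Decidable using (dec-true; dec-false; ¬?; _×-dec_)

-- Injectivity of `Φ(A)` is usually read off from the irreducibility of Φ over ℚ and the eigenvalues
-- of A. Here everything stays over ℤ: elimination cross-multiplies instead of dividing, and vectors
-- are compared up to nonzero integer multiples. Irreducibility is replaced by a computation with
-- the polynomials P such that `P(A) v = 0`. They form an ideal that is closed under division by p,
-- as ℤʳ is torsion-free. From `Φ = y^d + p g` with `g(1) = 1`, and from a member that modulo p
-- vanishes to order `k < d` at u = 1, one obtains a member congruent modulo p to an integer prime
-- to p. The derivation u d/du stands in for the logarithm of the zeta function, which would bring
-- in denominators: two series with constant term 1 and opposite logarithmic derivatives are inverse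
-- to each other. Determinants occur over ℤ, ℤ[u] and ℤ[[u]], linked by evaluation at 1 and by
-- taking coefficients, so their theory is set up over any commutative ring. As the defect is a
-- relation, existence and uniqueness of the order and of the rank have to be proved too.

-- Determinants and alternating forms over a commutative ring.

module Determinant {c ℓ} (R : CommutativeRing c ℓ) where
  open CommutativeRing R renaming (_+_ to _⊕_; _*_ to _⊗_; -_ to ⊝_; zero to *-zero) hiding (_-_)
  open SemiringSum semiring public
  open RingProperties ring using (-0#≈0#; -‿involutive)
  open SetoidReasoning setoid

  private
    module Mult = SemiringMult semiring

    fromℕ : ℕ → Carrier
    fromℕ n = n Mult.× 1#

    fromℤ : ℤ → Carrier
    fromℤ (+ n)    = fromℕ n
    fromℤ -[1+ n ] = ⊝ fromℕ (suc n)

    fromℤ-⊖ : ∀ m n → fromℤ (m ⊖ n) ≈ fromℕ m ⊕ ⊝ fromℕ n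
    fromℤ-⊖ zero    zero    = sym (trans (+-identityˡ _) -0#≈0#)
    fromℤ-⊖ zero    (suc n) = sym (+-identityˡ _)
    fromℤ-⊖ (suc m) zero    = sym (trans (+-congˡ -0#≈0#) (+-identityʳ _))
    fromℤ-⊖ (suc m) (suc n) = begin
      fromℤ (suc m ⊖ suc n)                              ≡⟨ ≡.cong fromℤ (ℤ.[1+m]⊖[1+n]≡m⊖n m n) ⟩
      fromℤ (m ⊖ n)                                      ≈⟨ fromℤ-⊖ m n ⟩
      fromℕ m ⊕ ⊝ fromℕ n                                ≈⟨ +-congˡ (+-identityˡ _) ⟨
      fromℕ m ⊕ (0# ⊕ ⊝ fromℕ n)                         ≈⟨ +-congˡ (+-congʳ (-‿inverseʳ 1#)) ⟨
      fromℕ m ⊕ ((1# ⊕ ⊝ 1#) ⊕ ⊝ fromℕ n)                ≈⟨ +-congˡ (+-assoc _ _ _) ⟩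
      fromℕ m ⊕ (1# ⊕ (⊝ 1# ⊕ ⊝ fromℕ n))                ≈⟨ +-assoc _ _ _ ⟨
      (fromℕ m ⊕ 1#) ⊕ (⊝ 1# ⊕ ⊝ fromℕ n)                ≈⟨ +-cong (+-comm _ _) (⁻¹-∙-comm 1# (fromℕ n)) ⟩
      (1# ⊕ fromℕ m) ⊕ ⊝ (1# ⊕ fromℕ n)                  ∎
      where open import Algebra.Properties.AbelianGroup +-abelianGroup using (⁻¹-∙-comm)

    fromℤ-+ : ∀ a b → fromℤ (a +ᶻ b) ≈ fromℤ a ⊕ fromℤ b
    fromℤ-+ (+ m)    (+ n)    = Mult.×-homo-+ 1# m n
    fromℤ-+ (+ m)    -[1+ n ] = fromℤ-⊖ m (suc n)
    fromℤ-+ -[1+ m ] (+ n)    = trans (fromℤ-⊖ n (suc m)) (+-comm _ _)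
    fromℤ-+ -[1+ m ] -[1+ n ] = begin
      ⊝ fromℕ (suc (suc (m + n)))                ≡⟨ ≡.cong (λ k → ⊝ fromℕ (suc k)) (ℕ.+-suc m n) ⟨
      ⊝ fromℕ (suc m + suc n)                    ≈⟨ -‿cong (Mult.×-homo-+ 1# (suc m) (suc n)) ⟩
      ⊝ (fromℕ (suc m) ⊕ fromℕ (suc n))          ≈⟨ ⁻¹-∙-comm _ _ ⟨
      ⊝ fromℕ (suc m) ⊕ ⊝ fromℕ (suc n)          ∎
      where open import Algebra.Properties.AbelianGroup +-abelianGroup using (⁻¹-∙-comm)

    fromℤ-neg : ∀ a → fromℤ (- a) ≈ ⊝ fromℤ a
    fromℤ-neg (+ zero)  = sym -0#≈0#
    fromℤ-neg (+ suc n) = refl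
    fromℤ-neg -[1+ n ]  = sym (-‿involutive _)

    fromℤ-* : ∀ a b → fromℤ (a *ᶻ b) ≈ fromℤ a ⊗ fromℤ b
    fromℤ-* (+ m) (+ n) = trans (reflexive (≡.cong fromℤ (≡.sym (ℤ.pos-* m n)))) (Mult.×1-homo-* m n)
    fromℤ-* (+ m) -[1+ n ] = begin
      fromℤ (+ m *ᶻ -[1+ n ])            ≡⟨ ≡.cong fromℤ (ℤ.neg-distribʳ-* (+ m) (+ suc n)) ⟨
      fromℤ (- (+ m *ᶻ + suc n))         ≈⟨ fromℤ-neg (+ m *ᶻ + suc n) ⟩
      ⊝ fromℤ (+ m *ᶻ + suc n)           ≈⟨ -‿cong (fromℤ-* (+ m) (+ suc n)) ⟩
      ⊝ (fromℕ m ⊗ fromℕ (suc n))        ≈⟨ -‿distribʳ-* _ _ ⟩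
      fromℕ m ⊗ ⊝ fromℕ (suc n)          ∎
      where open RingProperties ring
    fromℤ-* -[1+ m ] (+ n) = begin
      fromℤ (-[1+ m ] *ᶻ + n)            ≡⟨ ≡.cong fromℤ (ℤ.neg-distribˡ-* (+ suc m) (+ n)) ⟨
      fromℤ (- (+ suc m *ᶻ + n))         ≈⟨ fromℤ-neg (+ suc m *ᶻ + n) ⟩
      ⊝ fromℤ (+ suc m *ᶻ + n)           ≈⟨ -‿cong (fromℤ-* (+ suc m) (+ n)) ⟩
      ⊝ (fromℕ (suc m) ⊗ fromℕ n)        ≈⟨ -‿distribˡ-* _ _ ⟩
      ⊝ fromℕ (suc m) ⊗ fromℕ n          ∎
      where open RingProperties ring
    fromℤ-* -[1+ m ] -[1+ n ] = begin
      fromℤ (+ suc m *ᶻ + suc n)                   ≈⟨ fromℤ-* (+ suc m) (+ suc n) ⟩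
      fromℕ (suc m) ⊗ fromℕ (suc n)                ≈⟨ [-x][-y]≈xy _ _ ⟨
      ⊝ fromℕ (suc m) ⊗ ⊝ fromℕ (suc n)            ∎
      where open RingProperties ring using (-‿distribˡ-*; -‿distribʳ-*)
            [-x][-y]≈xy : ∀ x y → ⊝ x ⊗ ⊝ y ≈ x ⊗ y
            [-x][-y]≈xy x y = trans (sym (-‿distribˡ-* x (⊝ y))) (trans (-‿cong (sym (-‿distribʳ-* x y))) (-‿involutive _))

    fromℤ-homo : CommutativeRing.rawRing ℤ.+-*-commutativeRing -Raw-AlmostCommutative⟶ fromCommutativeRing R
    fromℤ-homo = record
      { ⟦_⟧ = fromℤ ; +-homo = fromℤ-+ ; *-homo = fromℤ-* ; -‿homo = fromℤ-neg
      ; 0-homo = refl ; 1-homo = +-identityʳ 1# }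

    fromℤ-weakly-decidable : ∀ a b → Maybe (fromℤ a ≈ fromℤ b)
    fromℤ-weakly-decidable a b with a ℤ.≟ b
    ... | yes eq = just (reflexive (≡.cong fromℤ eq))
    ... | no _   = nothing

  -- Integer coefficients make the solver able to cancel terms in an arbitrary ring.
  open RingSolver (CommutativeRing.rawRing ℤ.+-*-commutativeRing) (fromCommutativeRing R) fromℤ-homo
    fromℤ-weakly-decidable
    public using (solve; con; _:=_; _:+_; _:*_; _:-_; :-_)

  Mat : ℕ → Set c
  Mat n = Fin n → Fin n → Carrier

  infix 4 _≋_
  _≋_ : ∀ {n} → Mat n → Mat n → Set ℓ
  M ≋ N = ∀ i j → M i j ≈ N i j

  Agree-off : ∀ {n} → Fin n → Mat n → Mat n → Set ℓ
  Agree-off k M N = ∀ i → i ≢ k → ∀ j → M i j ≈ N i j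

  sgn : ∀ {n} → Fin n → Carrier
  sgn zero    = 1#
  sgn (suc i) = ⊝ sgn i

  minor : ∀ {n} → Mat (suc n) → Fin (suc n) → Mat n
  minor M i a b = M (punchIn i a) (suc b)

  -- Laplace expansion along the first column. A minor then loses one row and keeps the others in
  -- order, so statements about rows pass to minors by induction.
  det : ∀ {n} → Mat n → Carrier
  det {zero}  M = 1#
  det {suc n} M = ∑[ i < suc n ] (sgn i ⊗ (M i zero ⊗ det (minor M i)))

  det-cong : ∀ {n} {M N : Mat n} → M ≋ N → det M ≈ det N
  det-cong {zero}  eq = refl
  det-cong {suc n} eq = sum-cong-≋ λ i →
    *-congˡ {sgn i} (*-cong (eq i zero) (det-cong λ a b → eq (punchIn i a) (suc b)))

  -- Linearity in each row. It relates three matrices that agree off row k, instead of updates of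
  -- one matrix, because that form is inherited by minors.
  Linear : ∀ {n} → (Mat n → Carrier) → Set _
  Linear {n} f = ∀ (k : Fin n) x y {M N P : Mat n} →
    Agree-off k P M → Agree-off k P N → (∀ j → P k j ≈ x ⊗ M k j ⊕ y ⊗ N k j) → f P ≈ x ⊗ f M ⊕ y ⊗ f N

  det-linear : ∀ {n} → Linear (det {n})
  det-linear {suc n} k x y {M} {N} {P} PM PN Pk = begin
    ∑[ i < suc n ] (sgn i ⊗ (P i zero ⊗ det (minor P i)))
      ≈⟨ sum-cong-≋ term ⟩
    ∑[ i < suc n ] (x ⊗ (sgn i ⊗ (M i zero ⊗ det (minor M i))) ⊕ y ⊗ (sgn i ⊗ (N i zero ⊗ det (minor N i))))
      ≈⟨ ∑-distrib-+ (λ i → x ⊗ (sgn i ⊗ (M i zero ⊗ det (minor M i)))) (λ i → y ⊗ (sgn i ⊗ (N i zero ⊗ det (minor N i)))) ⟩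
    _ ≈⟨ +-cong (*-distribˡ-sum x (λ i → sgn i ⊗ (M i zero ⊗ det (minor M i)))) (*-distribˡ-sum y (λ i → sgn i ⊗ (N i zero ⊗ det (minor N i)))) ⟨
    x ⊗ det M ⊕ y ⊗ det N ∎
    where
    term : ∀ i → sgn i ⊗ (P i zero ⊗ det (minor P i)) ≈
      x ⊗ (sgn i ⊗ (M i zero ⊗ det (minor M i))) ⊕ y ⊗ (sgn i ⊗ (N i zero ⊗ det (minor N i)))
    term i with i Fin.≟ k
    ... | yes ≡.refl = begin
      sgn i ⊗ (P i zero ⊗ det (minor P i))
        ≈⟨ *-congˡ (*-congʳ (Pk zero)) ⟩
      sgn i ⊗ ((x ⊗ M i zero ⊕ y ⊗ N i zero) ⊗ det (minor P i))
        ≈⟨ solve 6 (λ s x y m n d → s :* ((x :* m :+ y :* n) :* d) := x :* (s :* (m :* d)) :+ y :* (s :* (n :* d))) refl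
             (sgn i) x y (M i zero) (N i zero) (det (minor P i)) ⟩
      x ⊗ (sgn i ⊗ (M i zero ⊗ det (minor P i))) ⊕ y ⊗ (sgn i ⊗ (N i zero ⊗ det (minor P i)))
        ≈⟨ +-cong (*-congˡ (*-congˡ (*-congˡ (det-cong λ a b → PM _ (Fin.punchInᵢ≢i i a) (suc b)))))
                  (*-congˡ (*-congˡ (*-congˡ (det-cong λ a b → PN _ (Fin.punchInᵢ≢i i a) (suc b))))) ⟩
      _ ∎
    ... | no i≢k = begin
      sgn i ⊗ (P i zero ⊗ det (minor P i))
        ≈⟨ *-congˡ (*-congˡ (det-linear (punchOut i≢k) x y (off PM) (off PN) row)) ⟩
      sgn i ⊗ (P i zero ⊗ (x ⊗ det (minor M i) ⊕ y ⊗ det (minor N i)))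
        ≈⟨ solve 6 (λ s x y p m n → s :* (p :* (x :* m :+ y :* n)) := x :* (s :* (p :* m)) :+ y :* (s :* (p :* n))) refl
             (sgn i) x y (P i zero) (det (minor M i)) (det (minor N i)) ⟩
      x ⊗ (sgn i ⊗ (P i zero ⊗ det (minor M i))) ⊕ y ⊗ (sgn i ⊗ (P i zero ⊗ det (minor N i)))
        ≈⟨ +-cong (*-congˡ (*-congˡ (*-congʳ (PM i i≢k zero)))) (*-congˡ (*-congˡ (*-congʳ (PN i i≢k zero)))) ⟩
      _ ∎
      where
      off : ∀ {Q} → Agree-off k P Q → Agree-off (punchOut i≢k) (minor P i) (minor Q i)
      off PQ a a≢ b = PQ (punchIn i a) (λ eq → a≢ (Fin.punchIn-injective i a _ (≡.trans eq (≡.sym (Fin.punchIn-punchOut i≢k))))) (suc b)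
      row : ∀ b → minor P i (punchOut i≢k) b ≈ x ⊗ minor M i (punchOut i≢k) b ⊕ y ⊗ minor N i (punchOut i≢k) b
      row b = ≡.subst (λ l → P l (suc b) ≈ x ⊗ M l (suc b) ⊕ y ⊗ N l (suc b)) (≡.sym (Fin.punchIn-punchOut i≢k)) (Pk (suc b))

  sum-adjacent : ∀ {n} (i : Fin n) (f : Fin (suc n) → Carrier) → f (inject₁ i) ⊕ f (suc i) ≈ 0# →
                 (∀ j → j ≢ inject₁ i → j ≢ suc i → f j ≈ 0#) → sum f ≈ 0#
  sum-adjacent {suc n} zero f pair rest = begin
    f zero ⊕ (f (suc zero) ⊕ sum (λ j → f (suc (suc j))))
      ≈⟨ +-assoc _ _ _ ⟨
    (f zero ⊕ f (suc zero)) ⊕ sum (λ j → f (suc (suc j)))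
      ≈⟨ +-cong pair (sum-cong-≋ λ j → rest (suc (suc j)) (λ ()) (λ ())) ⟩
    0# ⊕ sum {n} (λ _ → 0#)  ≈⟨ +-identityˡ _ ⟩
    sum {n} (λ _ → 0#)       ≈⟨ sum-replicate-zero n ⟩
    0#                       ∎
  sum-adjacent {suc n} (suc i) f pair rest = trans
    (+-cong (rest zero (λ ()) (λ ()))
            (sum-adjacent i (f ∘ suc) pair λ j j≢ j≢′ → rest (suc j) (j≢ ∘ Fin.suc-injective) (j≢′ ∘ Fin.suc-injective)))
    (+-identityˡ 0#)

  -- Neighbouring rows stay neighbours in a minor that removes neither of them. This is what lets
  -- `det-adjacent` recurse into minors.
  punchIn-adjacent : ∀ {n} (j : Fin (suc (suc n))) (k : Fin (suc n)) → j ≢ inject₁ k → j ≢ suc k →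
    ∃ λ (l : Fin n) → punchIn j (inject₁ l) ≡ inject₁ k × punchIn j (suc l) ≡ suc k
  punchIn-adjacent zero zero j≢ _ = ⊥-elim (j≢ ≡.refl)
  punchIn-adjacent zero (suc k) _ _ = k , ≡.refl , ≡.refl
  punchIn-adjacent (suc zero) zero _ j≢ = ⊥-elim (j≢ ≡.refl)
  punchIn-adjacent {suc n} (suc (suc j)) zero _ _ = zero , ≡.refl , ≡.refl
  punchIn-adjacent {suc zero} (suc zero) (suc zero) j≢ _ = ⊥-elim (j≢ ≡.refl)
  punchIn-adjacent {suc zero} (suc (suc zero)) (suc zero) _ j≢ = ⊥-elim (j≢ ≡.refl)
  punchIn-adjacent {suc (suc n)} (suc j) (suc k) j≢ j≢′
    with l , eq , eq′ ← punchIn-adjacent j k (j≢ ∘ ≡.cong suc) (j≢′ ∘ ≡.cong suc) =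
    suc l , ≡.cong suc eq , ≡.cong suc eq′

  sgn-inject₁ : ∀ {n} (i : Fin n) → sgn (inject₁ i) ≡ sgn i
  sgn-inject₁ zero    = ≡.refl
  sgn-inject₁ (suc i) = ≡.cong ⊝_ (sgn-inject₁ i)

  -- Removing one or the other of two neighbouring indices leaves the same enumeration, except at
  -- the place where the surviving neighbour stands.
  punchIn-inject₁-suc : ∀ {n} (i a : Fin n) →
    (punchIn (inject₁ i) a ≡ punchIn (suc i) a) ⊎ (punchIn (inject₁ i) a ≡ suc i × punchIn (suc i) a ≡ inject₁ i)
  punchIn-inject₁-suc zero    zero    = inj₂ (≡.refl , ≡.refl)
  punchIn-inject₁-suc zero    (suc a) = inj₁ ≡.refl
  punchIn-inject₁-suc (suc i) zero    = inj₁ ≡.refl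
  punchIn-inject₁-suc (suc i) (suc a) with punchIn-inject₁-suc i a
  ... | inj₁ eq         = inj₁ (≡.cong suc eq)
  ... | inj₂ (eq , eq′) = inj₂ (≡.cong suc eq , ≡.cong suc eq′)

  -- In the first-column expansion the terms of the two equal rows have equal minors and opposite
  -- signs, so they cancel; every other minor again has two equal adjacent rows.
  det-adjacent : ∀ {n} (i : Fin n) (M : Mat (suc n)) → (∀ j → M (inject₁ i) j ≈ M (suc i) j) → det M ≈ 0#
  minor-adjacent : ∀ {n} (M : Mat (suc n)) (j : Fin (suc n)) (i : Fin n) → j ≢ inject₁ i → j ≢ suc i →
           (∀ b → M (inject₁ i) b ≈ M (suc i) b) → det (minor M j) ≈ 0#

  det-adjacent {n} i M eq = sum-adjacent i (λ k → sgn k ⊗ (M k zero ⊗ det (minor M k))) pair rest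
    where
    minors : minor M (inject₁ i) ≋ minor M (suc i)
    minors a b with punchIn-inject₁-suc i a
    ... | inj₁ eq′ = reflexive (≡.cong (λ k → M k (suc b)) eq′)
    ... | inj₂ (eq₁ , eq₂) = begin
      M (punchIn (inject₁ i) a) (suc b) ≡⟨ ≡.cong (λ k → M k (suc b)) eq₁ ⟩
      M (suc i) (suc b)                 ≈⟨ eq (suc b) ⟨
      M (inject₁ i) (suc b)             ≡⟨ ≡.cong (λ k → M k (suc b)) eq₂ ⟨
      M (punchIn (suc i) a) (suc b)     ∎
    pair : sgn (inject₁ i) ⊗ (M (inject₁ i) zero ⊗ det (minor M (inject₁ i))) ⊕
           sgn (suc i) ⊗ (M (suc i) zero ⊗ det (minor M (suc i))) ≈ 0#
    pair = begin
      _ ≈⟨ +-congʳ (*-cong (reflexive (sgn-inject₁ i)) (*-cong (eq zero) (det-cong minors))) ⟩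
      _ ≈⟨ solve 3 (λ s x d → s :* (x :* d) :+ (:- s) :* (x :* d) := con 0ℤ) refl (sgn i) (M (suc i) zero) (det (minor M (suc i))) ⟩
      0# ∎
    rest : ∀ j → j ≢ inject₁ i → j ≢ suc i → sgn j ⊗ (M j zero ⊗ det (minor M j)) ≈ 0#
    rest j j≢ j≢′ = begin
      _ ≈⟨ *-congˡ (*-congˡ (minor-adjacent M j i j≢ j≢′ eq)) ⟩
      _ ≈⟨ *-congˡ (zeroʳ _) ⟩
      _ ≈⟨ zeroʳ _ ⟩
      0# ∎

  minor-adjacent {suc zero} M zero zero j≢ _ _ = ⊥-elim (j≢ ≡.refl)
  minor-adjacent {suc zero} M (suc zero) zero _ j≢ _ = ⊥-elim (j≢ ≡.refl)
  minor-adjacent {suc (suc n)} M j i j≢ j≢′ eq =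
    let l , eq₁ , eq₂ = punchIn-adjacent j i j≢ j≢′ in
    det-adjacent l (minor M j) λ b → begin
      M (punchIn j (inject₁ l)) (suc b) ≡⟨ ≡.cong (λ k → M k (suc b)) eq₁ ⟩
      M (inject₁ i) (suc b)             ≈⟨ eq (suc b) ⟩
      M (suc i) (suc b)                 ≡⟨ ≡.cong (λ k → M k (suc b)) eq₂ ⟨
      M (punchIn j (suc l)) (suc b)     ∎

  det-first-column : ∀ {n} (M : Mat (suc n)) → (∀ i → M (suc i) zero ≈ 0#) → det M ≈ M zero zero ⊗ det (minor M zero)
  det-first-column {n} M below = begin
    1# ⊗ (M zero zero ⊗ det (minor M zero)) ⊕ ∑[ i < n ] (sgn (suc i) ⊗ (M (suc i) zero ⊗ det (minor M (suc i))))
      ≈⟨ +-cong (*-identityˡ _) (sum-cong-≋ {n} λ i → trans (*-congˡ {sgn (suc i)} (trans (*-congʳ (below i)) (zeroˡ _))) (zeroʳ _)) ⟩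
    M zero zero ⊗ det (minor M zero) ⊕ ∑[ i < n ] 0#
      ≈⟨ trans (+-congˡ (sum-replicate-zero n)) (+-identityʳ _) ⟩
    M zero zero ⊗ det (minor M zero) ∎

  det-Id : ∀ {n} {M : Mat n} → (∀ i → M i i ≈ 1#) → (∀ i j → i ≢ j → M i j ≈ 0#) → det M ≈ 1#
  det-Id {zero} _ _ = refl
  det-Id {suc n} {M} diag off = trans (det-first-column M λ i → off (suc i) zero λ ())
    (trans (*-cong (diag zero) (det-Id (λ i → diag (suc i)) λ i j i≢j → off _ _ (i≢j ∘ Fin.suc-injective))) (*-identityˡ 1#))

  infixl 5 _[_≔_]
  _[_≔_] : ∀ {n} → Mat n → Fin n → (Fin n → Carrier) → Mat n
  M [ k ≔ v ] = updateAt M k (const v)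

  at : ∀ {n} (M : Mat n) k v → ∀ j → (M [ k ≔ v ]) k j ≈ v j
  at M k v j = reflexive (≡.cong (λ w → w j) (updateAt-updates k M))

  off : ∀ {n} (M : Mat n) k v → Agree-off k (M [ k ≔ v ]) M
  off M k v i i≢k j = reflexive (≡.cong (λ w → w j) (updateAt-minimal i k M i≢k))

  -- Abstracted from `det` because `det-∙` applies it to another form. Only adjacent equal rows are
  -- demanded, which is what Laplace expansion gives directly; arbitrary pairs of rows follow below.
  record Alternating {n} (f : Mat n → Carrier) : Set (c ⊔ ℓ) where
    field
      cong     : ∀ {M N} → M ≋ N → f M ≈ f N
      linear   : Linear f
      adjacent : ∀ a b → toℕ b ≡ suc (toℕ a) → ∀ {M} → (∀ j → M a j ≈ M b j) → f M ≈ 0#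

    -- Polarisation: with rows x, y replaced by x + y, x + y the form vanishes, and expanding leaves
    -- f(x, y) + f(y, x) = 0. Vanishing on equal rows is an argument, so that the lemma is available
    -- for adjacent rows before it is known for all pairs.
    swap : ∀ {a b} → a ≢ b → (∀ {M} → (∀ j → M a j ≈ M b j) → f M ≈ 0#) → ∀ {M N} →
      (∀ j → N a j ≈ M b j) → (∀ j → N b j ≈ M a j) → (∀ i → i ≢ a → i ≢ b → ∀ j → N i j ≈ M i j) → f N ≈ ⊝ f M
    swap {a} {b} a≢b vanish {M} {N} Na Nb Nrest = begin
      f N            ≈⟨ cong N≋ ⟩
      f (F y x)      ≈⟨ solve 2 (λ u v → u := :- v :+ (v :+ u)) refl (f (F y x)) (f (F x y)) ⟩
      ⊝ f (F x y) ⊕ (f (F x y) ⊕ f (F y x)) ≈⟨ +-congˡ total ⟨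
      ⊝ f (F x y) ⊕ f (F s s)               ≈⟨ +-congˡ (vanish (λ j → trans (Fa s s j) (sym (Fb s s j)))) ⟩
      ⊝ f (F x y) ⊕ 0#                      ≈⟨ +-identityʳ _ ⟩
      ⊝ f (F x y)                           ≈⟨ -‿cong (cong M≋) ⟨
      ⊝ f M ∎
      where
      x y s : Fin n → Carrier
      x = M a
      y = M b
      s j = x j ⊕ y j
      F : (Fin n → Carrier) → (Fin n → Carrier) → Mat n
      F v w = M [ b ≔ w ] [ a ≔ v ]
      Fa : ∀ v w j → F v w a j ≈ v j
      Fa v w = at (M [ b ≔ w ]) a v
      Fb : ∀ v w j → F v w b j ≈ w j
      Fb v w j = trans (off (M [ b ≔ w ]) a v b (a≢b ∘ ≡.sym) j) (at M b w j)
      Frest : ∀ v w i → i ≢ a → i ≢ b → ∀ j → F v w i j ≈ M i j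
      Frest v w i i≢a i≢b j = trans (off (M [ b ≔ w ]) a v i i≢a j) (off M b w i i≢b j)
      by-rows : ∀ {P Q : Mat n} → (∀ j → P a j ≈ Q a j) → (∀ j → P b j ≈ Q b j) → (∀ i → i ≢ a → i ≢ b → ∀ j → P i j ≈ Q i j) → P ≋ Q
      by-rows p q r i j with i Fin.≟ a | i Fin.≟ b
      ... | yes ≡.refl | _ = p j
      ... | no _ | yes ≡.refl = q j
      ... | no i≢a | no i≢b = r i i≢a i≢b j
      N≋ : N ≋ F y x
      N≋ = by-rows (λ j → trans (Na j) (sym (Fa y x j))) (λ j → trans (Nb j) (sym (Fb y x j))) (λ i p q j → trans (Nrest i p q j) (sym (Frest y x i p q j)))
      M≋ : M ≋ F x y
      M≋ = by-rows (λ j → sym (Fa x y j)) (λ j → sym (Fb x y j)) (λ i p q j → sym (Frest x y i p q j))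
      one* : ∀ u v → u ⊕ v ≈ 1# ⊗ u ⊕ 1# ⊗ v
      one* u v = sym (+-cong (*-identityˡ u) (*-identityˡ v))
      additive-a : ∀ w → f (F s w) ≈ f (F x w) ⊕ f (F y w)
      additive-a w = trans (linear a 1# 1#
        (λ i i≢a j → trans (off (M [ b ≔ w ]) a s i i≢a j) (sym (off (M [ b ≔ w ]) a x i i≢a j)))
        (λ i i≢a j → trans (off (M [ b ≔ w ]) a s i i≢a j) (sym (off (M [ b ≔ w ]) a y i i≢a j)))
        (λ j → trans (Fa s w j) (trans (one* _ _) (+-cong (*-congˡ (sym (Fa x w j))) (*-congˡ (sym (Fa y w j))))))) (sym (one* _ _))
      off-b : ∀ v w w′ → Agree-off b (F v w) (F v w′)
      off-b v w w′ i i≢b j with i Fin.≟ a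
      ... | yes ≡.refl = trans (Fa v w j) (sym (Fa v w′ j))
      ... | no i≢a = trans (Frest v w i i≢a i≢b j) (sym (Frest v w′ i i≢a i≢b j))
      additive-b : ∀ v → f (F v s) ≈ f (F v x) ⊕ f (F v y)
      additive-b v = trans (linear b 1# 1# (off-b v s x) (off-b v s y)
        (λ j → trans (Fb v s j) (trans (one* _ _) (+-cong (*-congˡ (sym (Fb v x j))) (*-congˡ (sym (Fb v y j))))))) (sym (one* _ _))
      diagonal : ∀ v → f (F v v) ≈ 0#
      diagonal v = vanish λ j → trans (Fa v v j) (sym (Fb v v j))
      total : f (F s s) ≈ f (F x y) ⊕ f (F y x)
      total = begin
        f (F s s)                                            ≈⟨ additive-a s ⟩
        f (F x s) ⊕ f (F y s)                                ≈⟨ +-cong (additive-b x) (additive-b y) ⟩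
        (f (F x x) ⊕ f (F x y)) ⊕ (f (F y x) ⊕ f (F y y))    ≈⟨ +-cong (+-congʳ (diagonal x)) (+-congˡ (diagonal y)) ⟩
        (0# ⊕ f (F x y)) ⊕ (f (F y x) ⊕ 0#)                  ≈⟨ +-cong (+-identityˡ _) (+-identityʳ _) ⟩
        f (F x y) ⊕ f (F y x)                                ∎

    private
      -- Exchanging row b with the row just above it brings the two equal rows one step closer and
      -- only changes the sign.
      alternating-< : ∀ gap a b → toℕ b ≡ suc (gap + toℕ a) → ∀ {M} → (∀ j → M a j ≈ M b j) → f M ≈ 0#
      alternating-< zero a b eq rows = adjacent a b eq rows
      alternating-< (suc gap) a (suc c) eq {M} rows = begin
        f M       ≈⟨ solve 1 (λ x → x := :- (:- x)) refl (f M) ⟩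
        ⊝ ⊝ f M   ≈⟨ -‿cong (swap b′≢b (adjacent b′ b eq′) (at′ M) (at (M [ b′ ≔ M b ]) b (M b′)) (rest M)) ⟨
        ⊝ f M′    ≈⟨ -‿cong (alternating-< gap a b′ (≡.trans (Fin.toℕ-inject₁ c) (ℕ.suc-injective eq)) rows′) ⟩
        ⊝ 0#      ≈⟨ -0#≈0# ⟩
        0#        ∎
        where
        b b′ : Fin n
        b = suc c
        b′ = inject₁ c
        eq′ : toℕ b ≡ suc (toℕ b′)
        eq′ = ≡.cong suc (≡.sym (Fin.toℕ-inject₁ c))
        b′≢b : b′ ≢ b
        b′≢b e = ℕ.1+n≢n (≡.sym (≡.trans (≡.cong toℕ e) eq′))
        a≢b : a ≢ b
        a≢b e = ℕ.m≢1+n+m (toℕ a) (≡.trans (≡.cong toℕ e) eq)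
        a≢b′ : a ≢ b′
        a≢b′ e = ℕ.m≢1+n+m (toℕ a) (≡.trans (≡.cong toℕ e) (≡.trans (Fin.toℕ-inject₁ c) (ℕ.suc-injective eq)))
        M′ : Mat n
        M′ = M [ b′ ≔ M b ] [ b ≔ M b′ ]
        at′ : ∀ M j → (M [ b′ ≔ M b ] [ b ≔ M b′ ]) b′ j ≈ M b j
        at′ M j = trans (off (M [ b′ ≔ M b ]) b (M b′) b′ b′≢b j) (at M b′ (M b) j)
        rest : ∀ M i → i ≢ b′ → i ≢ b → ∀ j → (M [ b′ ≔ M b ] [ b ≔ M b′ ]) i j ≈ M i j
        rest M i p q j = trans (off (M [ b′ ≔ M b ]) b (M b′) i q j) (off M b′ (M b) i p j)
        rows′ : ∀ j → M′ a j ≈ M′ b′ j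
        rows′ j = trans (rest M a a≢b′ a≢b j) (trans (rows j) (sym (at′ M j)))

    alternating : ∀ {a b} → a ≢ b → ∀ {M} → (∀ j → M a j ≈ M b j) → f M ≈ 0#
    alternating {a} {b} a≢b rows with ℕ.<-cmp (toℕ a) (toℕ b)
    ... | tri< a<b _ _ = alternating-< (toℕ b ∸ suc (toℕ a)) a b (≡.sym (≡.trans (≡.sym (ℕ.+-suc _ _)) (ℕ.m∸n+n≡m a<b))) rows
    ... | tri≈ _ eq _  = ⊥-elim (a≢b (Fin.toℕ-injective eq))
    ... | tri> _ _ b<a = alternating-< (toℕ a ∸ suc (toℕ b)) b a (≡.sym (≡.trans (≡.sym (ℕ.+-suc _ _)) (ℕ.m∸n+n≡m b<a))) (λ j → sym (rows j))

    expand : ∀ {m} (x : Fin m → Carrier) (v : Fin m → Fin n → Carrier) M k →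
      f (M [ k ≔ (λ j → ∑[ l < m ] (x l ⊗ v l j)) ]) ≈ ∑[ l < m ] (x l ⊗ f (M [ k ≔ v l ]))
    expand {zero} x v M k = trans
      -- The empty combination is the zero row, which is 0 times a row of `M` plus 0 times the same
      -- row.
      (linear k 0# 0# {M} {M} (off M k _) (off M k _) λ j → trans (at M k _ j) (sym (trans (+-cong (zeroˡ _) (zeroˡ _)) (+-identityʳ 0#))))
      (trans (+-cong (zeroˡ _) (zeroˡ _)) (+-identityʳ 0#))
    expand {suc m} x v M k = begin
      f (M [ k ≔ (λ j → x zero ⊗ v zero j ⊕ tail j) ])
        ≈⟨ linear k (x zero) 1# (agree (v zero)) (agree tail)
             (λ j → trans (at M k _ j) (+-cong (*-congˡ (sym (at M k _ j))) (trans (sym (at M k tail j)) (sym (*-identityˡ _))))) ⟩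
      x zero ⊗ f (M [ k ≔ v zero ]) ⊕ 1# ⊗ f (M [ k ≔ tail ])
        ≈⟨ +-congˡ (trans (*-identityˡ _) (expand (λ l → x (suc l)) (λ l → v (suc l)) M k)) ⟩
      _ ∎
      where
      tail : Fin n → Carrier
      tail j = ∑[ l < m ] (x (suc l) ⊗ v (suc l) j)
      agree : ∀ {w} w′ → Agree-off k (M [ k ≔ w ]) (M [ k ≔ w′ ])
      agree w′ i i≢k j = trans (off M k _ i i≢k j) (sym (off M k w′ i i≢k j))

-- Multiplicativity of the determinant and Jacobi's formula.

module DeterminantTheorems {c ℓ} (R : CommutativeRing c ℓ) where
  open Determinant R public
  open CommutativeRing R renaming (_+_ to _⊕_; _*_ to _⊗_; -_ to ⊝_; zero to *-zero) hiding (_-_)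
  open RingProperties ring using (-0#≈0#)
  open SetoidReasoning setoid

  det-alternating : ∀ {n} → Alternating (det {n})
  det-alternating {n} = record
    { cong = det-cong ; linear = det-linear ; adjacent = adjacent }
    where
    adjacent : ∀ {n} (a b : Fin n) → toℕ b ≡ suc (toℕ a) → ∀ {M : Mat n} → (∀ j → M a j ≈ M b j) → det M ≈ 0#
    adjacent a (suc c) eq {M} rows = det-adjacent c M λ j → trans (reflexive (≡.cong (λ l → M l j) inj)) (rows j)
      where
      inj : inject₁ c ≡ a
      inj = Fin.toℕ-injective (≡.trans (Fin.toℕ-inject₁ c) (ℕ.suc-injective eq))

  𝟙 : ∀ {n} → Mat n
  𝟙 i j = if does (i Fin.≟ j) then 1# else 0#

  𝟙-diag : ∀ {n} (i : Fin n) → 𝟙 i i ≈ 1#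
  𝟙-diag i = reflexive (≡.cong (if_then 1# else 0#) (dec-true (i Fin.≟ i) ≡.refl))

  𝟙-off : ∀ {n} (i j : Fin n) → i ≢ j → 𝟙 i j ≈ 0#
  𝟙-off i j i≢j = reflexive (≡.cong (if_then 1# else 0#) (dec-false (i Fin.≟ j) i≢j))

  sum-zero : ∀ {n} {f : Fin n → Carrier} → (∀ i → f i ≈ 0#) → sum f ≈ 0#
  sum-zero {n} eq = trans (sum-cong-≋ eq) (sum-replicate-zero n)

  sum-single : ∀ {n} (k : Fin n) (f : Fin n → Carrier) → (∀ i → i ≢ k → f i ≈ 0#) → sum f ≈ f k
  sum-single {suc n} k f rest = trans (sum-remove f)
    (trans (+-congˡ (sum-zero λ i → rest (punchIn k i) (Fin.punchInᵢ≢i k i))) (+-identityʳ _))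

  sum-𝟙ʳ : ∀ {n} (f : Fin n → Carrier) j → ∑[ l < n ] (f l ⊗ 𝟙 l j) ≈ f j
  sum-𝟙ʳ f j = trans (sum-single j (λ l → f l ⊗ 𝟙 l j) (λ l l≢j → trans (*-congˡ (𝟙-off l j l≢j)) (zeroʳ _)))
    (trans (*-congˡ (𝟙-diag j)) (*-identityʳ _))

  infixl 7 _∙_
  _∙_ : ∀ {n} → Mat n → Mat n → Mat n
  _∙_ {n} M N i j = ∑[ k < n ] (M i k ⊗ N k j)

  tr : ∀ {n} → Mat n → Carrier
  tr {n} M = ∑[ i < n ] M i i

  missed⇒collision : ∀ {n} (s : Fin n → Fin n) k → ¬ (∃ λ a → s a ≡ k) → ∃ λ i → ∃ λ j → i Fin.< j × s i ≡ s j
  missed⇒collision {suc n} s k k∉s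
    with i , j , i<j , eq ← Fin.pigeonhole (ℕ.n<1+n n) (λ i → punchOut {i = k} {j = s i} (λ e → k∉s (i , ≡.sym e))) =
    i , j , i<j , Fin.punchOut-injective (λ e → k∉s (i , ≡.sym e)) (λ e → k∉s (j , ≡.sym e)) eq

  module _ {n} {f : Mat n → Carrier} (alt : Alternating f) (f𝟙 : f 𝟙 ≈ 0#) where
    open Alternating alt

    private
      -- The first m rows are not yet known to be those of the identity.
      permuted : ∀ m → m ≤ n → (s : Fin n → Fin n) → (∀ i → m ≤ toℕ i → s i ≡ i) → f (λ i → 𝟙 (s i)) ≈ 0#
      permuted zero _ s fixed = trans (cong λ i j → reflexive (≡.cong (λ k → 𝟙 k j) (fixed i z≤n))) f𝟙
      permuted (suc m) m<n s fixed = by-cases s fixed (Fin.any? λ a → s a Fin.≟ k)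
        where
        k : Fin n
        k = fromℕ< m<n
        toℕk : toℕ k ≡ m
        toℕk = Fin.toℕ-fromℕ< m<n
        by-cases : ∀ s → (∀ i → suc m ≤ toℕ i → s i ≡ i) → Dec (∃ λ a → s a ≡ k) → f (λ i → 𝟙 (s i)) ≈ 0#
        by-cases s fixed (yes (a , sa≡k)) with a Fin.≟ k
        ... | yes ≡.refl = permuted m (ℕ.<⇒≤ m<n) s λ i m≤i → case toℕ i ℕ.≟ m of λ
          { (yes eq) → let i≡k = Fin.toℕ-injective (≡.trans eq (≡.sym toℕk)) in ≡.trans (≡.cong s i≡k) (≡.trans sa≡k (≡.sym i≡k))
          ; (no neq) → fixed i (ℕ.≤∧≢⇒< m≤i (neq ∘ ≡.sym)) }
        -- Exchanging rows `a` and `k` puts the unit row `k` into its own place, at the cost of a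
        -- sign.
        ... | no a≢k = begin
          f (λ i → 𝟙 (s i))   ≈⟨ swap a≢k (alternating a≢k) {λ i → 𝟙 (s′ i)} (λ j → row (≡.sym s′k)) (λ j → row (≡.sym s′a)) (λ i p q j → row (≡.sym (s′i i p q))) ⟩
          ⊝ f (λ i → 𝟙 (s′ i)) ≈⟨ -‿cong (permuted m (ℕ.<⇒≤ m<n) s′ fixed′) ⟩
          ⊝ 0#                ≈⟨ -0#≈0# ⟩
          0#                  ∎
          where
          row : ∀ {u v j} → u ≡ v → 𝟙 u j ≈ 𝟙 v j
          row eq = reflexive (≡.cong (λ u → 𝟙 u _) eq)
          s′ : Fin n → Fin n
          s′ i = if does (i Fin.≟ a) then s k else if does (i Fin.≟ k) then s a else s i
          s′a : s′ a ≡ s k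
          s′a rewrite dec-true (a Fin.≟ a) ≡.refl = ≡.refl
          s′k : s′ k ≡ s a
          s′k rewrite dec-false (k Fin.≟ a) (a≢k ∘ ≡.sym) | dec-true (k Fin.≟ k) ≡.refl = ≡.refl
          s′i : ∀ i → i ≢ a → i ≢ k → s′ i ≡ s i
          s′i i p q rewrite dec-false (i Fin.≟ a) p | dec-false (i Fin.≟ k) q = ≡.refl
          fixed′ : ∀ i → m ≤ toℕ i → s′ i ≡ i
          fixed′ i m≤i = dec (i Fin.≟ k)
            where
            dec : Dec (i ≡ k) → s′ i ≡ i
            dec (yes ≡.refl) = ≡.trans s′k sa≡k
            dec (no i≢k) = ≡.trans (s′i i i≢a i≢k) (fixed i m<i)
              where
              m<i : m < toℕ i
              m<i = ℕ.≤∧≢⇒< m≤i (λ eq → i≢k (Fin.toℕ-injective (≡.trans (≡.sym eq) (≡.sym toℕk))))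
              i≢a : i ≢ a
              i≢a ≡.refl = a≢k (≡.trans (≡.sym (fixed i m<i)) sa≡k)
        -- A unit row that does not occur forces another one to occur twice.
        by-cases s fixed (no k∉s) with i , j , i<j , eq ← missed⇒collision s k k∉s =
          alternating (λ e → ℕ.<-irrefl (≡.cong toℕ e) i<j) λ l → reflexive (≡.cong (λ u → 𝟙 u l) eq)

      -- Rows of index below m are arbitrary. Expanding the last of them in unit vectors reduces to
      -- m - 1, and for m = 0 all rows are rows of the identity.
      partly : ∀ m → m ≤ n → ∀ M → (∀ i → m ≤ toℕ i → ∃ λ s → ∀ j → M i j ≈ 𝟙 s j) → f M ≈ 0#
      partly zero _ M unit = trans (cong λ i j → proj₂ (unit i z≤n) j) (permuted n ℕ.≤-refl (λ i → proj₁ (unit i z≤n)) λ i n≤i → ⊥-elim (ℕ.<⇒≱ (Fin.toℕ<n i) n≤i))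
      partly (suc m) m<n M unit = begin
        f M
          ≈⟨ cong M≋ ⟩
        f (M [ k ≔ (λ j → ∑[ l < n ] (M k l ⊗ 𝟙 l j)) ])
          ≈⟨ expand (M k) 𝟙 M k ⟩
        ∑[ l < n ] (M k l ⊗ f (M [ k ≔ 𝟙 l ]))
          ≈⟨ sum-zero (λ l → trans (*-congˡ (partly m (ℕ.<⇒≤ m<n) (M [ k ≔ 𝟙 l ]) (unit′ l))) (zeroʳ _)) ⟩
        0# ∎
        where
        k : Fin n
        k = fromℕ< m<n
        M≋ : M ≋ M [ k ≔ (λ j → ∑[ l < n ] (M k l ⊗ 𝟙 l j)) ]
        M≋ i j with i Fin.≟ k
        ... | yes ≡.refl = trans (sym (sum-𝟙ʳ (M i) j)) (sym (at M i _ j))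
        ... | no i≢k = sym (off M k _ i i≢k j)
        unit′ : ∀ l i → m ≤ toℕ i → ∃ λ s → ∀ j → (M [ k ≔ 𝟙 l ]) i j ≈ 𝟙 s j
        unit′ l i m≤i with i Fin.≟ k
        ... | yes ≡.refl = l , at M i (𝟙 l)
        ... | no i≢k with s , eq ← unit i (ℕ.≤∧≢⇒< m≤i (λ e → i≢k (Fin.toℕ-injective (≡.trans (≡.sym e) (≡.sym (Fin.toℕ-fromℕ< m<n)))))) =
          s , λ j → trans (off M k (𝟙 l) i i≢k j) (eq j)

    -- An alternating form is determined by its value at the identity: multilinearity reduces to
    -- unit rows, and transpositions sort these.
    alternating-zero : ∀ M → f M ≈ 0#
    alternating-zero M = partly n ℕ.≤-refl M λ i n≤i → ⊥-elim (ℕ.<⇒≱ (Fin.toℕ<n i) n≤i)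

  -- For fixed N the difference of the two sides is an alternating form in M that vanishes at the
  -- identity.
  det-∙ : ∀ {n} (M N : Mat n) → det (M ∙ N) ≈ det M ⊗ det N
  det-∙ {n} M N = begin
    det (M ∙ N)
      ≈⟨ solve 2 (λ x y → x := (x :+ :- y) :+ y) refl _ (det M ⊗ det N) ⟩
    (det (M ∙ N) ⊕ ⊝ (det M ⊗ det N)) ⊕ det M ⊗ det N
      ≈⟨ +-congʳ (alternating-zero form form-𝟙 M) ⟩
    0# ⊕ det M ⊗ det N
      ≈⟨ +-identityˡ _ ⟩
    det M ⊗ det N ∎
    where
    open Alternating (det-alternating {n})
    form : Alternating (λ M → det (M ∙ N) ⊕ ⊝ (det M ⊗ det N))
    form = record
      { cong = λ eq → +-cong (det-cong λ i j → sum-cong-≋ λ k → *-congʳ (eq i k)) (-‿cong (*-congʳ (det-cong eq)))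
      ; linear = λ k x y {P} {Q} {S} SP SQ Sk → trans
          (+-cong (linear k x y
                     (λ i i≢k j → sum-cong-≋ λ l → *-congʳ (SP i i≢k l))
                     (λ i i≢k j → sum-cong-≋ λ l → *-congʳ (SQ i i≢k l))
                     (λ j → trans (sum-cong-≋ λ l → trans (*-congʳ (Sk l)) (trans (distribʳ _ _ _) (+-cong (*-assoc _ _ _) (*-assoc _ _ _))))
                              (trans (∑-distrib-+ (λ l → x ⊗ (P k l ⊗ N l j)) (λ l → y ⊗ (Q k l ⊗ N l j)))
                                 (sym (+-cong (*-distribˡ-sum x (λ l → P k l ⊗ N l j)) (*-distribˡ-sum y (λ l → Q k l ⊗ N l j)))))))
                  (-‿cong (*-congʳ (linear k x y SP SQ Sk))))
          (solve 7 (λ x y a b c d e → (x :* a :+ y :* b) :+ :- ((x :* c :+ y :* d) :* e) := x :* (a :+ :- (c :* e)) :+ y :* (b :+ :- (d :* e))) refl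
             x y (det (P ∙ N)) (det (Q ∙ N)) (det P) (det Q) (det N))
      ; adjacent = λ a b eq {P} rows → trans
          (+-cong (adjacent a b eq λ j → sum-cong-≋ λ k → *-congʳ (rows k))
                  (-‿cong (trans (*-congʳ (adjacent a b eq rows)) (zeroˡ _))))
          (-‿inverseʳ 0#) }
    form-𝟙 : det (𝟙 ∙ N) ⊕ ⊝ (det {n} 𝟙 ⊗ det N) ≈ 0#
    form-𝟙 = begin
      det (𝟙 ∙ N) ⊕ ⊝ (det {n} 𝟙 ⊗ det N) ≈⟨ +-cong (det-cong 𝟙∙N) (-‿cong (*-congʳ (det-Id {n} 𝟙-diag 𝟙-off))) ⟩
      det N ⊕ ⊝ (1# ⊗ det N)          ≈⟨ trans (+-congˡ (-‿cong (*-identityˡ _))) (-‿inverseʳ _) ⟩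
      0# ∎
      where
      𝟙∙N : 𝟙 ∙ N ≋ N
      𝟙∙N i j = trans (sum-single i (λ k → 𝟙 i k ⊗ N k j) λ k k≢i → trans (*-congʳ (𝟙-off i k (k≢i ∘ ≡.sym))) (zeroˡ _))
        (trans (*-congʳ (𝟙-diag i)) (*-identityˡ _))

  module Jacobi (∂ : Carrier → Carrier) (∂-cong : ∀ {x y} → x ≈ y → ∂ x ≈ ∂ y)
    (∂-+ : ∀ x y → ∂ (x ⊕ y) ≈ ∂ x ⊕ ∂ y) (∂-* : ∀ x y → ∂ (x ⊗ y) ≈ ∂ x ⊗ y ⊕ x ⊗ ∂ y)
    (∂-1 : ∂ 1# ≈ 0#) where

    ∂-0 : ∂ 0# ≈ 0#
    ∂-0 = begin
      ∂ 0#             ≈⟨ ∂-cong (zeroˡ 0#) ⟨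
      ∂ (0# ⊗ 0#)      ≈⟨ ∂-* 0# 0# ⟩
      ∂ 0# ⊗ 0# ⊕ 0# ⊗ ∂ 0# ≈⟨ +-cong (zeroʳ _) (zeroˡ _) ⟩
      0# ⊕ 0#          ≈⟨ +-identityʳ 0# ⟩
      0#               ∎

    ∂-neg : ∀ x → ∂ (⊝ x) ≈ ⊝ ∂ x
    ∂-neg x = begin
      ∂ (⊝ x)                     ≈⟨ solve 2 (λ a b → a := :- b :+ (b :+ a)) refl (∂ (⊝ x)) (∂ x) ⟩
      ⊝ ∂ x ⊕ (∂ x ⊕ ∂ (⊝ x))     ≈⟨ +-congˡ (∂-+ x (⊝ x)) ⟨
      ⊝ ∂ x ⊕ ∂ (x ⊕ ⊝ x)         ≈⟨ +-congˡ (trans (∂-cong (-‿inverseʳ x)) ∂-0) ⟩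
      ⊝ ∂ x ⊕ 0#                  ≈⟨ +-identityʳ _ ⟩
      ⊝ ∂ x                       ∎

    ∂-sum : ∀ {n} (f : Fin n → Carrier) → ∂ (sum f) ≈ sum (λ i → ∂ (f i))
    ∂-sum {zero}  f = ∂-0
    ∂-sum {suc n} f = trans (∂-+ _ _) (+-congˡ (∂-sum (λ i → f (suc i))))

    ∂-sgn : ∀ {n} (i : Fin n) → ∂ (sgn i) ≈ 0#
    ∂-sgn zero    = ∂-1
    ∂-sgn (suc i) = trans (∂-neg _) (trans (-‿cong (∂-sgn i)) -0#≈0#)

    row-derivatives : ∀ {n} → Mat n → Carrier
    row-derivatives {n} M = ∑[ k < n ] det (M [ k ≔ (λ j → ∂ (M k j)) ])

    -- Leibniz rule along the Laplace expansion. `T k i` below is the i-th term of the expansion of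
    -- the matrix whose row k is differentiated: summing over k first gives the derivative of a
    -- term, summing over i first gives a determinant.
    ∂-det : ∀ {n} (M : Mat n) → ∂ (det M) ≈ row-derivatives M
    ∂-det {zero}  M = ∂-1
    ∂-det {suc n} M = begin
      ∂ (∑[ i < suc n ] (sgn i ⊗ (M i zero ⊗ det (minor M i))))
        ≈⟨ trans (∂-sum (λ i → sgn i ⊗ (M i zero ⊗ det (minor M i)))) (sum-cong-≋ term) ⟩
      ∑[ i < suc n ] (T i i ⊕ ∑[ a < n ] T (punchIn i a) i)
        ≈⟨ sum-cong-≋ (λ i → sum-remove {i = i} (λ k → T k i)) ⟨
      ∑[ i < suc n ] ∑[ k < suc n ] T k i
        ≈⟨ ∑-comm (λ i k → T k i) ⟩
      row-derivatives M ∎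
      where
      M′ : Fin (suc n) → Mat (suc n)
      M′ k = M [ k ≔ (λ j → ∂ (M k j)) ]
      T : Fin (suc n) → Fin (suc n) → Carrier
      T k i = sgn i ⊗ (M′ k i zero ⊗ det (minor (M′ k) i))
      own : ∀ i → sgn i ⊗ (∂ (M i zero) ⊗ det (minor M i)) ≈ T i i
      own i = *-congˡ (*-cong (sym (at M i _ zero)) (det-cong λ a b → sym (off M i _ (punchIn i a) (Fin.punchInᵢ≢i i a) (suc b))))
      other : ∀ i a → sgn i ⊗ (M i zero ⊗ det (minor M i [ a ≔ (λ b → ∂ (minor M i a b)) ])) ≈ T (punchIn i a) i
      other i a = *-congˡ (*-cong (sym (off M k _ i (i≢k) zero)) (det-cong rows))
        where
        k : Fin (suc n)
        k = punchIn i a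
        i≢k : i ≢ k
        i≢k = Fin.punchInᵢ≢i i a ∘ ≡.sym
        rows : minor M i [ a ≔ (λ b → ∂ (minor M i a b)) ] ≋ minor (M′ k) i
        rows c b with c Fin.≟ a
        ... | yes ≡.refl = trans (at (minor M i) c _ b) (sym (at M k _ (suc b)))
        ... | no c≢a = trans (off (minor M i) a _ c c≢a b) (sym (off M k _ (punchIn i c) (c≢a ∘ Fin.punchIn-injective i c a) (suc b)))
      term : ∀ i → ∂ (sgn i ⊗ (M i zero ⊗ det (minor M i))) ≈ T i i ⊕ ∑[ a < n ] T (punchIn i a) i
      term i = begin
        ∂ (sgn i ⊗ (M i zero ⊗ det (minor M i)))
          ≈⟨ trans (∂-* _ _) (+-cong (*-congʳ (∂-sgn i)) (*-congˡ (trans (∂-* _ _) (+-congˡ (*-congˡ (∂-det (minor M i))))))) ⟩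
        0# ⊗ (M i zero ⊗ det (minor M i)) ⊕ sgn i ⊗ (∂ (M i zero) ⊗ det (minor M i) ⊕ M i zero ⊗ row-derivatives (minor M i))
          ≈⟨ solve 5 (λ z s a b d → con 0ℤ :* z :+ s :* (a :* d :+ b) := s :* (a :* d) :+ s :* b) refl
               (M i zero ⊗ det (minor M i)) (sgn i) (∂ (M i zero)) (M i zero ⊗ row-derivatives (minor M i)) (det (minor M i)) ⟩
        sgn i ⊗ (∂ (M i zero) ⊗ det (minor M i)) ⊕ sgn i ⊗ (M i zero ⊗ row-derivatives (minor M i))
          ≈⟨ +-cong (own i) (trans (*-congˡ (*-distribˡ-sum (M i zero) D)) (trans (*-distribˡ-sum (sgn i) (λ a → M i zero ⊗ D a)) (sum-cong-≋ (other i)))) ⟩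
        T i i ⊕ ∑[ a < n ] T (punchIn i a) i ∎
        where
        D : Fin n → Carrier
        D a = det (minor M i [ a ≔ (λ b → ∂ (minor M i a b)) ])

    -- Jacobi's formula with a matrix X such that ∂M = XM in place of an inverse or adjugate of M.
    -- Expanding row k of XM, every summand but the k-th repeats a row of M and vanishes.
    ∂-det-≋ : ∀ {n} (M X : Mat n) → (∀ i j → ∂ (M i j) ≈ (X ∙ M) i j) → ∂ (det M) ≈ tr X ⊗ det M
    ∂-det-≋ {n} M X ∂M = begin
      ∂ (det M)
        ≈⟨ ∂-det M ⟩
      ∑[ k < n ] det (M [ k ≔ (λ j → ∂ (M k j)) ])
        ≈⟨ sum-cong-≋ row ⟩
      ∑[ k < n ] (X k k ⊗ det M)
        ≈⟨ *-distribʳ-sum (det M) (λ k → X k k) ⟨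
      tr X ⊗ det M ∎
      where
      open Alternating (det-alternating {n})
      row : ∀ k → det (M [ k ≔ (λ j → ∂ (M k j)) ]) ≈ X k k ⊗ det M
      row k = begin
        det (M [ k ≔ (λ j → ∂ (M k j)) ])
          ≈⟨ det-cong (λ i j → replace i j) ⟩
        det (M [ k ≔ (λ j → ∑[ l < n ] (X k l ⊗ M l j)) ])
          ≈⟨ expand (X k) M M k ⟩
        ∑[ l < n ] (X k l ⊗ det (M [ k ≔ M l ]))
          ≈⟨ sum-single k (λ l → X k l ⊗ det (M [ k ≔ M l ])) (λ l l≢k → trans (*-congˡ
               (alternating l≢k λ j → trans (off M k (M l) l l≢k j) (sym (at M k (M l) j)))) (zeroʳ _)) ⟩
        X k k ⊗ det (M [ k ≔ M k ])
          ≈⟨ *-congˡ (det-cong same) ⟩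
        X k k ⊗ det M ∎
        where
        replace : ∀ i j → (M [ k ≔ (λ j → ∂ (M k j)) ]) i j ≈ (M [ k ≔ (λ j → ∑[ l < n ] (X k l ⊗ M l j)) ]) i j
        replace i j with i Fin.≟ k
        ... | yes ≡.refl = trans (at M i _ j) (trans (∂M i j) (sym (at M i _ j)))
        ... | no i≢k = trans (off M k _ i i≢k j) (sym (off M k _ i i≢k j))
        same : M [ k ≔ M k ] ≋ M
        same i j with i Fin.≟ k
        ... | yes ≡.refl = at M i _ j
        ... | no i≢k = off M k _ i i≢k j

-- Determinants under ring homomorphisms.

module _ {c ℓ c′ ℓ′} (R : CommutativeRing c ℓ) (S : CommutativeRing c′ ℓ′) where
  private
    module R = DeterminantTheorems R
    module S = DeterminantTheorems S
  open CommutativeRing S using (_≈_; 0#; 1#; refl; trans; +-cong; *-cong; -‿cong) renaming (_+_ to _+′_; _*_ to _*′_; -_ to -′_)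
  open CommutativeRing R using (Carrier) renaming (_+_ to _+ᴿ_; _*_ to _*ᴿ_; -_ to -ᴿ_; 0# to 0ᴿ; 1# to 1ᴿ)

  module DeterminantHom (h : Carrier → CommutativeRing.Carrier S)
    (h-+ : ∀ x y → h (x +ᴿ y) ≈ h x +′ h y) (h-* : ∀ x y → h (x *ᴿ y) ≈ h x *′ h y)
    (h-neg : ∀ x → h (-ᴿ x) ≈ -′ h x) (h-0 : h 0ᴿ ≈ 0#) (h-1 : h 1ᴿ ≈ 1#) where

    sum-hom : ∀ {n} (f : Fin n → Carrier) → h (R.sum f) ≈ S.sum (λ i → h (f i))
    sum-hom {zero}  f = h-0
    sum-hom {suc n} f = trans (h-+ _ _) (+-cong refl (sum-hom (λ i → f (suc i))))

    sgn-hom : ∀ {n} (i : Fin n) → h (R.sgn i) ≈ S.sgn i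
    sgn-hom zero    = h-1
    sgn-hom (suc i) = trans (h-neg _) (-‿cong (sgn-hom i))

    det-hom : ∀ {n} (M : R.Mat n) → h (R.det M) ≈ S.det (λ i j → h (M i j))
    det-hom {zero}  M = h-1
    det-hom {suc n} M = trans (sum-hom (λ i → R.sgn i *ᴿ (M i zero *ᴿ R.det (R.minor M i))))
      (S.sum-cong-≋ {suc n} λ i → trans (h-* (R.sgn i) _) (*-cong (sgn-hom i) (trans (h-* (M i zero) _) (*-cong refl (det-hom (R.minor M i))))))

-- Binomial coefficients modulo a prime.

nC0≡1 : ∀ n → n C 0 ≡ 1
nC0≡1 n = ≡.trans (nCk≡nC[n∸k] {0} {n} z≤n) (nCn≡1 n)

-- For n + 1 = p prime the right-hand side is divisible by p while a factor k + 1 < p is not, so p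
-- divides the binomial coefficient.
absorption : ∀ n k → suc k * (suc n C suc k) ≡ suc n * (n C k)
absorption zero zero = ≡.refl
absorption zero (suc k) = ≡.trans (≡.cong (suc (suc k) *_) (k>n⇒nCk≡0 {1} {suc (suc k)} (s≤s (s≤s z≤n))))
  (≡.trans (ℕ.*-zeroʳ (suc (suc k))) (≡.cong (1 *_) (≡.sym (k>n⇒nCk≡0 {0} {suc k} (s≤s z≤n)))))
absorption (suc n) zero = begin
  1 * (suc (suc n) C 1)        ≡⟨ ≡.cong (1 *_) (nCk+nC[k+1]≡[n+1]C[k+1] (suc n) 0) ⟨
  1 * ((suc n C 0) + (suc n C 1)) ≡⟨ ≡.cong₂ (λ a b → 1 * (a + b)) (nC0≡1 (suc n)) (≡.trans (≡.sym (ℕ.*-identityˡ _)) (≡.trans (absorption n 0) (≡.cong (suc n *_) (nC0≡1 n)))) ⟩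
  1 * (1 + suc n * 1)          ≡⟨ ≡.trans (ℕ.*-identityˡ _) (≡.cong suc (ℕ.*-identityʳ (suc n))) ⟩
  suc (suc n)                  ≡⟨ ≡.trans (≡.cong (suc (suc n) *_) (nC0≡1 (suc n))) (ℕ.*-identityʳ _) ⟨
  suc (suc n) * (suc n C 0)    ∎
  where open ≡-Reasoning
absorption (suc n) (suc k) = begin
  suc (suc k) * (suc (suc n) C suc (suc k))
    ≡⟨ ≡.cong (suc (suc k) *_) (nCk+nC[k+1]≡[n+1]C[k+1] (suc n) (suc k)) ⟨
  suc (suc k) * (a + b)
    ≡⟨ ℕ.*-distribˡ-+ (suc (suc k)) a b ⟩
  (a + suc k * a) + suc (suc k) * b
    ≡⟨ ≡.cong₂ (λ c d → (a + c) + d) (absorption n k) (absorption n (suc k)) ⟩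
  (a + suc n * (n C k)) + suc n * (n C suc k)
    ≡⟨ ℕ.+-assoc a _ _ ⟩
  a + (suc n * (n C k) + suc n * (n C suc k))
    ≡⟨ ≡.cong (λ c → a + c) (ℕ.*-distribˡ-+ (suc n) (n C k) (n C suc k)) ⟨
  a + suc n * ((n C k) + (n C suc k))
    ≡⟨ ≡.cong (λ c → a + suc n * c) (nCk+nC[k+1]≡[n+1]C[k+1] n k) ⟩
  suc (suc n) * a ∎
  where
  open ≡-Reasoning
  a b : ℕ
  a = suc n C suc k
  b = suc n C suc (suc k)

prime∣C : ∀ {p} → Prime p → ∀ j → suc j < p → p ℕ∣.∣ (p C suc j)
prime∣C {suc p} pp j j<p with euclidsLemma (suc j) (suc p C suc j) pp (ℕ∣.divides (p C j) (≡.trans (absorption p j) (ℕ.*-comm (suc p) (p C j))))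
... | inj₁ p∣j = ⊥-elim (ℕ.<⇒≱ j<p (ℕ∣.∣⇒≤ p∣j))
... | inj₂ p∣C = p∣C

-- Geometric sums, Frobenius and the Eisenstein argument.

module GeometricSums {c ℓ} (R : CommutativeRing c ℓ) where
  open CommutativeRing R renaming (_+_ to _⊕_; _*_ to _⊗_; -_ to ⊝_; zero to *-zero) hiding (_-_)
  open Determinant R using (solve; _:=_; _:+_; _:*_; :-_; con)
  open Exponentiation semiring public using (^-congˡ; ^-homo-*; ^-assocʳ) renaming (_^_ to _↑_)
  open SetoidReasoning setoid

  geo : ℕ → Carrier → Carrier
  geo zero    z = 0#
  geo (suc n) z = 1# ⊕ z ⊗ geo n z

  geo-telescope : ∀ n z → (1# ⊕ ⊝ z) ⊗ geo n z ≈ 1# ⊕ ⊝ (z ↑ n)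
  geo-telescope zero    z = trans (zeroʳ (1# ⊕ ⊝ z)) (sym (-‿inverseʳ 1#))
  geo-telescope (suc n) z = begin
    (1# ⊕ ⊝ z) ⊗ (1# ⊕ z ⊗ geo n z)
      ≈⟨ solve 3 (λ o z g → (o :+ :- z) :* (o :+ z :* g) := (o :+ :- z) :* o :+ z :* ((o :+ :- z) :* g)) refl 1# z (geo n z) ⟩
    (1# ⊕ ⊝ z) ⊗ 1# ⊕ z ⊗ ((1# ⊕ ⊝ z) ⊗ geo n z)
      ≈⟨ +-cong (*-identityʳ (1# ⊕ ⊝ z)) (*-congˡ (geo-telescope n z)) ⟩
    (1# ⊕ ⊝ z) ⊕ z ⊗ (1# ⊕ ⊝ (z ↑ n))
      ≈⟨ +-congˡ (solve 3 (λ o z g → z :* (o :+ :- g) := z :* o :+ :- (z :* g)) refl 1# z (z ↑ n)) ⟩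
    (1# ⊕ ⊝ z) ⊕ (z ⊗ 1# ⊕ ⊝ (z ⊗ z ↑ n))
      ≈⟨ +-congˡ (+-congʳ (*-identityʳ z)) ⟩
    (1# ⊕ ⊝ z) ⊕ (z ⊕ ⊝ (z ⊗ z ↑ n))
      ≈⟨ solve 3 (λ o z g → (o :+ :- z) :+ (z :+ :- g) := o :+ :- g) refl 1# z (z ⊗ z ↑ n) ⟩
    1# ⊕ ⊝ (z ⊗ z ↑ n) ∎

  geo-power : ∀ n z → (1# ⊕ z) ↑ n ≈ 1# ⊕ z ⊗ geo n (1# ⊕ z)
  geo-power n z = begin
    (1# ⊕ z) ↑ n
      ≈⟨ solve 2 (λ o w → w := o :+ :- (o :+ :- w)) refl 1# ((1# ⊕ z) ↑ n) ⟩
    1# ⊕ ⊝ (1# ⊕ ⊝ ((1# ⊕ z) ↑ n))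
      ≈⟨ +-congˡ (-‿cong (geo-telescope n (1# ⊕ z))) ⟨
    1# ⊕ ⊝ ((1# ⊕ ⊝ (1# ⊕ z)) ⊗ geo n (1# ⊕ z))
      ≈⟨ solve 3 (λ o z g → o :+ :- ((o :+ :- (o :+ z)) :* g) := o :+ z :* g) refl 1# z (geo n (1# ⊕ z)) ⟩
    1# ⊕ z ⊗ geo n (1# ⊕ z) ∎

  horner : ℕ → (ℕ → Carrier) → Carrier → Carrier
  horner zero    c z = 0#
  horner (suc n) c z = c 0 ⊕ z ⊗ horner n (c ∘ suc) z

  horner-cong : ∀ n {c c′} z → (∀ j → c j ≈ c′ j) → horner n c z ≈ horner n c′ z
  horner-cong zero    z eq = refl
  horner-cong (suc n) z eq = +-cong (eq 0) (*-congˡ (horner-cong n z (eq ∘ suc)))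

  horner-+ : ∀ n c c′ z → horner n (λ j → c j ⊕ c′ j) z ≈ horner n c z ⊕ horner n c′ z
  horner-+ zero    c c′ z = sym (+-identityˡ 0#)
  horner-+ (suc n) c c′ z = trans (+-congˡ (*-congˡ (horner-+ n (c ∘ suc) (c′ ∘ suc) z)))
    (solve 5 (λ a b z g h → (a :+ b) :+ z :* (g :+ h) := (a :+ z :* g) :+ (b :+ z :* h)) refl
      (c 0) (c′ 0) z (horner n (c ∘ suc) z) (horner n (c′ ∘ suc) z))

  horner-0 : ∀ n {c} z → (∀ j → c j ≈ 0#) → horner n c z ≈ 0#
  horner-0 zero    z eq = refl
  horner-0 (suc n) z eq = trans (+-cong (eq 0) (trans (*-congˡ (horner-0 n z (eq ∘ suc))) (zeroʳ z))) (+-identityˡ 0#)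

  open SemiringMult semiring using () renaming (_×_ to _×ᴿ_; ×-homo-+ to ×ᴿ-homo-+)

  -- This is ((1 + z)ⁿ - 1) / z, expanded without division. N pads with zero coefficients: Pascal's
  -- rule needs the sum for n at two different lengths.
  geo-binomial : ∀ n N z → n ≤ N → geo n (1# ⊕ z) ≈ horner N (λ j → (n C suc j) ×ᴿ 1#) z
  geo-binomial zero N z _ = sym (horner-0 N z λ j → reflexive (≡.cong (_×ᴿ 1#) (k>n⇒nCk≡0 {0} {suc j} (s≤s z≤n))))
  geo-binomial (suc n) (suc N) z (s≤s n≤N) = begin
    1# ⊕ (1# ⊕ z) ⊗ geo n (1# ⊕ z)
      ≈⟨ +-congˡ (trans (distribʳ _ 1# z) (+-congʳ (*-identityˡ _))) ⟩
    1# ⊕ (geo n (1# ⊕ z) ⊕ z ⊗ geo n (1# ⊕ z))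
      ≈⟨ +-congˡ (+-cong (geo-binomial n (suc N) z (ℕ.m≤n⇒m≤1+n n≤N)) (*-congˡ (geo-binomial n N z n≤N))) ⟩
    1# ⊕ (horner (suc N) C⁺ z ⊕ z ⊗ horner N C⁺ z)
      ≈⟨ solve 3 (λ o a b → o :+ (a :+ b) := (o :+ b) :+ a) refl 1# (horner (suc N) C⁺ z) (z ⊗ horner N C⁺ z) ⟩
    (1# ⊕ z ⊗ horner N C⁺ z) ⊕ horner (suc N) C⁺ z
      ≈⟨ +-congʳ (+-congʳ (trans (reflexive (≡.cong (_×ᴿ 1#) (nC0≡1 n))) (+-identityʳ 1#))) ⟨
    horner (suc N) (λ j → (n C j) ×ᴿ 1#) z ⊕ horner (suc N) C⁺ z
      ≈⟨ horner-+ (suc N) (λ j → (n C j) ×ᴿ 1#) C⁺ z ⟨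
    horner (suc N) (λ j → (n C j) ×ᴿ 1# ⊕ C⁺ j) z
      ≈⟨ horner-cong (suc N) z (λ j → trans (sym (×ᴿ-homo-+ 1# (n C j) (n C suc j))) (reflexive (≡.cong (_×ᴿ 1#) (nCk+nC[k+1]≡[n+1]C[k+1] n j)))) ⟩
    horner (suc N) (λ j → (suc n C suc j) ×ᴿ 1#) z ∎
    where
    C⁺ : ℕ → Carrier
    C⁺ j = (n C suc j) ×ᴿ 1#

  collect : ∀ p c y h → p ⊗ c ⊕ y ⊗ (p ⊗ h) ≈ p ⊗ (c ⊕ y ⊗ h)
  collect = solve 4 (λ p c y h → p :* c :+ y :* (p :* h) := p :* (c :+ y :* h)) refl

  collect′ : ∀ p c y h a F → p ⊗ c ⊕ y ⊗ (p ⊗ h ⊕ a ⊗ F) ≈ p ⊗ (c ⊕ y ⊗ h) ⊕ (y ⊗ a) ⊗ F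
  collect′ = solve 6 (λ p c y h a F → p :* c :+ y :* (p :* h :+ a :* F) := p :* (c :+ y :* h) :+ (y :* a) :* F) refl

  module Congruence (m : Carrier) where
    infix 4 _≡ₘ_
    _≡ₘ_ : Carrier → Carrier → Set _
    a ≡ₘ b = ∃ λ h → a ≈ b ⊕ m ⊗ h

    ≈⇒≡ₘ : ∀ {a b} → a ≈ b → a ≡ₘ b
    ≈⇒≡ₘ {a} {b} eq = 0# , trans eq (sym (trans (+-congˡ (zeroʳ m)) (+-identityʳ b)))

    ≡ₘ-trans : ∀ {a b c} → a ≡ₘ b → b ≡ₘ c → a ≡ₘ c
    ≡ₘ-trans {c = c} (h , eq) (h′ , eq′) = h′ ⊕ h , trans eq (trans (+-congʳ eq′)
      (solve 4 (λ s p h h′ → (s :+ p :* h′) :+ p :* h := s :+ p :* (h′ :+ h)) refl c m h h′))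

    ≡ₘ-+ : ∀ {a b a′ b′} → a ≡ₘ b → a′ ≡ₘ b′ → a ⊕ a′ ≡ₘ b ⊕ b′
    ≡ₘ-+ {b = b} {b′ = b′} (h , eq) (h′ , eq′) = h ⊕ h′ , trans (+-cong eq eq′)
      (solve 5 (λ q q′ p h h′ → (q :+ p :* h) :+ (q′ :+ p :* h′) := (q :+ q′) :+ p :* (h :+ h′)) refl b b′ m h h′)

    ≡ₘ-* : ∀ {a b a′ b′} → a ≡ₘ b → a′ ≡ₘ b′ → a ⊗ a′ ≡ₘ b ⊗ b′
    ≡ₘ-* {b = b} {b′ = b′} (h , eq) (h′ , eq′) = h ⊗ (b′ ⊕ m ⊗ h′) ⊕ b ⊗ h′ , trans (*-cong eq eq′)
      (solve 5 (λ q q′ p h h′ → (q :+ p :* h) :* (q′ :+ p :* h′) := q :* q′ :+ p :* (h :* (q′ :+ p :* h′) :+ q :* h′)) refl b b′ m h h′)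

    ≡ₘ-^ : ∀ n {a b} → a ≡ₘ b → a ↑ n ≡ₘ b ↑ n
    ≡ₘ-^ zero    eq = ≈⇒≡ₘ refl
    ≡ₘ-^ (suc n) eq = ≡ₘ-* eq (≡ₘ-^ n eq)

    ≡ₘ-geo : ∀ n {a b} → a ≡ₘ b → geo n a ≡ₘ geo n b
    ≡ₘ-geo zero    eq = ≈⇒≡ₘ refl
    ≡ₘ-geo (suc n) eq = ≡ₘ-+ (≈⇒≡ₘ refl) (≡ₘ-* eq (≡ₘ-geo n eq))

    -- A monic polynomial whose lower coefficients vanish modulo m; with m = p and the coefficients
    -- of `geo-binomial` this gives `geo-p`.
    horner-top : ∀ n c z → (∀ j → j < n → c j ≡ₘ 0#) → c n ≈ 1# → horner (suc n) c z ≡ₘ z ↑ n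
    horner-top zero c z _ eq = ≈⇒≡ₘ (trans (+-cong eq (zeroʳ z)) (+-identityʳ 1#))
    horner-top (suc n) c z div eq = ≡ₘ-trans
      (≡ₘ-+ (div 0 (s≤s z≤n)) (≡ₘ-* (≈⇒≡ₘ (refl {z})) (horner-top n (c ∘ suc) z (λ j → div (suc j) ∘ s≤s) eq)))
      (≈⇒≡ₘ (+-identityˡ _))

  module PrimeCongruence (p : ℕ) (pp : Prime p) where
    open Congruence (p ×ᴿ 1#) public
    open SemiringMult semiring using (×1-homo-*)

    private
      suc-p′ : p ≡ suc (p ∸ 1)
      suc-p′ = ≡.sym (ℕ.suc-pred p {{prime⇒nonZero pp}})

    geo-p : ∀ z → geo p (1# ⊕ z) ≡ₘ z ↑ (p ∸ 1)
    geo-p z = ≡ₘ-trans (≈⇒≡ₘ (geo-binomial p p z ℕ.≤-refl)) (≡ₘ-trans (≈⇒≡ₘ (reflexive (≡.cong (λ m → horner m C⁺ z) suc-p′)))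
      (horner-top (p ∸ 1) C⁺ z
        (λ j j<p′ → case prime∣C pp j (≡.subst (suc j <_) (≡.sym suc-p′) (s≤s j<p′)) of λ { (ℕ∣.divides k eq) → k ×ᴿ 1# ,
          trans (reflexive (≡.cong (_×ᴿ 1#) (≡.trans eq (ℕ.*-comm k p)))) (trans (×1-homo-* p k) (sym (+-identityˡ _))) })
        (trans (reflexive (≡.cong (_×ᴿ 1#) (≡.trans (≡.cong (p C_) (≡.sym suc-p′)) (nCn≡1 p)))) (+-identityʳ 1#))))
      where
      C⁺ : ℕ → Carrier
      C⁺ j = (p C suc j) ×ᴿ 1#

    frobenius : ∀ z → (1# ⊕ z) ↑ p ≡ₘ 1# ⊕ z ↑ p
    frobenius z = ≡ₘ-trans (≈⇒≡ₘ (geo-power p z)) (≡ₘ-trans (≡ₘ-+ (≈⇒≡ₘ refl) (≡ₘ-* (≈⇒≡ₘ (refl {z})) (geo-p z)))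
      (≈⇒≡ₘ (+-congˡ (reflexive (≡.cong (z ↑_) (≡.sym suc-p′))))))

    frobeniusⁿ : ∀ n z → (1# ⊕ z) ↑ (p ^ n) ≡ₘ 1# ⊕ z ↑ (p ^ n)
    frobeniusⁿ zero z = ≈⇒≡ₘ (trans (*-identityʳ _) (+-congˡ (sym (*-identityʳ z))))
    frobeniusⁿ (suc n) z = ≡ₘ-trans (≈⇒≡ₘ (power (1# ⊕ z))) (≡ₘ-trans (≡ₘ-^ p (frobeniusⁿ n z)) (≡ₘ-trans (frobenius (z ↑ (p ^ n)))
      (≈⇒≡ₘ (+-congˡ (sym (power z))))))
      where
      power : ∀ w → w ↑ (p ^ suc n) ≈ (w ↑ (p ^ n)) ↑ p
      power w = trans (reflexive (≡.cong (w ↑_) (ℕ.*-comm p (p ^ n)))) (sym (^-assocʳ w (p ^ n) p))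

    -- For z = x - 1 this is the Eisenstein form of the cyclotomic polynomial of order pⁿ⁺¹.
    geo-eisenstein : ∀ n z → geo p ((1# ⊕ z) ↑ (p ^ n)) ≡ₘ z ↑ ((p ∸ 1) * p ^ n)
    geo-eisenstein n z = ≡ₘ-trans (≡ₘ-geo p (frobeniusⁿ n z)) (≡ₘ-trans (geo-p (z ↑ (p ^ n)))
      (≈⇒≡ₘ (trans (^-assocʳ z (p ^ n) (p ∸ 1)) (reflexive (≡.cong (z ↑_) (ℕ.*-comm (p ^ n) (p ∸ 1)))))))

    -- If f is an element of I that is not divisible by p, multiplying by g turns p into - y ^ d, so that
    -- low-order terms divisible by p become terms of high order in y; a power of y is then cancelled modulo p.
    ideal-argument : ∀ {i} (I : Carrier → Set i) → (∀ {a b} → a ≈ b → I a → I b) →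
      (∀ {a b} → I a → I b → I (a ⊕ b)) → (∀ a {b} → I b → I (a ⊗ b)) → (∀ a → I ((p ×ᴿ 1#) ⊗ a) → I a) →
      ∀ Φ g f low F y G₁ e d k → k < d →
      Φ ≈ y ↑ d ⊕ (p ×ᴿ 1#) ⊗ g → I Φ → f ≈ (p ×ᴿ 1#) ⊗ low ⊕ y ↑ k ⊗ F → I f →
      g ⊗ (g ⊗ F ⊕ ⊝ (y ↑ (d ∸ k) ⊗ low)) ≈ e ⊕ y ⊗ G₁ → ∃ λ W → I (e ↑ d ⊕ (p ×ᴿ 1#) ⊗ W)
    ideal-argument I I-resp I-+ I-* I-sat Φ g f low F y G₁ e d k k<d Φ≈ IΦ f≈ If G≈ =
      (⊝ G₁) ↑ d ⊗ g , I-resp e^d (I-+ (I-* (proj₁ (expand d)) (I-resp G≈ IG)) (I-* ((⊝ G₁) ↑ d) IΦ))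
      where
      P F′ G : Carrier
      P = p ×ᴿ 1#
      F′ = g ⊗ F ⊕ ⊝ (y ↑ (d ∸ k) ⊗ low)
      G = g ⊗ F′
      split : y ↑ d ≈ y ↑ k ⊗ y ↑ (d ∸ k)
      split = trans (reflexive (≡.cong (y ↑_) (≡.sym (ℕ.m+[n∸m]≡n (ℕ.<⇒≤ k<d))))) (^-homo-* y k (d ∸ k))
      -- In `g f - low Φ` the two terms `p g low` cancel, and `y ^ k` can be taken out because k ≤
      -- d.
      I-y^kF′ : I (y ↑ k ⊗ F′)
      I-y^kF′ = I-resp (begin
        g ⊗ f ⊕ ⊝ low ⊗ Φ
          ≈⟨ +-cong (*-congˡ f≈) (*-congˡ (trans Φ≈ (+-congʳ split))) ⟩
        g ⊗ (P ⊗ low ⊕ y ↑ k ⊗ F) ⊕ ⊝ low ⊗ (y ↑ k ⊗ y ↑ (d ∸ k) ⊕ P ⊗ g)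
          ≈⟨ solve 6 (λ g P l a F b → g :* (P :* l :+ a :* F) :+ (:- l) :* (a :* b :+ P :* g) := a :* (g :* F :+ :- (b :* l))) refl
               g P low (y ↑ k) F (y ↑ (d ∸ k)) ⟩
        y ↑ k ⊗ F′ ∎) (I-+ (I-* g If) (I-* (⊝ low) IΦ))
      -- Here it is the powers of `y` that cancel, leaving p times `G`; saturation of `I` removes
      -- the p.
      IG : I G
      IG = I-sat G (I-resp (begin
        F′ ⊗ Φ ⊕ ⊝ (y ↑ (d ∸ k)) ⊗ (y ↑ k ⊗ F′)
          ≈⟨ +-congʳ (*-congˡ (trans Φ≈ (+-congʳ split))) ⟩
        F′ ⊗ (y ↑ k ⊗ y ↑ (d ∸ k) ⊕ P ⊗ g) ⊕ ⊝ (y ↑ (d ∸ k)) ⊗ (y ↑ k ⊗ F′)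
          ≈⟨ solve 5 (λ F a b P g → F :* (a :* b :+ P :* g) :+ (:- b) :* (a :* F) := P :* (g :* F)) refl F′ (y ↑ k) (y ↑ (d ∸ k)) P g ⟩
        P ⊗ G ∎) (I-+ (I-* F′ IΦ) (I-* (⊝ (y ↑ (d ∸ k))) I-y^kF′)))
      -- e ≡ - y G₁ modulo I.
      expand : ∀ m → ∃ λ H → e ↑ m ≈ H ⊗ (e ⊕ y ⊗ G₁) ⊕ (⊝ G₁) ↑ m ⊗ y ↑ m
      expand zero = 0# , sym (trans (+-cong (zeroˡ _) (*-identityˡ 1#)) (+-identityˡ 1#))
      expand (suc m) with H , eq ← expand m = e ⊗ H ⊕ (⊝ G₁) ↑ m ⊗ y ↑ m , trans (*-congˡ eq)
        (solve 6 (λ e H y G a b → e :* (H :* (e :+ y :* G) :+ a :* b) := (e :* H :+ a :* b) :* (e :+ y :* G) :+ ((:- G) :* a) :* (y :* b)) refl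
          e H y G₁ ((⊝ G₁) ↑ m) (y ↑ m))
      -- Modulo `I`, `e ^ d` is `(- G₁) ^ d y ^ d`, and `y ^ d` is `- p g` because `Φ` lies in `I`.
      e^d : proj₁ (expand d) ⊗ (e ⊕ y ⊗ G₁) ⊕ (⊝ G₁) ↑ d ⊗ Φ ≈ e ↑ d ⊕ P ⊗ ((⊝ G₁) ↑ d ⊗ g)
      e^d = begin
        proj₁ (expand d) ⊗ (e ⊕ y ⊗ G₁) ⊕ (⊝ G₁) ↑ d ⊗ Φ
          ≈⟨ +-congˡ (*-congˡ Φ≈) ⟩
        proj₁ (expand d) ⊗ (e ⊕ y ⊗ G₁) ⊕ (⊝ G₁) ↑ d ⊗ (y ↑ d ⊕ P ⊗ g)
          ≈⟨ solve 5 (λ h a b P g → h :+ a :* (b :+ P :* g) := (h :+ a :* b) :+ P :* (a :* g)) refl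
               (proj₁ (expand d) ⊗ (e ⊕ y ⊗ G₁)) ((⊝ G₁) ↑ d) (y ↑ d) P g ⟩
        (proj₁ (expand d) ⊗ (e ⊕ y ⊗ G₁) ⊕ (⊝ G₁) ↑ d ⊗ y ↑ d) ⊕ P ⊗ ((⊝ G₁) ↑ d ⊗ g)
          ≈⟨ +-congʳ (proj₂ (expand d)) ⟨
        e ↑ d ⊕ P ⊗ ((⊝ G₁) ↑ d ⊗ g) ∎

-- Ring identities behind quotients and logarithmic derivatives of power series.

module RationalSeries {c ℓ} (R : CommutativeRing c ℓ) where
  open CommutativeRing R renaming (_+_ to _⊕_; _*_ to _⊗_; -_ to ⊝_; zero to *-zero) hiding (_-_)
  open Determinant R using (solve; _:=_; _:+_; _:*_; :-_; con)
  open SetoidReasoning setoid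

  cancel : ∀ T F D → (T ⊗ F) ⊗ D ⊕ F ⊗ (⊝ T ⊗ D) ≈ 0#
  cancel = solve 3 (λ T F D → (T :* F) :* D :+ F :* ((:- T) :* D) := con 0ℤ) refl

  collect : ∀ ψ g Π Ψ → (ψ ⊗ g) ⊗ Π ⊕ g ⊗ (Ψ ⊗ Π) ≈ (ψ ⊕ Ψ) ⊗ (g ⊗ Π)
  collect = solve 4 (λ ψ g Π Ψ → (ψ :* g) :* Π :+ g :* (Ψ :* Π) := (ψ :+ Ψ) :* (g :* Π)) refl

  -- Two presentations of F as a fraction. Both sides equal (aq)(bs)F, so F is eliminated without
  -- cancelling it.
  cross-multiply : ∀ {a b q s F c d r t} → (a ⊗ q) ⊗ F ≈ c ⊗ r → (b ⊗ s) ⊗ F ≈ d ⊗ t → (a ⊗ d) ⊗ (q ⊗ t) ≈ (b ⊗ c) ⊗ (s ⊗ r)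
  cross-multiply {a} {b} {q} {s} {F} {c} {d} {r} {t} eq eq′ = begin
    (a ⊗ d) ⊗ (q ⊗ t)              ≈⟨ solve 4 (λ a d q t → (a :* d) :* (q :* t) := (a :* q) :* (d :* t)) refl a d q t ⟩
    (a ⊗ q) ⊗ (d ⊗ t)              ≈⟨ *-congˡ eq′ ⟨
    (a ⊗ q) ⊗ ((b ⊗ s) ⊗ F)        ≈⟨ solve 5 (λ a q b s F → (a :* q) :* ((b :* s) :* F) := (b :* s) :* ((a :* q) :* F)) refl a q b s F ⟩
    (b ⊗ s) ⊗ ((a ⊗ q) ⊗ F)        ≈⟨ *-congˡ eq ⟩
    (b ⊗ s) ⊗ (c ⊗ r)              ≈⟨ solve 4 (λ b s c r → (b :* s) :* (c :* r) := (b :* c) :* (s :* r)) refl b s c r ⟩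
    (b ⊗ c) ⊗ (s ⊗ r)              ∎

  quotient : ∀ {F F′ d d′ e} → F ⊗ d ≈ 1# → F′ ⊗ d′ ≈ 1# → d′ ≈ d ⊗ e → e ⊗ F′ ≈ F
  quotient {F} {F′} {d} {d′} {e} Fd F′d′ d′≈ = begin
    e ⊗ F′              ≈⟨ *-identityˡ (e ⊗ F′) ⟨
    1# ⊗ (e ⊗ F′)       ≈⟨ *-congʳ Fd ⟨
    (F ⊗ d) ⊗ (e ⊗ F′)  ≈⟨ solve 4 (λ F d e F′ → (F :* d) :* (e :* F′) := F :* (F′ :* (d :* e))) refl F d e F′ ⟩
    F ⊗ (F′ ⊗ (d ⊗ e))  ≈⟨ *-congˡ (trans (*-congˡ (sym d′≈)) F′d′) ⟩
    F ⊗ 1#              ≈⟨ *-identityʳ F ⟩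
    F                   ∎

  module _ (∂ : Carrier → Carrier) (∂-cong : ∀ {a b} → a ≈ b → ∂ a ≈ ∂ b) (∂-+ : ∀ a b → ∂ (a ⊕ b) ≈ ∂ a ⊕ ∂ b)
    (∂-* : ∀ a b → ∂ (a ⊗ b) ≈ ∂ a ⊗ b ⊕ a ⊗ ∂ b) (∂-1 : ∂ 1# ≈ 0#) (∂-neg : ∀ a → ∂ (⊝ a) ≈ ⊝ ∂ a)
    (l U g : Carrier) (∂U : ∂ U ≈ l ⊗ U) (g≈ : g ≈ 1# ⊕ U ⊗ g) where

    private
      inverse : g ⊗ (1# ⊕ ⊝ U) ≈ 1#
      inverse = begin
        g ⊗ (1# ⊕ ⊝ U)               ≈⟨ solve 3 (λ g o U → g :* (o :+ :- U) := g :* o :+ :- (U :* g)) refl g 1# U ⟩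
        g ⊗ 1# ⊕ ⊝ (U ⊗ g)           ≈⟨ +-congʳ (trans (*-identityʳ g) g≈) ⟩
        (1# ⊕ U ⊗ g) ⊕ ⊝ (U ⊗ g)     ≈⟨ solve 2 (λ o a → (o :+ a) :+ :- a := o) refl 1# (U ⊗ g) ⟩
        1#                           ∎

      U⊗g : U ⊗ g ≈ g ⊕ ⊝ 1#
      U⊗g = trans (solve 2 (λ o a → a := (o :+ a) :+ :- o) refl 1# (U ⊗ g)) (+-congʳ (sym g≈))

    -- Here g = 1 / (1 - U). Differentiating g = 1 + U g gives (1 - U) ∂g = l U g, and U g = g - 1.
    -- In the application U is the l-th power of u.
    ∂-reciprocal : ∂ g ≈ (l ⊗ (g ⊕ ⊝ 1#)) ⊗ g
    ∂-reciprocal = begin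
      ∂ g                                  ≈⟨ trans (*-congʳ inverse) (*-identityˡ (∂ g)) ⟨
      (g ⊗ (1# ⊕ ⊝ U)) ⊗ ∂ g               ≈⟨ solve 4 (λ g o U d → (g :* (o :+ :- U)) :* d := g :* (o :* d :+ :- (U :* d))) refl g 1# U (∂ g) ⟩
      g ⊗ (1# ⊗ ∂ g ⊕ ⊝ (U ⊗ ∂ g))         ≈⟨ *-congˡ (+-congʳ (trans (*-identityˡ (∂ g)) ∂g)) ⟩
      g ⊗ ((l ⊗ U ⊗ g ⊕ U ⊗ ∂ g) ⊕ ⊝ (U ⊗ ∂ g)) ≈⟨ solve 4 (λ g l U d → g :* ((l :* U :* g :+ U :* d) :+ :- (U :* d)) := (l :* (U :* g)) :* g) refl g l U (∂ g) ⟩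
      (l ⊗ (U ⊗ g)) ⊗ g                    ≈⟨ *-congʳ (*-congˡ U⊗g) ⟩
      (l ⊗ (g ⊕ ⊝ 1#)) ⊗ g                 ∎
      where
      ∂g : ∂ g ≈ l ⊗ U ⊗ g ⊕ U ⊗ ∂ g
      ∂g = trans (∂-cong g≈) (trans (∂-+ 1# (U ⊗ g)) (trans (+-cong ∂-1 (∂-* U g)) (trans (+-identityˡ _) (+-congʳ (*-congʳ ∂U)))))

    -- The logarithmic derivative of 1 - U is the negative of that of g, written with the same
    -- series l (g - 1) so that the two can be matched.
    ∂-1-U : ∂ (1# ⊕ ⊝ U) ≈ ⊝ (l ⊗ (g ⊕ ⊝ 1#)) ⊗ (1# ⊕ ⊝ U)
    ∂-1-U = begin
      ∂ (1# ⊕ ⊝ U)                  ≈⟨ trans (∂-+ 1# (⊝ U)) (trans (+-cong ∂-1 (∂-neg U)) (+-identityˡ _)) ⟩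
      ⊝ ∂ U                         ≈⟨ -‿cong ∂U ⟩
      ⊝ (l ⊗ U)                     ≈⟨ solve 3 (λ l o U → :- (l :* U) := :- (l :* (o :+ :- (o :+ :- U)))) refl l 1# U ⟩
      ⊝ (l ⊗ (1# ⊕ ⊝ (1# ⊕ ⊝ U)))   ≈⟨ -‿cong (*-congˡ (+-cong inverse (-‿cong (*-identityˡ (1# ⊕ ⊝ U))))) ⟨
      ⊝ (l ⊗ (g ⊗ (1# ⊕ ⊝ U) ⊕ ⊝ (1# ⊗ (1# ⊕ ⊝ U)))) ≈⟨ solve 4 (λ l g o s → :- (l :* (g :* s :+ :- (o :* s))) := :- (l :* (g :+ :- o)) :* s) refl l g 1# (1# ⊕ ⊝ U) ⟩
      ⊝ (l ⊗ (g ⊕ ⊝ 1#)) ⊗ (1# ⊕ ⊝ U) ∎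

-- The ring of integer power series.

open ≡ using (refl; sym; trans; cong; cong₂; subst)

module ℤdet = DeterminantTheorems ℤ.+-*-commutativeRing

open SemiringSum ℤ.+-*-semiring using (sum; sum-syntax; sum-cong-≗; ∑-distrib-+; *-distribˡ-sum; *-distribʳ-sum; ∑-comm)
open ℤdet using (sum-zero; sum-single; 𝟙; 𝟙-diag; 𝟙-off)

infix 4 _≗ˢ_
_≗ˢ_ : Series → Series → Set
f ≗ˢ g = ∀ n → f n ≡ g n

infixl 6 _+ˢ_
_+ˢ_ : Series → Series → Series
(f +ˢ g) n = f n +ᶻ g n

-ˢ_ : Series → Series
(-ˢ f) n = - f n

0ˢ : Series
0ˢ _ = 0ℤ

⊛-cong : ∀ {f f′ g g′} → f ≗ˢ f′ → g ≗ˢ g′ → f ⊛ g ≗ˢ f′ ⊛ g′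
⊛-cong p q n = sum-cong-≗ {suc n} λ i → cong₂ _*ᶻ_ (p (toℕ i)) (q (n ∸ toℕ i))

⊛-distribʳ : ∀ h f g → (f +ˢ g) ⊛ h ≗ˢ f ⊛ h +ˢ g ⊛ h
⊛-distribʳ h f g n = trans (sum-cong-≗ {suc n} λ i → ℤ.*-distribʳ-+ (h (n ∸ toℕ i)) (f (toℕ i)) (g (toℕ i)))
  (∑-distrib-+ {suc n} (λ i → f (toℕ i) *ᶻ h (n ∸ toℕ i)) (λ i → g (toℕ i) *ᶻ h (n ∸ toℕ i)))

⊛-scaleˡ : ∀ a f g → (λ n → a *ᶻ f n) ⊛ g ≗ˢ (λ n → a *ᶻ (f ⊛ g) n)
⊛-scaleˡ a f g n = trans (sum-cong-≗ {suc n} λ i → ℤ.*-assoc a (f (toℕ i)) (g (n ∸ toℕ i)))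
  (sym (*-distribˡ-sum {suc n} a (λ i → f (toℕ i) *ᶻ g (n ∸ toℕ i))))

-- The convolution sum unfolds at its first term; peeling off the last one instead is what
-- commutativity requires.
⊛-last : ∀ f g n → (f ⊛ g) (suc n) ≡ (f ⊛ (g ∘ suc)) n +ᶻ f (suc n) *ᶻ g 0
⊛-last f g zero = lemma (f 0) (g 1) (f 1) (g 0)
  where
  lemma : ∀ a b c d → a *ᶻ b +ᶻ (c *ᶻ d +ᶻ 0ℤ) ≡ (a *ᶻ b +ᶻ 0ℤ) +ᶻ c *ᶻ d
  lemma = solve-∀
⊛-last f g (suc n) = trans (cong (f 0 *ᶻ g (suc (suc n)) +ᶻ_) (⊛-last (f ∘ suc) g n))
  (sym (ℤ.+-assoc (f 0 *ᶻ g (suc (suc n))) _ _))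

⊛-comm : ∀ f g → f ⊛ g ≗ˢ g ⊛ f
⊛-comm f g zero    = cong (_+ᶻ 0ℤ) (ℤ.*-comm (f 0) (g 0))
⊛-comm f g (suc n) = begin
  f 0 *ᶻ g (suc n) +ᶻ ((f ∘ suc) ⊛ g) n    ≡⟨ cong₂ _+ᶻ_ (ℤ.*-comm (f 0) (g (suc n))) (⊛-comm (f ∘ suc) g n) ⟩
  g (suc n) *ᶻ f 0 +ᶻ (g ⊛ (f ∘ suc)) n    ≡⟨ ℤ.+-comm (g (suc n) *ᶻ f 0) _ ⟩
  (g ⊛ (f ∘ suc)) n +ᶻ g (suc n) *ᶻ f 0    ≡⟨ ⊛-last g f n ⟨
  (g ⊛ f) (suc n)                          ∎
  where open ≡-Reasoning

⊛-assoc : ∀ f g h → (f ⊛ g) ⊛ h ≗ˢ f ⊛ (g ⊛ h)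
⊛-assoc f g h zero = lemma (f 0) (g 0) (h 0)
  where
  lemma : ∀ a b c → (a *ᶻ b +ᶻ 0ℤ) *ᶻ c +ᶻ 0ℤ ≡ a *ᶻ (b *ᶻ c +ᶻ 0ℤ) +ᶻ 0ℤ
  lemma = solve-∀
⊛-assoc f g h (suc n) = begin
  (f 0 *ᶻ g 0 +ᶻ 0ℤ) *ᶻ h (suc n) +ᶻ (((λ k → f 0 *ᶻ g (suc k)) +ˢ ((f ∘ suc) ⊛ g)) ⊛ h) n
    ≡⟨ cong ((f 0 *ᶻ g 0 +ᶻ 0ℤ) *ᶻ h (suc n) +ᶻ_) (trans (⊛-distribʳ h (λ k → f 0 *ᶻ g (suc k)) ((f ∘ suc) ⊛ g) n)
         (cong₂ _+ᶻ_ (⊛-scaleˡ (f 0) (g ∘ suc) h n) (⊛-assoc (f ∘ suc) g h n))) ⟩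
  (f 0 *ᶻ g 0 +ᶻ 0ℤ) *ᶻ h (suc n) +ᶻ (f 0 *ᶻ ((g ∘ suc) ⊛ h) n +ᶻ ((f ∘ suc) ⊛ (g ⊛ h)) n)
    ≡⟨ lemma (f 0) (g 0) (h (suc n)) _ _ ⟩
  f 0 *ᶻ (g 0 *ᶻ h (suc n) +ᶻ ((g ∘ suc) ⊛ h) n) +ᶻ ((f ∘ suc) ⊛ (g ⊛ h)) n ∎
  where
  open ≡-Reasoning
  lemma : ∀ a b c d e → (a *ᶻ b +ᶻ 0ℤ) *ᶻ c +ᶻ (a *ᶻ d +ᶻ e) ≡ a *ᶻ (b *ᶻ c +ᶻ d) +ᶻ e
  lemma = solve-∀

⊛-zeroˡ : ∀ g → 0ˢ ⊛ g ≗ˢ 0ˢ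
⊛-zeroˡ g n = sum-zero {suc n} λ i → ℤ.*-zeroˡ (g (n ∸ toℕ i))

⊛-identityˡ : ∀ g → one ⊛ g ≗ˢ g
⊛-identityˡ g zero    = trans (ℤ.+-identityʳ _) (ℤ.*-identityˡ (g 0))
⊛-identityˡ g (suc n) = trans (cong₂ _+ᶻ_ (ℤ.*-identityˡ (g (suc n))) (⊛-zeroˡ g n)) (ℤ.+-identityʳ _)

abstract
  series-isCommutativeRing : IsCommutativeRing _≗ˢ_ _+ˢ_ _⊛_ -ˢ_ 0ˢ one
  series-isCommutativeRing = record
    { isRing = record
      { +-isAbelianGroup = AbelianGroup.isAbelianGroup (Pointwise.abelianGroup ℕ ℤ.+-0-abelianGroup)
      ; *-cong = ⊛-cong
      ; *-assoc = ⊛-assoc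
      ; *-identity = ⊛-identityˡ , λ g n → trans (⊛-comm g one n) (⊛-identityˡ g n)
      ; distrib = (λ f g h n → trans (⊛-comm f (g +ˢ h) n) (trans (⊛-distribʳ f g h n) (cong₂ _+ᶻ_ (⊛-comm g f n) (⊛-comm h f n))))
                , ⊛-distribʳ
      }
    ; *-comm = ⊛-comm
    }

seriesRing : CommutativeRing 0ℓ 0ℓ
seriesRing = record { isCommutativeRing = series-isCommutativeRing }

-- The derivation u d/du.
∂ : Series → Series
∂ f n = + n *ᶻ f n

∂-⊛ : ∀ f g → ∂ (f ⊛ g) ≗ˢ ∂ f ⊛ g +ˢ f ⊛ ∂ g
∂-⊛ f g n = begin
  + n *ᶻ (f ⊛ g) n
    ≡⟨ *-distribˡ-sum {suc n} (+ n) (λ i → f (toℕ i) *ᶻ g (n ∸ toℕ i)) ⟩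
  ∑[ i < suc n ] (+ n *ᶻ (f (toℕ i) *ᶻ g (n ∸ toℕ i)))
    ≡⟨ sum-cong-≗ {suc n} (λ i → trans (cong (λ m → + m *ᶻ (f (toℕ i) *ᶻ g (n ∸ toℕ i))) (sym (ℕ.m+[n∸m]≡n (ℕ.≤-pred (Fin.toℕ<n i)))))
         (lemma (+ toℕ i) (+ (n ∸ toℕ i)) (f (toℕ i)) (g (n ∸ toℕ i)))) ⟩
  ∑[ i < suc n ] (∂ f (toℕ i) *ᶻ g (n ∸ toℕ i) +ᶻ f (toℕ i) *ᶻ ∂ g (n ∸ toℕ i))
    ≡⟨ ∑-distrib-+ {suc n} (λ i → ∂ f (toℕ i) *ᶻ g (n ∸ toℕ i)) (λ i → f (toℕ i) *ᶻ ∂ g (n ∸ toℕ i)) ⟩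
  (∂ f ⊛ g +ˢ f ⊛ ∂ g) n ∎
  where
  open ≡-Reasoning
  lemma : ∀ i j a b → (i +ᶻ j) *ᶻ (a *ᶻ b) ≡ (i *ᶻ a) *ᶻ b +ᶻ a *ᶻ (j *ᶻ b)
  lemma = solve-∀

module Sdet = DeterminantTheorems seriesRing

sumˢ : ∀ {m} (f : Fin m → Series) n → Sdet.sum f n ≡ ∑[ i < m ] f i n
sumˢ {zero}  f n = refl
sumˢ {suc m} f n = cong (f zero n +ᶻ_) (sumˢ (λ i → f (suc i)) n)

∂-cong : ∀ {f g} → f ≗ˢ g → ∂ f ≗ˢ ∂ g
∂-cong eq n = cong (+ n *ᶻ_) (eq n)

∂-+ˢ : ∀ f g → ∂ (f +ˢ g) ≗ˢ ∂ f +ˢ ∂ g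
∂-+ˢ f g n = ℤ.*-distribˡ-+ (+ n) (f n) (g n)

∂-one : ∂ one ≗ˢ 0ˢ
∂-one zero    = refl
∂-one (suc n) = ℤ.*-zeroʳ (+ suc n)

open Sdet.Jacobi ∂ ∂-cong ∂-+ˢ ∂-⊛ ∂-one using (∂-det-≋)

-- The ring of integer polynomials.

infixl 6 _+ᴾ_
_+ᴾ_ : Polynomial → Polynomial → Polynomial
[]      +ᴾ Q       = Q
(a ∷ P) +ᴾ []      = a ∷ P
(a ∷ P) +ᴾ (b ∷ Q) = (a +ᶻ b) ∷ (P +ᴾ Q)

infixl 7 _*ᴾ_
_*ᴾ_ : Polynomial → Polynomial → Polynomial
[]      *ᴾ Q = []
(a ∷ P) *ᴾ Q = map (a *ᶻ_) Q +ᴾ (0ℤ ∷ (P *ᴾ Q))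

-ᴾ_ : Polynomial → Polynomial
-ᴾ_ = map (-_)

coeff-+ : ∀ P Q → coeff (P +ᴾ Q) ≗ˢ coeff P +ˢ coeff Q
coeff-+ []      Q       n       = sym (ℤ.+-identityˡ _)
coeff-+ (a ∷ P) []      n       = sym (ℤ.+-identityʳ _)
coeff-+ (a ∷ P) (b ∷ Q) zero    = refl
coeff-+ (a ∷ P) (b ∷ Q) (suc n) = coeff-+ P Q n

coeff-map : ∀ (h : ℤ → ℤ) → h 0ℤ ≡ 0ℤ → ∀ P n → coeff (map h P) n ≡ h (coeff P n)
coeff-map h h0 []      n       = sym h0
coeff-map h h0 (a ∷ P) zero    = refl
coeff-map h h0 (a ∷ P) (suc n) = coeff-map h h0 P n

coeff-scale : ∀ a P n → coeff (map (a *ᶻ_) P) n ≡ a *ᶻ coeff P n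
coeff-scale a = coeff-map (a *ᶻ_) (ℤ.*-zeroʳ a)

coeff-* : ∀ P Q → coeff (P *ᴾ Q) ≗ˢ coeff P ⊛ coeff Q
coeff-* [] Q n = sym (⊛-zeroˡ (coeff Q) n)
coeff-* (a ∷ P) Q zero = trans (coeff-+ (map (a *ᶻ_) Q) _ 0) (cong (_+ᶻ 0ℤ) (coeff-scale a Q 0))
coeff-* (a ∷ P) Q (suc n) = trans (coeff-+ (map (a *ᶻ_) Q) _ (suc n)) (cong₂ _+ᶻ_ (coeff-scale a Q (suc n)) (coeff-* P Q n))

1ᴾ : Polynomial
1ᴾ = 1ℤ ∷ []

coeff-1 : coeff 1ᴾ ≗ˢ one
coeff-1 zero    = refl
coeff-1 (suc n) = refl

infix 4 _≈ᴾ_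
-- Lists may end in zeros, so equality is that of coefficients. The record wrapper makes P and Q
-- recoverable from the type of a proof.
record _≈ᴾ_ (P Q : Polynomial) : Set where
  constructor coeffwise
  field coeff-≡ : coeff P ≗ˢ coeff Q

open _≈ᴾ_ public

abstract
  -- `coeff` is an injective homomorphism into power series, by the very definition of `_≈ᴾ_`, so
  -- the ring laws are pulled back.
  polynomial-isCommutativeRing : IsCommutativeRing _≈ᴾ_ _+ᴾ_ _*ᴾ_ -ᴾ_ [] 1ᴾ
  polynomial-isCommutativeRing = RingMonomorphism.isCommutativeRing
    {R₁ = record { Carrier = Polynomial ; _≈_ = _≈ᴾ_ ; _+_ = _+ᴾ_ ; _*_ = _*ᴾ_ ; -_ = -ᴾ_ ; 0# = [] ; 1# = 1ᴾ }}
    {R₂ = CommutativeRing.rawRing seriesRing}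
    (record { isRingHomomorphism = record
      { isSemiringHomomorphism = record
        { isNearSemiringHomomorphism = record
          { +-isMonoidHomomorphism = record
            { isMagmaHomomorphism = record { isRelHomomorphism = record { cong = coeff-≡ } ; homo = coeff-+ }
            ; ε-homo = λ _ → refl }
          ; *-homo = coeff-* }
        ; 1#-homo = coeff-1 }
      ; -‿homo = coeff-map (-_) refl }
      ; injective = coeffwise })
    (CommutativeRing.isCommutativeRing seriesRing)

polynomialRing : CommutativeRing 0ℓ 0ℓ
polynomialRing = record { isCommutativeRing = polynomial-isCommutativeRing }

module Pdet = DeterminantTheorems polynomialRing
module 𝒫 = CommutativeRing polynomialRing
module 𝒮 = CommutativeRing seriesRing

eval-zero : ∀ x P → (∀ n → coeff P n ≡ 0ℤ) → eval P x ≡ 0ℤ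
eval-zero x []      eq = refl
eval-zero x (a ∷ P) eq = trans (cong₂ (λ b c → b +ᶻ x *ᶻ c) (eq 0) (eval-zero x P (eq ∘ suc)))
  (trans (ℤ.+-identityˡ _) (ℤ.*-zeroʳ x))

eval-cong : ∀ x {P Q} → P ≈ᴾ Q → eval P x ≡ eval Q x
eval-cong x {[]}    {Q}     (coeffwise eq) = sym (eval-zero x Q λ n → sym (eq n))
eval-cong x {a ∷ P} {[]}    (coeffwise eq) = eval-zero x (a ∷ P) eq
eval-cong x {a ∷ P} {b ∷ Q} (coeffwise eq) = cong₂ (λ b c → b +ᶻ x *ᶻ c) (eq 0) (eval-cong x {P} {Q} (coeffwise (eq ∘ suc)))

eval-+ : ∀ x P Q → eval (P +ᴾ Q) x ≡ eval P x +ᶻ eval Q x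
eval-+ x []      Q       = sym (ℤ.+-identityˡ _)
eval-+ x (a ∷ P) []      = sym (ℤ.+-identityʳ _)
eval-+ x (a ∷ P) (b ∷ Q) = trans (cong (λ c → (a +ᶻ b) +ᶻ x *ᶻ c) (eval-+ x P Q)) (lemma a b x (eval P x) (eval Q x))
  where
  lemma : ∀ a b x p q → (a +ᶻ b) +ᶻ x *ᶻ (p +ᶻ q) ≡ (a +ᶻ x *ᶻ p) +ᶻ (b +ᶻ x *ᶻ q)
  lemma = solve-∀

eval-scale : ∀ x a P → eval (map (a *ᶻ_) P) x ≡ a *ᶻ eval P x
eval-scale x a []      = sym (ℤ.*-zeroʳ a)
eval-scale x a (b ∷ P) = trans (cong (λ c → a *ᶻ b +ᶻ x *ᶻ c) (eval-scale x a P)) (lemma a b x (eval P x))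
  where
  lemma : ∀ a b x p → a *ᶻ b +ᶻ x *ᶻ (a *ᶻ p) ≡ a *ᶻ (b +ᶻ x *ᶻ p)
  lemma = solve-∀

eval-neg : ∀ x P → eval (-ᴾ P) x ≡ - eval P x
eval-neg x []      = refl
eval-neg x (b ∷ P) = trans (cong (λ c → - b +ᶻ x *ᶻ c) (eval-neg x P)) (lemma b x (eval P x))
  where
  lemma : ∀ b x p → - b +ᶻ x *ᶻ (- p) ≡ - (b +ᶻ x *ᶻ p)
  lemma = solve-∀

eval-* : ∀ x P Q → eval (P *ᴾ Q) x ≡ eval P x *ᶻ eval Q x
eval-* x []      Q = sym (ℤ.*-zeroˡ (eval Q x))
eval-* x (a ∷ P) Q = trans (eval-+ x (map (a *ᶻ_) Q) _)
  (trans (cong₂ (λ b c → b +ᶻ (0ℤ +ᶻ x *ᶻ c)) (eval-scale x a Q) (eval-* x P Q)) (lemma a x (eval P x) (eval Q x)))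
  where
  lemma : ∀ a x p q → a *ᶻ q +ᶻ (0ℤ +ᶻ x *ᶻ (p *ᶻ q)) ≡ (a +ᶻ x *ᶻ p) *ᶻ q
  lemma = solve-∀

eval-1 : ∀ x → eval 1ᴾ x ≡ 1ℤ
eval-1 x = trans (cong (1ℤ +ᶻ_) (ℤ.*-zeroʳ x)) refl

-- Fraction-free elimination and ranks over ℤ.

Vecℤ : ℕ → Set
Vecℤ m = Fin m → ℤ

comb : ∀ {k m} → Vecℤ k → (Fin k → Vecℤ m) → Vecℤ m
comb {k} a g j = ∑[ i < k ] (a i *ᶻ g i j)

zero⊎pivot : ∀ {n} (f : Vecℤ n) → (∀ i → f i ≡ 0ℤ) ⊎ (∃ λ i → f i ≢ 0ℤ)
zero⊎pivot f with Fin.any? (λ i → ¬? (f i ℤ.≟ 0ℤ))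
... | yes p = inj₂ p
... | no ¬p = inj₁ λ i → case f i ℤ.≟ 0ℤ of λ { (yes eq) → eq ; (no neq) → ⊥-elim (¬p (i , neq)) }

*-nonzero : ∀ {a b} → a ≢ 0ℤ → b ≢ 0ℤ → a *ᶻ b ≢ 0ℤ
*-nonzero {a} a≢0 b≢0 eq with ℤ.i*j≡0⇒i≡0∨j≡0 a eq
... | inj₁ a≡0 = a≢0 a≡0
... | inj₂ b≡0 = b≢0 b≡0

*-cancel-zero : ∀ {a b} → a ≢ 0ℤ → a *ᶻ b ≡ 0ℤ → b ≡ 0ℤ
*-cancel-zero {a} a≢0 eq with ℤ.i*j≡0⇒i≡0∨j≡0 a eq
... | inj₁ a≡0 = ⊥-elim (a≢0 a≡0)
... | inj₂ b≡0 = b≡0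

sum-combination : ∀ {n} x y (f g : Vecℤ n) → x *ᶻ sum f +ᶻ y *ᶻ sum g ≡ ∑[ i < n ] (x *ᶻ f i +ᶻ y *ᶻ g i)
sum-combination x y f g = trans (cong₂ _+ᶻ_ (*-distribˡ-sum x f) (*-distribˡ-sum y g))
  (sym (∑-distrib-+ (λ i → x *ᶻ f i) (λ i → y *ᶻ g i)))

comb-scale : ∀ {k m} c (a : Vecℤ k) (g : Fin k → Vecℤ m) j → comb (λ i → c *ᶻ a i) g j ≡ c *ᶻ comb a g j
comb-scale c a g j = trans (sum-cong-≗ λ i → ℤ.*-assoc c (a i) (g i j)) (sym (*-distribˡ-sum c (λ i → a i *ᶻ g i j)))

sum-insert : ∀ {n} (i : Fin (suc n)) (f : Vecℤ (suc n)) → sum f ≡ f i +ᶻ sum (λ a → f (punchIn i a))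
sum-insert i f = ℤdet.sum-remove {i = i} f

-- One step of Gaussian elimination with pivot `g i zero`, cross-multiplied so that no division
-- occurs.
eliminate : ∀ {k m} → (Fin (suc k) → Vecℤ (suc m)) → Fin (suc k) → Fin k → Vecℤ m
eliminate g i c j = g i zero *ᶻ g (punchIn i c) (suc j) -ᶻ g (punchIn i c) zero *ᶻ g i (suc j)

Dependent : ∀ {k m} → (Fin k → Vecℤ m) → Set
Dependent g = ∃ λ a → (∃ λ i → a i ≢ 0ℤ) × (∀ j → comb a g j ≡ 0ℤ)

eliminate-dependent : ∀ {k m} (g : Fin (suc k) → Vecℤ (suc m)) i → g i zero ≢ 0ℤ → Dependent (eliminate g i) → Dependent g
eliminate-dependent {k} {m} g i p≢0 (a , (l , al≢0) , eq) =
  b , (punchIn i l , λ bl≡0 → *-nonzero p≢0 al≢0 (trans (sym (b-punchIn l)) bl≡0)) , vanish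
  where
  p : ℤ
  p = g i zero
  s : ℤ
  s = sum (λ c → a c *ᶻ g (punchIn i c) zero)
  -- The relation among the eliminated vectors, times the pivot; the entry `- s` at the pivot row
  -- cancels the first column.
  b : Vecℤ (suc k)
  b = insertAt (λ c → p *ᶻ a c) i (- s)
  b-i : b i ≡ - s
  b-i = insertAt-lookup (λ c → p *ᶻ a c) i (- s)
  b-punchIn : ∀ c → b (punchIn i c) ≡ p *ᶻ a c
  b-punchIn = insertAt-punchIn (λ c → p *ᶻ a c) i (- s)
  split : ∀ j → comb b g j ≡ - s *ᶻ g i j +ᶻ p *ᶻ sum (λ c → a c *ᶻ g (punchIn i c) j)
  split j = trans (sum-insert i (λ c → b c *ᶻ g c j)) (cong₂ _+ᶻ_ (cong (_*ᶻ g i j) b-i)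
    (trans (sum-cong-≗ λ c → trans (cong (_*ᶻ g (punchIn i c) j) (b-punchIn c)) (ℤ.*-assoc p (a c) (g (punchIn i c) j)))
      (sym (*-distribˡ-sum p (λ c → a c *ᶻ g (punchIn i c) j)))))
  vanish : ∀ j → comb b g j ≡ 0ℤ
  vanish zero = trans (split zero) (lemma s p)
    where
    lemma : ∀ s p → - s *ᶻ p +ᶻ p *ᶻ s ≡ 0ℤ
    lemma = solve-∀
  vanish (suc j) = begin
    comb b g (suc j)
      ≡⟨ split (suc j) ⟩
    - s *ᶻ g i (suc j) +ᶻ p *ᶻ t
      ≡⟨ lemma s (g i (suc j)) p t ⟩
    p *ᶻ t +ᶻ (- g i (suc j)) *ᶻ s
      ≡⟨ sum-combination p (- g i (suc j)) (λ c → a c *ᶻ g (punchIn i c) (suc j)) (λ c → a c *ᶻ g (punchIn i c) zero) ⟩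
    ∑[ c < k ] (p *ᶻ (a c *ᶻ g (punchIn i c) (suc j)) +ᶻ (- g i (suc j)) *ᶻ (a c *ᶻ g (punchIn i c) zero))
      ≡⟨ sum-cong-≗ (λ c → lemma′ p (a c) (g (punchIn i c) (suc j)) (g i (suc j)) (g (punchIn i c) zero)) ⟩
    comb a (eliminate g i) j
      ≡⟨ eq j ⟩
    0ℤ ∎
    where
    open ≡-Reasoning
    t : ℤ
    t = sum (λ c → a c *ᶻ g (punchIn i c) (suc j))
    lemma : ∀ s x p t → - s *ᶻ x +ᶻ p *ᶻ t ≡ p *ᶻ t +ᶻ (- x) *ᶻ s
    lemma = solve-∀
    lemma′ : ∀ p a x y z → p *ᶻ (a *ᶻ x) +ᶻ (- y) *ᶻ (a *ᶻ z) ≡ a *ᶻ (p *ᶻ x -ᶻ z *ᶻ y)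
    lemma′ = solve-∀

dependent : ∀ {m k} (g : Fin k → Vecℤ m) → m < k → Dependent g
dependent {zero}  {suc k} g _ = (λ _ → 1ℤ) , (zero , λ ()) , λ ()
dependent {suc m} {suc k} g (s≤s m<k) with zero⊎pivot (λ i → g i zero)
... | inj₂ (i , p≢0) = eliminate-dependent g i p≢0 (dependent (eliminate g i) m<k)
... | inj₁ first-zero with a , a≢0 , eq ← dependent (λ i j → g i (suc j)) (ℕ.m<n⇒m<1+n m<k) =
  a , a≢0 , λ { zero → sum-zero λ i → trans (cong (a i *ᶻ_) (first-zero i)) (ℤ.*-zeroʳ (a i)) ; (suc j) → eq j }

Subset : ℕ → Set₁
Subset m = Vecℤ m → Set

Respects≗ : ∀ {m} → Subset m → Set
Respects≗ I = ∀ {x y} → (∀ j → x j ≡ y j) → I x → I y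

IndependentMod : ∀ {m} → Subset m → ∀ {k} → (Fin k → Vecℤ m) → Set
IndependentMod I {k} g = ∀ (a : Vecℤ k) → I (comb a g) → ∀ i → a i ≡ 0ℤ

-- The rank of the quotient of ℤᵐ by I in coordinates. I is any subset, so that images of matrices
-- and images of polynomials in a matrix are treated alike.
RankMod : ∀ {m} → Subset m → ℕ → Set
RankMod {m} I b = (∃ λ (g : Fin b → Vecℤ m) → IndependentMod I g)
                × (∀ k (g : Fin k → Vecℤ m) → IndependentMod I g → k ≤ b)

Image : ∀ {m n} → Matrix m n → Subset m
Image M x = ∃ λ z → ∀ j → x j ≡ (M *ᵛ z) j

module _ {m n} (M : Matrix m n) where
  open AbelianGroup (coker M) using (monoid; commutativeMonoid)
  open import Algebra.Properties.Monoid.Mult monoid using () renaming (_×_ to _×ᴳ_)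
  open import Algebra.Properties.CommutativeMonoid.Sum commutativeMonoid using () renaming (sum to sumᴳ)

  private
    ×ᴳ-lookup : ∀ k x j → (k ×ᴳ x) j ≡ + k *ᶻ x j
    ×ᴳ-lookup zero    x j = refl
    ×ᴳ-lookup (suc k) x j = trans (cong (x j +ᶻ_) (×ᴳ-lookup k x j)) (lemma (+ k) (x j))
      where
      lemma : ∀ k x → x +ᶻ k *ᶻ x ≡ (1ℤ +ᶻ k) *ᶻ x
      lemma = solve-∀

    ·-lookup : ∀ a x j → (_·_ (coker M) a x) j ≡ a *ᶻ x j
    ·-lookup (+ k)    x j = ×ᴳ-lookup k x j
    ·-lookup -[1+ k ] x j = trans (cong -_ (×ᴳ-lookup (suc k) x j)) (ℤ.neg-distribˡ-* (+ suc k) (x j))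

    sumᴳ-lookup : ∀ {k} (a : Vecℤ k) (g : Fin k → Vecℤ m) j → sumᴳ (λ i → _·_ (coker M) (a i) (g i)) j ≡ comb a g j
    sumᴳ-lookup {zero}  a g j = refl
    sumᴳ-lookup {suc k} a g j = cong₂ _+ᶻ_ (·-lookup (a zero) (g zero) j) (sumᴳ-lookup (λ i → a (suc i)) (λ i → g (suc i)) j)

    x-0≡x : ∀ x → x -ᶻ 0ℤ ≡ x
    x-0≡x = solve-∀

    independent : ∀ {k} (g : Fin k → Vecℤ m) → Independent (coker M) g ⇔ IndependentMod (Image M) g
    independent g = mk⇔
      (λ ind a (z , eq) → ind a (z , λ j → trans (x-0≡x _) (trans (sumᴳ-lookup a g j) (eq j))))
      (λ ind a (z , eq) → ind a (z , λ j → trans (sym (sumᴳ-lookup a g j)) (trans (sym (x-0≡x _)) (eq j))))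

  HasRank⇔RankMod : ∀ b → HasRank (coker M) b ⇔ RankMod (Image M) b
  HasRank⇔RankMod b = mk⇔
    (λ ((g , ind) , max) → (g , Equivalence.to (independent g) ind) , λ k h → max k h ∘ Equivalence.from (independent h))
    (λ ((g , ind) , max) → (g , Equivalence.from (independent g) ind) , λ k h → max k h ∘ Equivalence.to (independent h))

BF-matrix : ∀ Y → Matrix (Digraph.order Y) (Digraph.order Y)
BF-matrix Y i j = Id i j -ᶻ adjacency Y i j

BF-HasRank⇔RankMod : ∀ Y b → HasRank (BF Y) b ⇔ RankMod (Image (BF-matrix Y)) b
BF-HasRank⇔RankMod Y = HasRank⇔RankMod (BF-matrix Y)

HasRank-unique : ∀ {c ℓ} (G : AbelianGroup c ℓ) {b b′} → HasRank G b → HasRank G b′ → b ≡ b′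
HasRank-unique G ((g , ind) , max) ((g′ , ind′) , max′) = ℕ.≤-antisym (max′ _ g ind) (max _ g′ ind′)

-- The hypotheses say that L induces a map of quotients with torsion kernel and torsion cokernel,
-- that is, an isomorphism after tensoring with ℚ. Independent families then push forward and pull
-- back, with the scalars c absorbed into the coefficients.
module Transfer {m m′ : ℕ} {I : Subset m} {I′ : Subset m′} (I-resp : Respects≗ I) (I′-resp : Respects≗ I′)
  (L : Vecℤ m → Vecℤ m′) (L-comb : ∀ {k : ℕ} (a : Vecℤ k) (g : Fin k → Vecℤ m) (j : Fin m′) → L (comb a g) j ≡ comb a (λ i → L (g i)) j)
  (preserve : ∀ (x : Vecℤ m) → I x → I′ (L x))
  (reflect : ∀ (x : Vecℤ m) → I′ (L x) → ∃ λ (c : ℤ) → c ≢ 0ℤ × I (λ j → c *ᶻ x j))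
  (onto : ∀ (y : Vecℤ m′) → ∃ λ (x : Vecℤ m) → ∃ λ (c : ℤ) → c ≢ 0ℤ × (∀ (j : Fin m′) → L x j ≡ c *ᶻ y j)) where

  private
    push : ∀ {k} {g : Fin k → Vecℤ m} → IndependentMod I g → IndependentMod I′ (λ i → L (g i))
    push {g = g} ind a Ix with c , c≢0 , Icx ← reflect (comb a g) (I′-resp (λ j → sym (L-comb a g j)) Ix) =
      λ i → *-cancel-zero c≢0 (ind (λ i → c *ᶻ a i) (I-resp (λ j → sym (comb-scale c a g j)) Icx) i)

    pull : ∀ {k} (h : Fin k → Vecℤ m′) → IndependentMod I′ h → IndependentMod I (λ i → proj₁ (onto (h i)))
    pull h ind a Ix i = *-cancel-zero (proj₁ (proj₂ (proj₂ (onto (h i))))) (trans (ℤ.*-comm (scale i) (a i)) (ind (λ i → a i *ᶻ scale i)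
      (I′-resp (λ j → trans (L-comb a _ j) (sum-cong-≗ λ i → trans (cong (a i *ᶻ_) (proj₂ (proj₂ (proj₂ (onto (h i)))) j))
        (sym (ℤ.*-assoc (a i) (scale i) (h i j))))) (preserve _ Ix)) i))
      where
      scale : ∀ i → ℤ
      scale i = proj₁ (proj₂ (onto (h i)))

  to : ∀ {b} → RankMod I b → RankMod I′ b
  to ((g , ind) , max) = (_ , push ind) , λ k h ind′ → max k _ (pull h ind′)

  from : ∀ {b} → RankMod I′ b → RankMod I b
  from ((g , ind) , max) = (_ , pull g ind) , λ k h ind′ → max k _ (push ind′)

Image-resp : ∀ {m n} (M : Matrix m n) → Respects≗ (Image M)
Image-resp M eq (z , eq′) = z , λ j → trans (sym (eq j)) (eq′ j)

-- Induction on the columns: with none left the quotient is ℤᵐ; a zero column may be dropped; a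
-- pivot removes its row and its column and changes the quotient only by torsion.
Image-rank : ∀ {m n} (M : Matrix m n) → ∃ λ b → RankMod (Image M) b
Image-rank {m} {zero} M = m , (𝟙 , λ a (_ , eq) i → trans (sym (ℤdet.sum-𝟙ʳ a i)) (eq i)) , bound
  where
  bound : ∀ k (g : Fin k → Vecℤ m) → IndependentMod (Image M) g → k ≤ m
  bound k g ind with k ℕ.≤? m
  ... | yes k≤m = k≤m
  ... | no k≰m with a , (i , ai≢0) , eq ← dependent g (ℕ.≰⇒> k≰m) = ⊥-elim (ai≢0 (ind a ((λ ()) , eq) i))
Image-rank {m} {suc n} M with zero⊎pivot (λ i → M i zero)
... | inj₁ first-zero = let b , rank = Image-rank M₊ in b ,
  Transfer.from (Image-resp M) (Image-resp M₊) (λ x → x) (λ a g j → refl) preserve reflect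
    (λ y → y , 1ℤ , (λ ()) , λ j → sym (ℤ.*-identityˡ (y j))) rank
  where
  M₊ : Matrix m n
  M₊ i j = M i (suc j)
  extend : Vecℤ n → Vecℤ (suc n)
  extend z zero    = 0ℤ
  extend z (suc j) = z j
  preserve : ∀ x → Image M x → Image M₊ x
  preserve x (z , eq) = (λ j → z (suc j)) , λ j → trans (eq j)
    (trans (cong (λ c → c *ᶻ z zero +ᶻ (M₊ *ᵛ (λ j → z (suc j))) j) (first-zero j)) (ℤ.+-identityˡ _))
  reflect : ∀ x → Image M₊ x → ∃ λ c → c ≢ 0ℤ × Image M (λ j → c *ᶻ x j)
  reflect x (z , eq) = 1ℤ , (λ ()) , extend z , λ j → trans (ℤ.*-identityˡ (x j)) (trans (eq j)
    (sym (trans (cong (_+ᶻ (M₊ *ᵛ z) j) (ℤ.*-zeroʳ (M j zero))) (ℤ.+-identityˡ _))))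
Image-rank {suc m} {suc n} M | inj₂ (i , p≢0) = let b , rank = Image-rank M′ in b ,
  Transfer.from (Image-resp M) (Image-resp M′) L L-comb preserve reflect onto rank
  where
  p : ℤ
  p = M i zero
  -- Clears row entries against the pivot. It annihilates the first column of `M`, and `M′` consists
  -- of the images of the other columns.
  L : Vecℤ (suc m) → Vecℤ m
  L x a = p *ᶻ x (punchIn i a) +ᶻ (- M (punchIn i a) zero) *ᶻ x i
  M′ : Matrix m n
  M′ a j = L (λ k → M k (suc j)) a
  swap : ∀ p a x → p *ᶻ (a *ᶻ x) ≡ a *ᶻ (p *ᶻ x)
  swap = solve-∀
  L-comb : ∀ {k} (a : Vecℤ k) g j → L (comb a g) j ≡ comb a (λ i → L (g i)) j
  L-comb a g j = trans (sum-combination p (- M (punchIn i j) zero) (λ l → a l *ᶻ g l (punchIn i j)) (λ l → a l *ᶻ g l i))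
    (sum-cong-≗ λ l → lemma p (- M (punchIn i j) zero) (a l) (g l (punchIn i j)) (g l i))
    where
    lemma : ∀ p q a x y → p *ᶻ (a *ᶻ x) +ᶻ q *ᶻ (a *ᶻ y) ≡ a *ᶻ (p *ᶻ x +ᶻ q *ᶻ y)
    lemma = solve-∀
  preserve : ∀ x → Image M x → Image M′ (L x)
  preserve x (z , eq) = (λ j → z (suc j)) , λ a → begin
    L x a
      ≡⟨ cong₂ (λ u v → p *ᶻ u +ᶻ (- M (punchIn i a) zero) *ᶻ v) (eq (punchIn i a)) (eq i) ⟩
    p *ᶻ (M *ᵛ z) (punchIn i a) +ᶻ (- M (punchIn i a) zero) *ᶻ (M *ᵛ z) i
      ≡⟨ sum-combination p (- M (punchIn i a) zero) (λ j → M (punchIn i a) j *ᶻ z j) (λ j → M i j *ᶻ z j) ⟩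
    (p *ᶻ (M (punchIn i a) zero *ᶻ z zero) +ᶻ (- M (punchIn i a) zero) *ᶻ (p *ᶻ z zero)) +ᶻ _
      ≡⟨ cong₂ _+ᶻ_ (lemma p (M (punchIn i a) zero) (z zero)) (sum-cong-≗ λ j → lemma′ p (- M (punchIn i a) zero) (M (punchIn i a) (suc j)) (M i (suc j)) (z (suc j))) ⟩
    0ℤ +ᶻ (M′ *ᵛ (λ j → z (suc j))) a
      ≡⟨ ℤ.+-identityˡ _ ⟩
    (M′ *ᵛ (λ j → z (suc j))) a ∎
    where
    open ≡-Reasoning
    lemma : ∀ p c z → p *ᶻ (c *ᶻ z) +ᶻ (- c) *ᶻ (p *ᶻ z) ≡ 0ℤ
    lemma = solve-∀
    lemma′ : ∀ p q x y z → p *ᶻ (x *ᶻ z) +ᶻ q *ᶻ (y *ᶻ z) ≡ (p *ᶻ x +ᶻ q *ᶻ y) *ᶻ z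
    lemma′ = solve-∀
  reflect : ∀ x → Image M′ (L x) → ∃ λ c → c ≢ 0ℤ × Image M (λ j → c *ᶻ x j)
  reflect x (w , eq) = p , p≢0 , z , λ k → by-row k (k Fin.≟ i)
    where
    open ≡-Reasoning
    s : ℤ
    s = ∑[ j < n ] (M i (suc j) *ᶻ w j)
    -- The solution w scaled by the pivot; the first entry is then forced by row `i`.
    z : Vecℤ (suc n)
    z zero    = x i -ᶻ s
    z (suc j) = p *ᶻ w j
    M*z : ∀ k → (M *ᵛ z) k ≡ M k zero *ᶻ (x i -ᶻ s) +ᶻ p *ᶻ (∑[ j < n ] (M k (suc j) *ᶻ w j))
    M*z k = cong (M k zero *ᶻ (x i -ᶻ s) +ᶻ_) (trans (sum-cong-≗ λ j → sym (swap p (M k (suc j)) (w j))) (sym (*-distribˡ-sum p (λ j → M k (suc j) *ᶻ w j))))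
    by-row : ∀ k → Dec (k ≡ i) → p *ᶻ x k ≡ (M *ᵛ z) k
    by-row k (yes refl) = sym (trans (M*z k) (lemma p (x k) s))
      where
      lemma : ∀ p x s → p *ᶻ (x -ᶻ s) +ᶻ p *ᶻ s ≡ p *ᶻ x
      lemma = solve-∀
    by-row k (no k≢i) = subst (λ k → p *ᶻ x k ≡ (M *ᵛ z) k) (Fin.punchIn-punchOut (k≢i ∘ sym)) (row (punchOut (k≢i ∘ sym)))
      where
      row : ∀ a → p *ᶻ x (punchIn i a) ≡ (M *ᵛ z) (punchIn i a)
      row a = begin
        p *ᶻ x k′
          ≡⟨ lemma (p *ᶻ x k′) (M k′ zero) (x i) ⟩
        L x a +ᶻ M k′ zero *ᶻ x i
          ≡⟨ cong (_+ᶻ M k′ zero *ᶻ x i) (trans (eq a) (trans (sum-cong-≗ λ j → lemma″ p (- M k′ zero) (M k′ (suc j)) (M i (suc j)) (w j))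
               (sym (sum-combination p (- M k′ zero) (λ j → M k′ (suc j) *ᶻ w j) (λ j → M i (suc j) *ᶻ w j))))) ⟩
        (p *ᶻ t +ᶻ (- M k′ zero) *ᶻ s) +ᶻ M k′ zero *ᶻ x i
          ≡⟨ lemma′ p t (M k′ zero) s (x i) ⟩
        M k′ zero *ᶻ (x i -ᶻ s) +ᶻ p *ᶻ t
          ≡⟨ M*z k′ ⟨
        (M *ᵛ z) k′ ∎
        where
        k′ : Fin (suc m)
        k′ = punchIn i a
        t : ℤ
        t = ∑[ j < n ] (M k′ (suc j) *ᶻ w j)
        lemma : ∀ a c x → a ≡ (a +ᶻ (- c) *ᶻ x) +ᶻ c *ᶻ x
        lemma = solve-∀
        lemma′ : ∀ p t c s x → (p *ᶻ t +ᶻ (- c) *ᶻ s) +ᶻ c *ᶻ x ≡ c *ᶻ (x -ᶻ s) +ᶻ p *ᶻ t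
        lemma′ = solve-∀
        lemma″ : ∀ p q x y z → (p *ᶻ x +ᶻ q *ᶻ y) *ᶻ z ≡ p *ᶻ (x *ᶻ z) +ᶻ q *ᶻ (y *ᶻ z)
        lemma″ = solve-∀
  onto : ∀ y → ∃ λ x → ∃ λ c → c ≢ 0ℤ × (∀ j → L x j ≡ c *ᶻ y j)
  onto y = insertAt y i 0ℤ , p , p≢0 , λ j → trans
    (cong₂ (λ u v → p *ᶻ u +ᶻ (- M (punchIn i j) zero) *ᶻ v) (insertAt-punchIn y i 0ℤ j) (insertAt-lookup y i 0ℤ))
    (lemma (p *ᶻ y j) (- M (punchIn i j) zero))
    where
    lemma : ∀ a b → a +ᶻ b *ᶻ 0ℤ ≡ a
    lemma = solve-∀

-- Polynomials near u = 1.

open GeometricSums polynomialRing using (geo; geo-telescope) renaming (_↑_ to _^ᴾ_; ^-congˡ to ^ᴾ-congˡ; ^-homo-* to ^ᴾ-homo-*; ^-assocʳ to ^ᴾ-assocʳ)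

⟨_⟩ : ℤ → Polynomial
⟨ a ⟩ = a ∷ []

u : Polynomial
u = 0ℤ ∷ 1ℤ ∷ []

-- All orders are taken at u = 1, so polynomials are expanded in powers of y = u - 1.
y : Polynomial
y = - 1ℤ ∷ 1ℤ ∷ []

coeff-⟨⟩* : ∀ a P n → coeff (⟨ a ⟩ *ᴾ P) n ≡ a *ᶻ coeff P n
coeff-⟨⟩* a P n = trans (coeff-+ (map (a *ᶻ_) P) (0ℤ ∷ []) n) (trans (cong₂ _+ᶻ_ (coeff-scale a P n) (zeros n)) (ℤ.+-identityʳ _))
  where
  zeros : ∀ n → coeff (0ℤ ∷ []) n ≡ 0ℤ
  zeros zero    = refl
  zeros (suc n) = refl

⟨⟩-* : ∀ a b → ⟨ a *ᶻ b ⟩ ≈ᴾ ⟨ a ⟩ *ᴾ ⟨ b ⟩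
⟨⟩-* a b = coeffwise λ { zero → sym (ℤ.+-identityʳ _) ; (suc n) → refl }

⟨⟩-cong : ∀ {a b} → a ≡ b → ⟨ a ⟩ ≈ᴾ ⟨ b ⟩
⟨⟩-cong refl = 𝒫.refl

⟨0⟩ : ⟨ 0ℤ ⟩ ≈ᴾ []
⟨0⟩ = coeffwise λ { zero → refl ; (suc n) → refl }

eval-⟨⟩ : ∀ x a → eval ⟨ a ⟩ x ≡ a
eval-⟨⟩ x a = trans (cong (a +ᶻ_) (ℤ.*-zeroʳ x)) (ℤ.+-identityʳ a)

eval-^ : ∀ x P n → eval P x ≡ 0ℤ → 0 < n → eval (P ^ᴾ n) x ≡ 0ℤ
eval-^ x P (suc n) eq _ = trans (eval-* x P (P ^ᴾ n)) (trans (cong (_*ᶻ eval (P ^ᴾ n) x) eq) (ℤ.*-zeroˡ (eval (P ^ᴾ n) x)))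

eval-u^ : ∀ n → eval (u ^ᴾ n) 1ℤ ≡ 1ℤ
eval-u^ zero    = refl
eval-u^ (suc n) = trans (eval-* 1ℤ u (u ^ᴾ n)) (cong (1ℤ *ᶻ_) (eval-u^ n))

eval-geo : ∀ n z → eval z 1ℤ ≡ 1ℤ → eval (geo n z) 1ℤ ≡ + n
eval-geo zero    z eq = refl
eval-geo (suc n) z eq = trans (eval-+ 1ℤ 1ᴾ (z *ᴾ geo n z))
  (cong (1ℤ +ᶻ_) (trans (eval-* 1ℤ z (geo n z)) (trans (cong₂ _*ᶻ_ eq (eval-geo n z eq)) (ℤ.*-identityˡ _))))

-- Synthetic division by u - 1.
quot : Polynomial → Polynomial
quot []          = []
quot (a ∷ [])    = []
quot (a ∷ b ∷ P) = eval (b ∷ P) 1ℤ ∷ quot (b ∷ P)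

quot-head : ∀ a P → coeff (quot (a ∷ P)) 0 ≡ eval P 1ℤ
quot-head a []      = refl
quot-head a (b ∷ P) = refl

quot-tail : ∀ a P n → coeff (quot (a ∷ P)) (suc n) ≡ coeff (quot P) n
quot-tail a []      n = refl
quot-tail a (b ∷ P) n = refl

length-quot : ∀ a P → length (quot (a ∷ P)) ≡ length P
length-quot a []      = refl
length-quot a (b ∷ P) = cong suc (length-quot b P)

quot-spec : ∀ P → P ≈ᴾ ⟨ eval P 1ℤ ⟩ +ᴾ y *ᴾ quot P
quot-spec P = coeffwise λ n → sym (trans (coeff-+ ⟨ eval P 1ℤ ⟩ (y *ᴾ quot P) n)
  (trans (cong (coeff ⟨ eval P 1ℤ ⟩ n +ᶻ_) (coeff-* y (quot P) n)) (go P n)))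
  where
  go : ∀ P n → coeff ⟨ eval P 1ℤ ⟩ n +ᶻ (coeff y ⊛ coeff (quot P)) n ≡ coeff P n
  go [] zero = refl
  go [] (suc n) = trans (ℤ.+-identityˡ _) (trans (⊛-comm (coeff y) 0ˢ (suc n)) (⊛-zeroˡ (coeff y) (suc n)))
  go (a ∷ P) zero = trans (cong (λ q → (a +ᶻ 1ℤ *ᶻ eval P 1ℤ) +ᶻ (- 1ℤ *ᶻ q +ᶻ 0ℤ)) (quot-head a P)) (lemma a (eval P 1ℤ))
    where
    lemma : ∀ a e → (a +ᶻ 1ℤ *ᶻ e) +ᶻ (- 1ℤ *ᶻ e +ᶻ 0ℤ) ≡ a
    lemma = solve-∀
  go (a ∷ P) (suc n) = begin
    0ℤ +ᶻ (coeff y ⊛ coeff (quot (a ∷ P))) (suc n)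
      ≡⟨ ℤ.+-identityˡ _ ⟩
    (coeff y ⊛ coeff (quot (a ∷ P))) (suc n)
      ≡⟨ ⊛-last (coeff y) (coeff (quot (a ∷ P))) n ⟩
    (coeff y ⊛ (coeff (quot (a ∷ P)) ∘ suc)) n +ᶻ coeff y (suc n) *ᶻ coeff (quot (a ∷ P)) 0
      ≡⟨ cong₂ _+ᶻ_ (⊛-cong {coeff y} (λ _ → refl) (quot-tail a P) n) (trans (cong (coeff y (suc n) *ᶻ_) (quot-head a P)) (last n)) ⟩
    (coeff y ⊛ coeff (quot P)) n +ᶻ coeff ⟨ eval P 1ℤ ⟩ n
      ≡⟨ ℤ.+-comm ((coeff y ⊛ coeff (quot P)) n) _ ⟩
    coeff ⟨ eval P 1ℤ ⟩ n +ᶻ (coeff y ⊛ coeff (quot P)) n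
      ≡⟨ go P n ⟩
    coeff P n ∎
    where
    open ≡-Reasoning
    last : ∀ n → coeff y (suc n) *ᶻ eval P 1ℤ ≡ coeff ⟨ eval P 1ℤ ⟩ n
    last zero    = ℤ.*-identityˡ _
    last (suc n) = ℤ.*-zeroˡ (eval P 1ℤ)

coeff-beyond : ∀ P n → length P ≤ n → coeff P n ≡ 0ℤ
coeff-beyond []      n       _         = refl
coeff-beyond (a ∷ P) (suc n) (s≤s l≤n) = coeff-beyond P n l≤n

take-≈ : ∀ m P → (∀ n → m ≤ n → coeff P n ≡ 0ℤ) → take m P ≈ᴾ P
take-≈ m P eq = coeffwise (go m P eq)
  where
  go : ∀ m P → (∀ n → m ≤ n → coeff P n ≡ 0ℤ) → coeff (take m P) ≗ˢ coeff P
  go zero    P       eq n       = sym (eq n z≤n)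
  go (suc m) []      eq n       = refl
  go (suc m) (a ∷ P) eq zero    = refl
  go (suc m) (a ∷ P) eq (suc n) = go m P (λ n → eq (suc n) ∘ s≤s) n

-- The cyclotomic polynomial in powers of u - 1.

module Eisenstein (p : ℕ) (pp : Prime p) where
  private instance
    p≢0 : NonZero p
    p≢0 = prime⇒nonZero pp

  open GeometricSums polynomialRing using (module PrimeCongruence)
  open PrimeCongruence p pp public using (ideal-argument)
  open PrimeCongruence p pp using (geo-eisenstein)
  open SemiringMult 𝒫.semiring using () renaming (_×_ to _×ᴾ_)

  p̂ : Polynomial
  p̂ = p ×ᴾ 1ᴾ

  ×ᴾ1≈⟨⟩ : ∀ n → n ×ᴾ 1ᴾ ≈ᴾ ⟨ + n ⟩
  ×ᴾ1≈⟨⟩ zero    = 𝒫.sym ⟨0⟩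
  ×ᴾ1≈⟨⟩ (suc n) = 𝒫.+-congˡ {1ᴾ} (×ᴾ1≈⟨⟩ n)

  -- The cyclotomic polynomial of order pⁿ⁺¹, as the quotient of 1 - z^p by 1 - z for z the pⁿ-th
  -- power of u.
  Φ : ℕ → Polynomial
  Φ n = geo p (u ^ᴾ (p ^ n))

  private
    0<d : ∀ n → 0 < (p ∸ 1) * p ^ n
    0<d n = ℕ.*-mono-≤ {1} {p ∸ 1} {1} {p ^ n} (ℕ.m<n⇒0<n∸m (ℕ.nonTrivial⇒n>1 p {{prime⇒nonTrivial pp}})) (ℕ.m^n>0 p n)

    eval-p̂ : eval p̂ 1ℤ ≡ + p
    eval-p̂ = trans (eval-cong 1ℤ (×ᴾ1≈⟨⟩ p)) (eval-⟨⟩ 1ℤ (+ p))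

    eval-form : ∀ P h → eval P 1ℤ ≡ 0ℤ → eval (P +ᴾ p̂ *ᴾ h) 1ℤ ≡ + p *ᶻ eval h 1ℤ
    eval-form P h eq = trans (eval-+ 1ℤ P (p̂ *ᴾ h))
      (trans (cong₂ _+ᶻ_ eq (trans (eval-* 1ℤ p̂ h) (cong (_*ᶻ eval h 1ℤ) eval-p̂))) (ℤ.+-identityˡ (+ p *ᶻ eval h 1ℤ)))

  eval-Φ : ∀ n → eval (Φ n) 1ℤ ≡ + p
  eval-Φ n = eval-geo p (u ^ᴾ (p ^ n)) (eval-u^ (p ^ n))

  -- At u = 1 the power of y vanishes and p = p h(1) remains. This is the Eisenstein condition that
  -- p² does not divide the constant term.
  eval-cofactor : ∀ n h → Φ n ≈ᴾ y ^ᴾ ((p ∸ 1) * p ^ n) +ᴾ p̂ *ᴾ h → eval h 1ℤ ≡ 1ℤ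
  eval-cofactor n h eq = ℤ.*-cancelˡ-≡ (+ p) (eval h 1ℤ) 1ℤ
    (trans (sym form) (trans (sym (eval-cong 1ℤ eq)) (trans (eval-Φ n) (sym (ℤ.*-identityʳ (+ p))))))
    where
    y^d : Polynomial
    y^d = y ^ᴾ ((p ∸ 1) * p ^ n)
    form : eval (y^d +ᴾ p̂ *ᴾ h) 1ℤ ≡ + p *ᶻ eval h 1ℤ
    form = eval-form y^d h (eval-^ 1ℤ y ((p ∸ 1) * p ^ n) refl (0<d n))

  Φ-eisenstein : ∀ n → ∃ λ g → Φ n ≈ᴾ y ^ᴾ ((p ∸ 1) * p ^ n) +ᴾ p̂ *ᴾ g × eval g 1ℤ ≡ 1ℤ
  -- `1ᴾ +ᴾ y` computes to `u`, so the general congruence at `y` is one for `Φ n`.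
  Φ-eisenstein n = let h , eq = geo-eisenstein n y in h , eq , eval-cofactor n h eq

-- Polynomials in a matrix, acting on vectors.

module Action {r} (A : Matrix r r) where
  *ᵛ-cong : ∀ {v w : Vecℤ r} → (∀ i → v i ≡ w i) → ∀ i → (A *ᵛ v) i ≡ (A *ᵛ w) i
  *ᵛ-cong eq i = sum-cong-≗ λ j → cong (A i j *ᶻ_) (eq j)

  *ᵛ-+ : ∀ (v w : Vecℤ r) i → (A *ᵛ (λ j → v j +ᶻ w j)) i ≡ (A *ᵛ v) i +ᶻ (A *ᵛ w) i
  *ᵛ-+ v w i = trans (sum-cong-≗ λ j → ℤ.*-distribˡ-+ (A i j) (v j) (w j)) (∑-distrib-+ (λ j → A i j *ᶻ v j) (λ j → A i j *ᶻ w j))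

  *ᵛ-comb : ∀ {k} (a : Vecℤ k) (g : Fin k → Vecℤ r) i → (A *ᵛ comb a g) i ≡ comb a (λ l → A *ᵛ g l) i
  *ᵛ-comb {k} a g i = begin
    ∑[ j < r ] (A i j *ᶻ ∑[ l < k ] (a l *ᶻ g l j))
      ≡⟨ sum-cong-≗ (λ j → *-distribˡ-sum (A i j) (λ l → a l *ᶻ g l j)) ⟩
    ∑[ j < r ] ∑[ l < k ] (A i j *ᶻ (a l *ᶻ g l j))
      ≡⟨ ∑-comm (λ j l → A i j *ᶻ (a l *ᶻ g l j)) ⟩
    ∑[ l < k ] ∑[ j < r ] (A i j *ᶻ (a l *ᶻ g l j))
      ≡⟨ sum-cong-≗ (λ l → trans (sum-cong-≗ λ j → swap (A i j) (a l) (g l j)) (sym (*-distribˡ-sum (a l) (λ j → A i j *ᶻ g l j)))) ⟩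
    comb a (λ l → A *ᵛ g l) i ∎
    where
    open ≡-Reasoning
    swap : ∀ x a y → x *ᶻ (a *ᶻ y) ≡ a *ᶻ (x *ᶻ y)
    swap = solve-∀

  *ᵛ-scale : ∀ c (v : Vecℤ r) i → (A *ᵛ (λ j → c *ᶻ v j)) i ≡ c *ᶻ (A *ᵛ v) i
  *ᵛ-scale c v i = trans (sum-cong-≗ λ j → swap (A i j) c (v j)) (sym (*-distribˡ-sum c (λ j → A i j *ᶻ v j)))
    where
    swap : ∀ x a y → x *ᶻ (a *ᶻ y) ≡ a *ᶻ (x *ᶻ y)
    swap = solve-∀

  *ᵛ-0 : ∀ i → (A *ᵛ (λ _ → 0ℤ)) i ≡ 0ℤ
  *ᵛ-0 i = sum-zero λ j → ℤ.*-zeroʳ (A i j)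

  -- P(A) v, by Horner's rule.
  act : Polynomial → Vecℤ r → Vecℤ r
  act []      v i = 0ℤ
  act (a ∷ P) v i = a *ᶻ v i +ᶻ (A *ᵛ act P v) i

  powᵛ : ℕ → Vecℤ r → Vecℤ r
  powᵛ zero    v = v
  powᵛ (suc n) v = A *ᵛ powᵛ n v

  act-cong : ∀ P {v w} → (∀ i → v i ≡ w i) → ∀ i → act P v i ≡ act P w i
  act-cong []      eq i = refl
  act-cong (a ∷ P) eq i = cong₂ (λ x z → a *ᶻ x +ᶻ z) (eq i) (*ᵛ-cong (act-cong P eq) i)

  act-comb : ∀ P {k} (a : Vecℤ k) (g : Fin k → Vecℤ r) i → act P (comb a g) i ≡ comb a (λ l → act P (g l)) i
  act-comb []      a g i = sym (sum-zero λ l → ℤ.*-zeroʳ (a l))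
  act-comb (c ∷ P) {k} a g i = begin
    c *ᶻ comb a g i +ᶻ (A *ᵛ act P (comb a g)) i
      ≡⟨ cong (c *ᶻ comb a g i +ᶻ_) (trans (*ᵛ-cong (act-comb P a g) i) (trans (*ᵛ-comb a (λ l → act P (g l)) i) (sym (ℤ.*-identityˡ _)))) ⟩
    c *ᶻ comb a g i +ᶻ 1ℤ *ᶻ comb a (λ l → A *ᵛ act P (g l)) i
      ≡⟨ sum-combination c 1ℤ (λ l → a l *ᶻ g l i) (λ l → a l *ᶻ (A *ᵛ act P (g l)) i) ⟩
    ∑[ l < k ] (c *ᶻ (a l *ᶻ g l i) +ᶻ 1ℤ *ᶻ (a l *ᶻ (A *ᵛ act P (g l)) i))
      ≡⟨ sum-cong-≗ (λ l → lemma c (a l) (g l i) ((A *ᵛ act P (g l)) i)) ⟩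
    comb a (λ l → act (c ∷ P) (g l)) i ∎
    where
    open ≡-Reasoning
    lemma : ∀ c a x z → c *ᶻ (a *ᶻ x) +ᶻ 1ℤ *ᶻ (a *ᶻ z) ≡ a *ᶻ (c *ᶻ x +ᶻ z)
    lemma = solve-∀

  act-scaleʳ : ∀ P c v i → act P (λ j → c *ᶻ v j) i ≡ c *ᶻ act P v i
  act-scaleʳ []      c v i = sym (ℤ.*-zeroʳ c)
  act-scaleʳ (a ∷ P) c v i = trans (cong (a *ᶻ (c *ᶻ v i) +ᶻ_) (trans (*ᵛ-cong (act-scaleʳ P c v) i) (*ᵛ-scale c (act P v) i)))
    (lemma a c (v i) ((A *ᵛ act P v) i))
    where
    lemma : ∀ a c x z → a *ᶻ (c *ᶻ x) +ᶻ c *ᶻ z ≡ c *ᶻ (a *ᶻ x +ᶻ z)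
    lemma = solve-∀

  act-0ʳ : ∀ P {v} → (∀ i → v i ≡ 0ℤ) → ∀ i → act P v i ≡ 0ℤ
  act-0ʳ []      eq i = refl
  act-0ʳ (a ∷ P) eq i = trans (cong₂ (λ x z → a *ᶻ x +ᶻ z) (eq i) (trans (*ᵛ-cong (act-0ʳ P eq) i) (*ᵛ-0 i)))
    (trans (ℤ.+-identityʳ _) (ℤ.*-zeroʳ a))

  act-+ : ∀ P Q v i → act (P +ᴾ Q) v i ≡ act P v i +ᶻ act Q v i
  act-+ []      Q       v i = sym (ℤ.+-identityˡ _)
  act-+ (a ∷ P) []      v i = sym (ℤ.+-identityʳ _)
  act-+ (a ∷ P) (b ∷ Q) v i = trans (cong ((a +ᶻ b) *ᶻ v i +ᶻ_) (trans (*ᵛ-cong (act-+ P Q v) i) (*ᵛ-+ (act P v) (act Q v) i)))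
    (lemma a b (v i) ((A *ᵛ act P v) i) ((A *ᵛ act Q v) i))
    where
    lemma : ∀ a b x z w → (a +ᶻ b) *ᶻ x +ᶻ (z +ᶻ w) ≡ (a *ᶻ x +ᶻ z) +ᶻ (b *ᶻ x +ᶻ w)
    lemma = solve-∀

  act-scale : ∀ c P v i → act (map (c *ᶻ_) P) v i ≡ c *ᶻ act P v i
  act-scale c []      v i = sym (ℤ.*-zeroʳ c)
  act-scale c (a ∷ P) v i = trans (cong ((c *ᶻ a) *ᶻ v i +ᶻ_) (trans (*ᵛ-cong (act-scale c P v) i) (*ᵛ-scale c (act P v) i)))
    (lemma c a (v i) ((A *ᵛ act P v) i))
    where
    lemma : ∀ c a x z → (c *ᶻ a) *ᶻ x +ᶻ c *ᶻ z ≡ c *ᶻ (a *ᶻ x +ᶻ z)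
    lemma = solve-∀

  act-* : ∀ P Q v i → act (P *ᴾ Q) v i ≡ act P (act Q v) i
  act-* []      Q v i = refl
  act-* (a ∷ P) Q v i = trans (act-+ (map (a *ᶻ_) Q) (0ℤ ∷ (P *ᴾ Q)) v i)
    (cong₂ _+ᶻ_ (act-scale a Q v i) (trans (ℤ.+-identityˡ _) (*ᵛ-cong (act-* P Q v) i)))

  act-vanish : ∀ P v → (∀ n → coeff P n ≡ 0ℤ) → ∀ i → act P v i ≡ 0ℤ
  act-vanish []      v eq i = refl
  act-vanish (a ∷ P) v eq i = trans (cong₂ (λ c z → c *ᶻ v i +ᶻ z) (eq 0) (trans (*ᵛ-cong (act-vanish P v (eq ∘ suc)) i) (*ᵛ-0 i))) refl

  act-≈ : ∀ {P Q} → P ≈ᴾ Q → ∀ v i → act P v i ≡ act Q v i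
  act-≈ {[]}    {Q}     (coeffwise eq) v i = sym (act-vanish Q v (λ n → sym (eq n)) i)
  act-≈ {a ∷ P} {[]}    (coeffwise eq) v i = act-vanish (a ∷ P) v eq i
  act-≈ {a ∷ P} {b ∷ Q} (coeffwise eq) v i = cong₂ (λ c z → c *ᶻ v i +ᶻ z) (eq 0) (*ᵛ-cong (act-≈ {P} {Q} (coeffwise (eq ∘ suc)) v) i)

  act-⟨⟩ : ∀ a v i → act ⟨ a ⟩ v i ≡ a *ᶻ v i
  act-⟨⟩ a v i = trans (cong (a *ᶻ v i +ᶻ_) (*ᵛ-0 i)) (ℤ.+-identityʳ _)

  act-1 : ∀ v i → act 1ᴾ v i ≡ v i
  act-1 v i = trans (act-⟨⟩ 1ℤ v i) (ℤ.*-identityˡ (v i))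

  act-u^ : ∀ n v i → act (u ^ᴾ n) v i ≡ powᵛ n v i
  act-u^ zero    v i = act-1 v i
  act-u^ (suc n) v i = trans (act-* u (u ^ᴾ n) v i)
    (trans (ℤ.+-identityˡ ((A *ᵛ act 1ᴾ (act (u ^ᴾ n) v)) i)) (*ᵛ-cong (λ j → trans (act-1 (act (u ^ᴾ n) v) j) (act-u^ n v j)) i))

  -- Turns a linear relation among v, Av, A²v, ... into a polynomial that annihilates v.
  act-tabulate : ∀ {n} (a : Vecℤ n) v i → act (tabulate a) v i ≡ comb a (λ l → powᵛ (toℕ l) v) i
  act-tabulate {zero}  a v i = refl
  act-tabulate {suc n} a v i = cong (a zero *ᶻ v i +ᶻ_) (trans (*ᵛ-cong (act-tabulate (a ∘ suc) v) i) (*ᵛ-comb (a ∘ suc) (λ l → powᵛ (toℕ l) v) i))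

coeff-tabulate : ∀ {n} (a : Vecℤ n) l → coeff (tabulate a) (toℕ l) ≡ a l
coeff-tabulate a zero    = refl
coeff-tabulate a (suc l) = coeff-tabulate (a ∘ suc) l

-- Injectivity of Φ(A) when the degree d of Φ exceeds r.

module CyclotomicKernel (p : ℕ) (pp : Prime p) (n : ℕ) {r} (A : Matrix r r) (r<d : r < (p ∸ 1) * p ^ n) where
  open Eisenstein p pp
  open Action A

  private
    instance
      p≢0 : NonZero p
      p≢0 = prime⇒nonZero pp

    d : ℕ
    d = (p ∸ 1) * p ^ n

    euclid : ∀ a b → (+ p) ∣ᶻ a *ᶻ b → ¬ (+ p) ∣ᶻ a → (+ p) ∣ᶻ b
    euclid a b p∣ab p∤a with euclidsLemma ∣ a ∣ ∣ b ∣ pp (subst (p ℕ∣.∣_) (ℤ.abs-* a b) (∣⇒∣ᵤ p∣ab))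
    ... | inj₁ p∣a = ⊥-elim (p∤a (∣ᵤ⇒∣ p∣a))
    ... | inj₂ p∣b = ∣ᵤ⇒∣ p∣b

    p̂* : ∀ P → p̂ *ᴾ P ≈ᴾ ⟨ + p ⟩ *ᴾ P
    p̂* P = 𝒫.*-congʳ {P} (×ᴾ1≈⟨⟩ p)

    coeff-p̂* : ∀ P m → coeff (p̂ *ᴾ P) m ≡ + p *ᶻ coeff P m
    coeff-p̂* P m = trans (coeff-≡ (p̂* P) m) (coeff-⟨⟩* (+ p) P m)

    act-p̂* : ∀ P v i → act (p̂ *ᴾ P) v i ≡ + p *ᶻ act P v i
    act-p̂* P v i = trans (act-≈ (p̂* P) v i) (trans (act-* ⟨ + p ⟩ P v i) (act-⟨⟩ (+ p) (act P v) i))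

    -- The measure of both descents below: division by p shrinks a nonzero integer.
    smaller : ∀ {a b N} → a ≡ + p *ᶻ b → b ≢ 0ℤ → ∣ a ∣ ≤ suc N → ∣ b ∣ ≤ N
    smaller {a} {b} {N} eq b≢0 a≤ = ℕ.≤-pred (ℕ.≤-trans (ℕ.≤-trans (ℕ.m<m*n ∣ b ∣ p {{ℕ.≢-nonZero (b≢0 ∘ ℤ.∣i∣≡0⇒i≡0)}} (ℕ.nonTrivial⇒n>1 p {{prime⇒nonTrivial pp}}))
      (ℕ.≤-reflexive (trans (ℕ.*-comm ∣ b ∣ p) (sym (trans (cong ∣_∣ eq) (ℤ.abs-* (+ p) b)))))) a≤)

    divisible-form : ∀ f c h → eval f 1ℤ ≡ c *ᶻ + p → quot f ≈ᴾ p̂ *ᴾ h → f ≈ᴾ p̂ *ᴾ (⟨ c ⟩ +ᴾ y *ᴾ h)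
    divisible-form f c h e≡ q≈ = 𝒫.trans (quot-spec f) (𝒫.trans (𝒫.+-cong constant (𝒫.*-congˡ {y} q≈)) (GeometricSums.collect polynomialRing p̂ ⟨ c ⟩ y h))
      where
      constant : ⟨ eval f 1ℤ ⟩ ≈ᴾ p̂ *ᴾ ⟨ c ⟩
      constant = 𝒫.trans (⟨⟩-cong (trans e≡ (ℤ.*-comm c (+ p)))) (𝒫.trans (⟨⟩-* (+ p) c) (𝒫.sym (p̂* ⟨ c ⟩)))

    primitive-form : ∀ f c k low F → eval f 1ℤ ≡ c *ᶻ + p → quot f ≈ᴾ p̂ *ᴾ low +ᴾ y ^ᴾ k *ᴾ F →
      f ≈ᴾ p̂ *ᴾ (⟨ c ⟩ +ᴾ y *ᴾ low) +ᴾ (y *ᴾ y ^ᴾ k) *ᴾ F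
    primitive-form f c k low F e≡ q≈ = 𝒫.trans (quot-spec f) (𝒫.trans (𝒫.+-cong constant (𝒫.*-congˡ {y} q≈)) (GeometricSums.collect′ polynomialRing p̂ ⟨ c ⟩ y low (y ^ᴾ k) F))
      where
      constant : ⟨ eval f 1ℤ ⟩ ≈ᴾ p̂ *ᴾ ⟨ c ⟩
      constant = 𝒫.trans (⟨⟩-cong (trans e≡ (ℤ.*-comm c (+ p)))) (𝒫.trans (⟨⟩-* (+ p) c) (𝒫.sym (p̂* ⟨ c ⟩)))

    -- f is not divisible by p, and k is the order of vanishing at u = 1 of its reduction modulo p.
    Primitive : Polynomial → ℕ → Set
    Primitive f L = ∃ λ k → ∃ λ low → ∃ λ F → k < L × f ≈ᴾ p̂ *ᴾ low +ᴾ y ^ᴾ k *ᴾ F × ¬ (+ p) ∣ᶻ eval F 1ℤ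

    -- Repeated division by y yields the digits of f in powers of y; the first digit prime to p
    -- gives k and F. Each division shortens the list, whence k < L.
    p-adic-form : ∀ L f → length f ≤ L → (∃ λ h → f ≈ᴾ p̂ *ᴾ h) ⊎ Primitive f L
    p-adic-form L [] _ = inj₁ ([] , 𝒫.sym (𝒫.zeroʳ p̂))
    p-adic-form (suc L) (a ∷ P) (s≤s l≤L) = by-cases ((+ p) ∣ᶻ? eval (a ∷ P) 1ℤ)
      where
      step : ∀ c → eval (a ∷ P) 1ℤ ≡ c *ᶻ + p → (∃ λ h → quot (a ∷ P) ≈ᴾ p̂ *ᴾ h) ⊎ Primitive (quot (a ∷ P)) L →
        (∃ λ h → (a ∷ P) ≈ᴾ p̂ *ᴾ h) ⊎ Primitive (a ∷ P) (suc L)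
      step c e≡ (inj₁ (h , q≈)) = inj₁ (⟨ c ⟩ +ᴾ y *ᴾ h , divisible-form (a ∷ P) c h e≡ q≈)
      step c e≡ (inj₂ (k , low , F , k<L , q≈ , p∤F)) = inj₂ (suc k , ⟨ c ⟩ +ᴾ y *ᴾ low , F , s≤s k<L , primitive-form (a ∷ P) c k low F e≡ q≈ , p∤F)
      by-cases : Dec ((+ p) ∣ᶻ eval (a ∷ P) 1ℤ) → (∃ λ h → (a ∷ P) ≈ᴾ p̂ *ᴾ h) ⊎ Primitive (a ∷ P) (suc L)
      by-cases (no p∤e) = inj₂ (0 , [] , (a ∷ P) , s≤s z≤n ,
        𝒫.sym (𝒫.trans (𝒫.+-cong (𝒫.zeroʳ p̂) (𝒫.*-identityˡ (a ∷ P))) (𝒫.+-identityˡ (a ∷ P))) , p∤e)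
      by-cases (yes (divides c e≡)) = step c e≡ (p-adic-form L (quot (a ∷ P)) (subst (_≤ L) (sym (length-quot a P)) l≤L))

    Annihilates : Vecℤ r → Polynomial → Set
    Annihilates v P = ∀ i → act P v i ≡ 0ℤ

    -- ℤʳ is torsion-free.
    annihilates-sat : ∀ v P → Annihilates v (p̂ *ᴾ P) → Annihilates v P
    annihilates-sat v P eq i = *-cancel-zero {+ p} (λ e → ℕ.≢-nonZero⁻¹ p (ℤ.+-injective e)) (trans (sym (act-p̂* P v i)) (eq i))

    -- Factors p are divided out of f until none is left. This terminates because the absolute value
    -- of one fixed nonzero coefficient, bounded by N, decreases.
    primitive-annihilator : ∀ v N f k → ∣ coeff f k ∣ ≤ N → coeff f k ≢ 0ℤ → length f ≤ d → Annihilates v f →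
      ∃ λ f → Annihilates v f × Primitive f d
    primitive-annihilator v zero f k fk≤0 fk≢0 _ _ = ⊥-elim (fk≢0 (ℤ.∣i∣≡0⇒i≡0 (ℕ.n≤0⇒n≡0 fk≤0)))
    primitive-annihilator v (suc N) f k fk≤ fk≢0 l≤d ann = step (p-adic-form d f l≤d)
      where
      step : (∃ λ h → f ≈ᴾ p̂ *ᴾ h) ⊎ Primitive f d → ∃ λ f → Annihilates v f × Primitive f d
      step (inj₂ prim) = f , ann , prim
      step (inj₁ (h , f≈)) = primitive-annihilator v N h′ k (smaller fk≡ h′k≢0 fk≤) h′k≢0 h′-length
        (annihilates-sat v h′ λ i → trans (act-≈ (𝒫.trans (𝒫.*-congˡ {p̂} h′≈) (𝒫.sym f≈)) v i) (ann i))
        where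
        -- The cofactor `h` may carry trailing zeros; cutting it to the length of `f` preserves the
        -- bound `d`.
        h′ : Polynomial
        h′ = take (length f) h
        h′≈ : h′ ≈ᴾ h
        h′≈ = take-≈ (length f) h λ m l≤m → *-cancel-zero {+ p} (λ e → ℕ.≢-nonZero⁻¹ p (ℤ.+-injective e))
          (trans (sym (coeff-p̂* h m)) (trans (sym (coeff-≡ f≈ m)) (coeff-beyond f m l≤m)))
        h′-length : length h′ ≤ d
        h′-length = ℕ.≤-trans (ℕ.≤-reflexive (List.length-take (length f) h)) (ℕ.≤-trans (ℕ.m⊓n≤m (length f) (length h)) l≤d)
        fk≡ : coeff f k ≡ + p *ᶻ coeff h′ k
        fk≡ = trans (coeff-≡ f≈ k) (trans (coeff-p̂* h k) (cong (+ p *ᶻ_) (sym (coeff-≡ h′≈ k))))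
        h′k≢0 : coeff h′ k ≢ 0ℤ
        h′k≢0 eq = fk≢0 (trans fk≡ (trans (cong (+ p *ᶻ_) eq) (ℤ.*-zeroʳ (+ p))))

    -- The r + 1 vectors v, Av, ..., Aʳv in ℤʳ are dependent. The relation has r + 1 ≤ d
    -- coefficients, but its leading one need not be a unit, hence the passage to a primitive
    -- annihilator.
    krylov : ∀ v → ∃ λ f → Annihilates v f × Primitive f d
    krylov v = let a , (l , al≢0) , eq = dependent {r} {suc r} (λ l → powᵛ (toℕ l) v) (ℕ.n<1+n r) in
      primitive-annihilator v _ (tabulate a) (toℕ l) ℕ.≤-refl (λ e → al≢0 (trans (sym (coeff-tabulate a l)) e))
        (ℕ.≤-trans (ℕ.≤-reflexive (List.length-tabulate a)) r<d) (λ i → trans (act-tabulate a v i) (eq i))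

    descend : ∀ m e v i → ¬ (+ p) ∣ᶻ e → (+ p) ∣ᶻ act (⟨ e ⟩ ^ᴾ m) v i → (+ p) ∣ᶻ v i
    descend zero    e v i p∤e p∣ = subst ((+ p) ∣ᶻ_) (act-1 v i) p∣
    descend (suc m) e v i p∤e p∣ = descend m e v i p∤e (euclid e _ (subst ((+ p) ∣ᶻ_)
      (trans (act-* ⟨ e ⟩ (⟨ e ⟩ ^ᴾ m) v i) (act-⟨⟩ e (act (⟨ e ⟩ ^ᴾ m) v) i)) p∣) p∤e)

    -- Identifies the integer e of the ideal argument: it is F(1), which is prime to p. Positivity
    -- of m removes the term with `low`.
    eval-argument : ∀ g F low m → eval g 1ℤ ≡ 1ℤ → 0 < m → eval (g *ᴾ (g *ᴾ F +ᴾ -ᴾ (y ^ᴾ m *ᴾ low))) 1ℤ ≡ eval F 1ℤ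
    eval-argument g F low m g≡1 0<m = begin
      eval (g *ᴾ (g *ᴾ F +ᴾ -ᴾ (y ^ᴾ m *ᴾ low))) 1ℤ
        ≡⟨ trans (eval-* 1ℤ g (g *ᴾ F +ᴾ -ᴾ (y ^ᴾ m *ᴾ low))) (cong₂ _*ᶻ_ g≡1 (eval-+ 1ℤ (g *ᴾ F) (-ᴾ (y ^ᴾ m *ᴾ low)))) ⟩
      1ℤ *ᶻ (eval (g *ᴾ F) 1ℤ +ᶻ eval (-ᴾ (y ^ᴾ m *ᴾ low)) 1ℤ)
        ≡⟨ cong₂ (λ a b → 1ℤ *ᶻ (a +ᶻ b)) (trans (eval-* 1ℤ g F) (cong (_*ᶻ eval F 1ℤ) g≡1))
             (trans (eval-neg 1ℤ (y ^ᴾ m *ᴾ low)) (cong -_ (trans (eval-* 1ℤ (y ^ᴾ m) low) (cong (_*ᶻ eval low 1ℤ) (eval-^ 1ℤ y m refl 0<m))))) ⟩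
      1ℤ *ᶻ (1ℤ *ᶻ eval F 1ℤ +ᶻ - (0ℤ *ᶻ eval low 1ℤ))
        ≡⟨ lemma (eval F 1ℤ) (eval low 1ℤ) ⟩
      eval F 1ℤ ∎
      where
      open ≡-Reasoning
      lemma : ∀ a b → 1ℤ *ᶻ (1ℤ *ᶻ a +ᶻ - (0ℤ *ᶻ b)) ≡ a
      lemma = solve-∀

    -- Modulo p the annihilating polynomial is the integer eᵈ, so p divides eᵈ v, and e is prime to
    -- p.
    power-divisible : ∀ v e W → Annihilates v (⟨ e ⟩ ^ᴾ d +ᴾ p̂ *ᴾ W) → ¬ (+ p) ∣ᶻ e → ∀ i → (+ p) ∣ᶻ v i
    power-divisible v e W ann p∤e i = descend d e v i p∤e (ℤ∣.∣m+n∣n⇒∣m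
      (subst ((+ p) ∣ᶻ_) (trans (sym (ann i)) (act-+ (⟨ e ⟩ ^ᴾ d) (p̂ *ᴾ W) v i)) (divides 0ℤ refl))
      (divides (act W v i) (trans (act-p̂* W v i) (ℤ.*-comm (+ p) (act W v i)))))

    eisenstein-divisible : ∀ v g f low F k G₁ e → Φ n ≈ᴾ y ^ᴾ d +ᴾ p̂ *ᴾ g → Annihilates v (Φ n) → k < d →
      f ≈ᴾ p̂ *ᴾ low +ᴾ y ^ᴾ k *ᴾ F → Annihilates v f →
      g *ᴾ (g *ᴾ F +ᴾ -ᴾ (y ^ᴾ (d ∸ k) *ᴾ low)) ≈ᴾ ⟨ e ⟩ +ᴾ y *ᴾ G₁ → ¬ (+ p) ∣ᶻ e → ∀ i → (+ p) ∣ᶻ v i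
    eisenstein-divisible v g f low F k G₁ e Φ≈ ker k<d f≈ ann G≈ p∤e =
      let W , IW = ideal-argument (Annihilates v)
            (λ eq IP i → trans (sym (act-≈ eq v i)) (IP i))
            (λ {P} {Q} IP IQ i → trans (act-+ P Q v i) (cong₂ _+ᶻ_ (IP i) (IQ i)))
            (λ P {Q} IQ i → trans (act-* P Q v i) (act-0ʳ P IQ i))
            (annihilates-sat v)
            (Φ n) g f low F y G₁ ⟨ e ⟩ d k k<d Φ≈ ker f≈ ann G≈
      in power-divisible v e W IW p∤e

    kernel-divisible : ∀ v → Annihilates v (Φ n) → ∀ i → (+ p) ∣ᶻ v i
    kernel-divisible v ker = from-form (Φ-eisenstein n) (krylov v)
      where
      from-form : (∃ λ g → Φ n ≈ᴾ y ^ᴾ d +ᴾ p̂ *ᴾ g × eval g 1ℤ ≡ 1ℤ) → (∃ λ f → Annihilates v f × Primitive f d) → ∀ i → (+ p) ∣ᶻ v i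
      from-form (g , Φ≈ , g≡1) (f , ann , k , low , F , k<d , f≈ , p∤F) = eisenstein-divisible v g f low F k (quot G) (eval G 1ℤ) Φ≈ ker k<d f≈ ann (quot-spec G)
        (λ p∣e → p∤F (subst ((+ p) ∣ᶻ_) (eval-argument g F low (d ∸ k) g≡1 (ℕ.m<n⇒0<n∸m k<d)) p∣e))
        where
        G : Polynomial
        G = g *ᴾ (g *ᴾ F +ᴾ -ᴾ (y ^ᴾ (d ∸ k) *ᴾ low))

    quotient-kernel : ∀ v → Annihilates v (Φ n) → (∀ i → (+ p) ∣ᶻ v i) → ∃ λ v′ → (∀ j → v j ≡ + p *ᶻ v′ j) × Annihilates v′ (Φ n)
    quotient-kernel v ker div = v′ , v≡ , λ j → *-cancel-zero {+ p} (λ e → ℕ.≢-nonZero⁻¹ p (ℤ.+-injective e))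
      (trans (sym (act-scaleʳ (Φ n) (+ p) v′ j)) (trans (sym (act-cong (Φ n) v≡ j)) (ker j)))
      where
      v′ : Vecℤ r
      v′ j = _∣ᶻ_.quotient (div j)
      v≡ : ∀ j → v j ≡ + p *ᶻ v′ j
      v≡ j = trans (_∣ᶻ_.equality (div j)) (ℤ.*-comm (v′ j) (+ p))

    -- A kernel vector is p times another kernel vector; a nonzero coordinate would shrink forever.
    infinite-descent : ∀ N v → Annihilates v (Φ n) → ∀ i → ∣ v i ∣ ≤ N → v i ≡ 0ℤ
    infinite-descent zero v ker i vi≤ = ℤ.∣i∣≡0⇒i≡0 (ℕ.n≤0⇒n≡0 vi≤)
    infinite-descent (suc N) v ker i vi≤ = step (quotient-kernel v ker (kernel-divisible v ker))
      where
      step : (∃ λ v′ → (∀ j → v j ≡ + p *ᶻ v′ j) × Annihilates v′ (Φ n)) → v i ≡ 0ℤ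
      step (v′ , v≡ , ker′) = trans (v≡ i) (trans (cong (+ p *ᶻ_) (by-cases (v′ i ℤ.≟ 0ℤ))) (ℤ.*-zeroʳ (+ p)))
        where
        by-cases : Dec (v′ i ≡ 0ℤ) → v′ i ≡ 0ℤ
        by-cases (yes eq) = eq
        by-cases (no neq) = infinite-descent N v′ ker′ i (smaller (v≡ i) neq vi≤)

  Φ-injective : ∀ v → (∀ i → act (Φ n) v i ≡ 0ℤ) → ∀ i → v i ≡ 0ℤ
  Φ-injective v ker i = infinite-descent ∣ v i ∣ v ker i ℕ.≤-refl

-- Determinants of s(uA) for a series or polynomial s.

module Twist {r} (A : Matrix r r) where
  open Action A

  -- The standard basis: `powᵛ n (e j) i` is the (i, j) entry of Aⁿ, and powers of A are handled
  -- through such entries.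
  e : Fin r → Vecℤ r
  e = 𝟙

  comb-e : ∀ (w : Vecℤ r) i → comb w e i ≡ w i
  comb-e w i = ℤdet.sum-𝟙ʳ w i

  powᵛ-suc : ∀ n v i → powᵛ n (A *ᵛ v) i ≡ powᵛ (suc n) v i
  powᵛ-suc zero    v i = refl
  powᵛ-suc (suc n) v i = *ᵛ-cong (powᵛ-suc n v) i

  powᵛ-cong : ∀ n {v w} → (∀ i → v i ≡ w i) → ∀ i → powᵛ n v i ≡ powᵛ n w i
  powᵛ-cong zero    eq = eq
  powᵛ-cong (suc n) eq = *ᵛ-cong (powᵛ-cong n eq)

  powᵛ-+ : ∀ m n v i → powᵛ (m + n) v i ≡ powᵛ m (powᵛ n v) i
  powᵛ-+ zero    n v i = refl
  powᵛ-+ (suc m) n v i = *ᵛ-cong (powᵛ-+ m n v) i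

  powᵛ-comb : ∀ n {k} (a : Vecℤ k) (g : Fin k → Vecℤ r) i → powᵛ n (comb a g) i ≡ comb a (λ l → powᵛ n (g l)) i
  powᵛ-comb zero    a g i = refl
  powᵛ-comb (suc n) a g i = trans (*ᵛ-cong (powᵛ-comb n a g) i) (*ᵛ-comb a (λ l → powᵛ n (g l)) i)

  powᵛ-e : ∀ n w i → comb w (λ k → powᵛ n (e k)) i ≡ powᵛ n w i
  powᵛ-e n w i = trans (sym (powᵛ-comb n w e i)) (powᵛ-cong n (comb-e w) i)

  act-*ᵛ : ∀ P v i → act P (A *ᵛ v) i ≡ (A *ᵛ act P v) i
  act-*ᵛ []      v i = sym (*ᵛ-0 i)
  act-*ᵛ (a ∷ P) v i = trans (cong₂ _+ᶻ_ (sym (*ᵛ-scale a v i)) (*ᵛ-cong (act-*ᵛ P v) i))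
    (sym (*ᵛ-+ (λ j → a *ᶻ v j) (A *ᵛ act P v) i))

  traceᴬ : ℕ → ℤ
  traceᴬ n = ∑[ i < r ] powᵛ n (e i) i

  -- s(uA), with entries in ℤ[[u]]
  twist : Series → Sdet.Mat r
  twist s i j n = s n *ᶻ powᵛ n (e j) i

  -- Substituting uA for u is multiplicative; in degree n all summands share the matrix Aⁿ.
  twist-∙ : ∀ s t → (twist s Sdet.∙ twist t) Sdet.≋ twist (s ⊛ t)
  twist-∙ s t i j n = begin
    (twist s Sdet.∙ twist t) i j n
      ≡⟨ sumˢ (λ k → twist s i k ⊛ twist t k j) n ⟩
    ∑[ k < r ] ∑[ l < suc n ] (twist s i k (toℕ l) *ᶻ twist t k j (n ∸ toℕ l))
      ≡⟨ ∑-comm (λ k (l : Fin (suc n)) → twist s i k (toℕ l) *ᶻ twist t k j (n ∸ toℕ l)) ⟩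
    ∑[ l < suc n ] ∑[ k < r ] (twist s i k (toℕ l) *ᶻ twist t k j (n ∸ toℕ l))
      ≡⟨ sum-cong-≗ {suc n} (λ l → term (toℕ l) (n ∸ toℕ l) (ℕ.m+[n∸m]≡n (ℕ.≤-pred (Fin.toℕ<n l)))) ⟩
    ∑[ l < suc n ] (s (toℕ l) *ᶻ t (n ∸ toℕ l) *ᶻ powᵛ n (e j) i)
      ≡⟨ *-distribʳ-sum {suc n} (powᵛ n (e j) i) (λ l → s (toℕ l) *ᶻ t (n ∸ toℕ l)) ⟨
    twist (s ⊛ t) i j n ∎
    where
    open ≡-Reasoning
    rearrange : ∀ a x b z → (a *ᶻ x) *ᶻ (b *ᶻ z) ≡ (a *ᶻ b) *ᶻ (z *ᶻ x)
    rearrange = solve-∀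
    term : ∀ l m → l + m ≡ n → ∑[ k < r ] (twist s i k l *ᶻ twist t k j m) ≡ s l *ᶻ t m *ᶻ powᵛ n (e j) i
    term l m refl = begin
      ∑[ k < r ] (twist s i k l *ᶻ twist t k j m)
        ≡⟨ sum-cong-≗ (λ k → rearrange (s l) (powᵛ l (e k) i) (t m) (powᵛ m (e j) k)) ⟩
      ∑[ k < r ] ((s l *ᶻ t m) *ᶻ (powᵛ m (e j) k *ᶻ powᵛ l (e k) i))
        ≡⟨ *-distribˡ-sum (s l *ᶻ t m) (λ k → powᵛ m (e j) k *ᶻ powᵛ l (e k) i) ⟨
      (s l *ᶻ t m) *ᶻ comb (powᵛ m (e j)) (λ k → powᵛ l (e k)) i
        ≡⟨ cong ((s l *ᶻ t m) *ᶻ_) (trans (powᵛ-e l (powᵛ m (e j)) i) (sym (powᵛ-+ l m (e j) i))) ⟩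
      s l *ᶻ t m *ᶻ powᵛ (l + m) (e j) i ∎

  -- ∂s = x s becomes ∂(s(uA)) = x(uA) s(uA), to which Jacobi's formula applies; the factor on the
  -- right is the trace of x(uA).
  ∂-det-twist : ∀ s x → ∂ s ≗ˢ x ⊛ s → ∂ (Sdet.det (twist s)) ≗ˢ (λ n → x n *ᶻ traceᴬ n) ⊛ Sdet.det (twist s)
  ∂-det-twist s x eq = 𝒮.trans (∂-det-≋ (twist s) (twist x) λ i j n →
      trans (sym (ℤ.*-assoc (+ n) (s n) (powᵛ n (e j) i))) (trans (cong (_*ᶻ powᵛ n (e j) i) (eq n)) (sym (twist-∙ x s i j n))))
    (⊛-cong trace λ _ → refl)
    where
    trace : Sdet.tr (twist x) ≗ˢ (λ n → x n *ᶻ traceᴬ n)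
    trace n = trans (sumˢ (λ i → twist x i i) n) (sym (*-distribˡ-sum (x n) (λ i → powᵛ n (e i) i)))

  det-twist-0 : ∀ s → s 0 ≡ 1ℤ → Sdet.det (twist s) 0 ≡ 1ℤ
  det-twist-0 s s₀ = trans (det-hom (twist s)) (ℤdet.det-Id {r}
    (λ i → trans (cong₂ _*ᶻ_ s₀ (𝟙-diag i)) refl)
    (λ i j i≢j → trans (cong (s 0 *ᶻ_) (𝟙-off j i (i≢j ∘ sym))) (ℤ.*-zeroʳ (s 0))))
    where open DeterminantHom seriesRing ℤ.+-*-commutativeRing (λ f → f 0) (λ f g → refl) (λ f g → ℤ.+-identityʳ (f 0 *ᶻ g 0)) (λ f → refl) refl refl

  -- The i-th coordinate of P(uA) v, as a polynomial in u.
  twistᴾ : Polynomial → Vecℤ r → Fin r → Polynomial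
  twistᴾ []      v i = []
  twistᴾ (a ∷ P) v i = a *ᶻ v i ∷ twistᴾ P (A *ᵛ v) i

  eval-twistᴾ : ∀ P v i → eval (twistᴾ P v i) 1ℤ ≡ act P v i
  eval-twistᴾ []      v i = refl
  eval-twistᴾ (a ∷ P) v i = cong (a *ᶻ v i +ᶻ_) (trans (ℤ.*-identityˡ (eval (twistᴾ P (A *ᵛ v) i) 1ℤ))
    (trans (eval-twistᴾ P (A *ᵛ v) i) (act-*ᵛ P v i)))

  coeff-twistᴾ : ∀ P v i n → coeff (twistᴾ P v i) n ≡ coeff P n *ᶻ powᵛ n v i
  coeff-twistᴾ []      v i n       = refl
  coeff-twistᴾ (a ∷ P) v i zero    = refl
  coeff-twistᴾ (a ∷ P) v i (suc n) = trans (coeff-twistᴾ P (A *ᵛ v) i n) (cong (coeff P n *ᶻ_) (powᵛ-suc n v i))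

  -- det P(uA). At u = 1 it is det P(A); for P = 1 - u^q it will be the reciprocal of a zeta
  -- function.
  D : Polynomial → Polynomial
  D P = Pdet.det (λ i j → twistᴾ P (e j) i)

  coeff-D : ∀ P → coeff (D P) ≗ˢ Sdet.det (twist (coeff P))
  coeff-D P = 𝒮.trans (det-hom (λ i j → twistᴾ P (e j) i)) (Sdet.det-cong λ i j n → coeff-twistᴾ P (e j) i n)
    where open DeterminantHom polynomialRing seriesRing coeff coeff-+ coeff-* (coeff-map (-_) refl) (λ _ → refl) coeff-1

  eval-D : ∀ P → eval (D P) 1ℤ ≡ ℤdet.det (λ i j → act P (e j) i)
  eval-D P = trans (det-hom (λ i j → twistᴾ P (e j) i)) (ℤdet.det-cong λ i j → eval-twistᴾ P (e j) i)
    where open DeterminantHom polynomialRing ℤ.+-*-commutativeRing (λ P → eval P 1ℤ) (eval-+ 1ℤ) (eval-* 1ℤ) (eval-neg 1ℤ) refl (eval-1 1ℤ)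

  -- Checked in power series, where `twist-∙` and multiplicativity of the determinant are at hand.
  D-* : ∀ P Q → D (P *ᴾ Q) ≈ᴾ D P *ᴾ D Q
  D-* P Q = coeffwise (begin
    coeff (D (P *ᴾ Q))                                         ≈⟨ coeff-D (P *ᴾ Q) ⟩
    Sdet.det (twist (coeff (P *ᴾ Q)))                          ≈⟨ Sdet.det-cong (λ i j n → cong (_*ᶻ powᵛ n (e j) i) (coeff-* P Q n)) ⟩
    Sdet.det (twist (coeff P ⊛ coeff Q))                       ≈⟨ Sdet.det-cong (twist-∙ (coeff P) (coeff Q)) ⟨
    Sdet.det (twist (coeff P) Sdet.∙ twist (coeff Q))          ≈⟨ Sdet.det-∙ (twist (coeff P)) (twist (coeff Q)) ⟩
    Sdet.det (twist (coeff P)) ⊛ Sdet.det (twist (coeff Q))    ≈⟨ ⊛-cong (coeff-D P) (coeff-D Q) ⟨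
    coeff (D P) ⊛ coeff (D Q)                                  ≈⟨ coeff-* (D P) (D Q) ⟨
    coeff (D P *ᴾ D Q) ∎)
    where open SetoidReasoning 𝒮.setoid

  D-cong : ∀ {P Q} → P ≈ᴾ Q → D P ≈ᴾ D Q
  D-cong {P} {Q} eq = coeffwise (𝒮.trans (coeff-D P) (𝒮.trans
    (Sdet.det-cong (λ i j n → cong (_*ᶻ powᵛ n (e j) i) (coeff-≡ eq n))) (𝒮.sym (coeff-D Q))))

common-multiple : ∀ {n} (c : Vecℤ n) → (∀ i → c i ≢ 0ℤ) → ∃ λ K → K ≢ 0ℤ × (∃ λ (k : Vecℤ n) → ∀ i → K ≡ k i *ᶻ c i)
common-multiple {zero}  c c≢0 = 1ℤ , (λ ()) , (λ ()) , λ ()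
common-multiple {suc n} c c≢0 = let K , K≢0 , k , eq = common-multiple (c ∘ suc) (c≢0 ∘ suc) in
  K *ᶻ c zero , *-nonzero K≢0 (c≢0 zero) , (λ { zero → K ; (suc i) → c zero *ᶻ k i }) ,
  λ { zero → refl ; (suc i) → trans (ℤ.*-comm K (c zero)) (trans (cong (c zero *ᶻ_) (eq i)) (sym (ℤ.*-assoc (c zero) (k i) (c (suc i))))) }

det-diagonal≢0 : ∀ {n} (M : Matrix n n) → (∀ i → M i i ≢ 0ℤ) → (∀ i j → i ≢ j → M i j ≡ 0ℤ) → ℤdet.det M ≢ 0ℤ
det-diagonal≢0 {zero}  M diag off ()
det-diagonal≢0 {suc n} M diag off eq = *-nonzero (diag zero)
  (det-diagonal≢0 (ℤdet.minor M zero) (λ i → diag (suc i)) (λ i j i≢j → off (suc i) (suc j) (i≢j ∘ Fin.suc-injective)))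
  (trans (sym (ℤdet.det-first-column M (λ i → off (suc i) zero λ ()))) eq)

module Injective {r} (A : Matrix r r) (P : Polynomial) (injective : ∀ v → (∀ i → Action.act A P v i ≡ 0ℤ) → ∀ i → v i ≡ 0ℤ) where
  open Action A
  open Twist A

  private
    -- e_j and the r vectors P(A) e_l are dependent in ℤʳ. If the coefficient of e_j were zero,
    -- injectivity would make the other coefficients zero as well.
    column : ∀ j → ∃ λ c → c ≢ 0ℤ × (∃ λ v → ∀ i → act P v i ≡ c *ᶻ e j i)
    column j = solution (dependent g (ℕ.n<1+n r))
      where
      g : Fin (suc r) → Vecℤ r
      g zero    = e j
      g (suc l) = act P (e l)
      solution : Dependent g → ∃ λ c → c ≢ 0ℤ × (∃ λ v → ∀ i → act P v i ≡ c *ᶻ e j i)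
      solution (a , (l , al≢0) , eq) = - a zero , c≢0 , w , act-w
        where
        w : Vecℤ r
        w l = a (suc l)
        act-comb-e : ∀ i → comb w (λ l → act P (e l)) i ≡ act P w i
        act-comb-e i = trans (sym (act-comb P w e i)) (act-cong P (comb-e w) i)
        relation : ∀ i → a zero *ᶻ e j i +ᶻ act P w i ≡ 0ℤ
        relation i = trans (cong (a zero *ᶻ e j i +ᶻ_) (sym (act-comb-e i))) (eq i)
        act-w : ∀ i → act P w i ≡ (- a zero) *ᶻ e j i
        act-w i = trans (lemma (a zero *ᶻ e j i) (act P w i)) (trans (cong (_-ᶻ a zero *ᶻ e j i) (relation i)) (lemma′ (a zero) (e j i)))
          where
          lemma : ∀ x z → z ≡ (x +ᶻ z) -ᶻ x
          lemma = solve-∀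
          lemma′ : ∀ a x → 0ℤ -ᶻ a *ᶻ x ≡ (- a) *ᶻ x
          lemma′ = solve-∀
        c≢0 : - a zero ≢ 0ℤ
        c≢0 -a≡0 = all-zero l
          where
          w≡0 : ∀ i → w i ≡ 0ℤ
          w≡0 = injective w λ i → trans (act-w i) (trans (cong (_*ᶻ e j i) -a≡0) (ℤ.*-zeroˡ (e j i)))
          all-zero : ∀ l → ⊥
          all-zero′ : ∀ l → a l ≡ 0ℤ
          all-zero′ zero    = trans (sym (ℤ.neg-involutive (a zero))) (cong -_ -a≡0)
          all-zero′ (suc l) = w≡0 l
          all-zero _ = al≢0 (all-zero′ l)

  inverse : ∃ λ K → K ≢ 0ℤ × (∃ λ (U : Fin r → Vecℤ r) → ∀ j i → act P (U j) i ≡ K *ᶻ e j i)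
  inverse = let K , K≢0 , k , eq = common-multiple (λ j → proj₁ (column j)) (λ j → proj₁ (proj₂ (column j))) in
    K , K≢0 , (λ j l → k j *ᶻ proj₁ (proj₂ (proj₂ (column j))) l) , λ j i →
      trans (act-scaleʳ P (k j) (proj₁ (proj₂ (proj₂ (column j)))) i)
      (trans (cong (k j *ᶻ_) (proj₂ (proj₂ (proj₂ (column j))) i))
      (trans (sym (ℤ.*-assoc (k j) (proj₁ (column j)) (e j i))) (cong (_*ᶻ e j i) (sym (eq j)))))

  act-onto : ∃ λ K → K ≢ 0ℤ × (∀ v → ∃ λ w → ∀ i → act P w i ≡ K *ᶻ v i)
  act-onto = let K , K≢0 , U , eq = inverse in K , K≢0 , λ v → comb v U , λ i →
    trans (act-comb P v U i) (trans (sum-cong-≗ λ l → trans (cong (v l *ᶻ_) (eq l i)) (swap (v l) K (e l i)))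
      (trans (sym (*-distribˡ-sum K (λ l → v l *ᶻ e l i))) (cong (K *ᶻ_) (comb-e v i))))
    where
    swap : ∀ x a z → x *ᶻ (a *ᶻ z) ≡ a *ᶻ (x *ᶻ z)
    swap = solve-∀

  -- P(A) times the integer matrix of `inverse` is the scalar matrix K, whose determinant is
  -- nonzero.
  eval-D≢0 : eval (D P) 1ℤ ≢ 0ℤ
  eval-D≢0 eq = by-inverse inverse
    where
    M : Matrix r r
    M i j = act P (e j) i
    by-inverse : (∃ λ K → K ≢ 0ℤ × (∃ λ (U : Fin r → Vecℤ r) → ∀ j i → act P (U j) i ≡ K *ᶻ e j i)) → ⊥
    by-inverse (K , K≢0 , U , eq′) = det-diagonal≢0 (M ℤdet.∙ N)
      (λ i → subst (_≢ 0ℤ) (sym (trans (product i i) (trans (cong (K *ᶻ_) (𝟙-diag i)) (ℤ.*-identityʳ K)))) K≢0)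
      (λ i j i≢j → trans (product i j) (trans (cong (K *ᶻ_) (𝟙-off j i (i≢j ∘ sym))) (ℤ.*-zeroʳ K)))
      (trans (ℤdet.det-∙ M N) (trans (cong (_*ᶻ ℤdet.det N) (trans (sym (eval-D P)) eq)) (ℤ.*-zeroˡ (ℤdet.det N))))
      where
      N : Matrix r r
      N k j = U j k
      product : ∀ i j → (M ℤdet.∙ N) i j ≡ K *ᶻ e j i
      product i j = trans (sum-cong-≗ λ k → ℤ.*-comm (M i k) (U j k)) (trans (sym (act-comb P (U j) e i))
        (trans (act-cong P (comb-e (U j)) i) (eq′ j i)))

-- Words: powers, commutation, rotations, and counting with duplicate-free lists.

module _ {a} {A : Set a} where
  pow : ℕ → List A → List A
  pow k c = concat (replicate k c)

  pow-+ : ∀ i j (c : List A) → pow (i + j) c ≡ pow i c ++ pow j c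
  pow-+ zero    j c = refl
  pow-+ (suc i) j c = trans (cong (c ++_) (pow-+ i j c)) (sym (List.++-assoc c (pow i c) (pow j c)))

  pow-* : ∀ i j (c : List A) → pow (i * j) c ≡ pow i (pow j c)
  pow-* zero    j c = refl
  pow-* (suc i) j c = trans (pow-+ j (i * j) c) (cong (pow j c ++_) (pow-* i j c))

  pow-[] : ∀ k → pow k [] ≡ []
  pow-[] zero    = refl
  pow-[] (suc k) = pow-[] k

  length-pow : ∀ k c → length (pow k c) ≡ k * length c
  length-pow zero    c = refl
  length-pow (suc k) c = trans (List.length-++ c) (cong (λ l → length c + l) (length-pow k c))

  pow-comm : ∀ k c → c ++ pow k c ≡ pow k c ++ c
  pow-comm k c = trans (cong (λ l → concat (replicate l c)) (ℕ.+-comm 1 k))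
    (trans (pow-+ k 1 c) (cong (pow k c ++_) (List.++-identityʳ c)))

  ++-prefix : ∀ (xs : List A) {us} ys {vs} → xs ++ us ≡ ys ++ vs → length xs ≤ length ys → ∃ λ w → ys ≡ xs ++ w × us ≡ w ++ vs
  ++-prefix []       ys       eq _         = ys , refl , eq
  ++-prefix (x ∷ xs) (z ∷ ys) eq (s≤s l≤l) with refl ← List.∷-injectiveˡ eq
    with w , refl , eq′ ← ++-prefix xs ys (List.∷-injectiveʳ eq) l≤l = w , refl , eq′

  length-suffix : ∀ xs {ys w : List A} → ys ≡ xs ++ w → length ys ≡ length xs + length w
  length-suffix xs eq = trans (cong length eq) (List.length-++ xs)

  cancel-prefix : ∀ {xs ys w : List A} → xs ++ ys ≡ ys ++ xs → ys ≡ xs ++ w → xs ++ w ≡ w ++ xs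
  cancel-prefix {xs} {w = w} eq refl = List.++-cancelˡ xs (xs ++ w) (w ++ xs) (trans eq (List.++-assoc xs w xs))

  -- Euclid's algorithm on lengths: the shorter of two commuting words is a prefix of the longer,
  -- and commutes with what remains.
  commute : ∀ N (xs ys : List A) → length xs + length ys ≤ N → xs ++ ys ≡ ys ++ xs →
    ∃ λ z → ∃ λ i → ∃ λ j → xs ≡ pow i z × ys ≡ pow j z
  commute N [] ys _ _ = ys , 0 , 1 , refl , sym (List.++-identityʳ ys)
  commute N xs@(_ ∷ _) [] _ _ = xs , 1 , 0 , sym (List.++-identityʳ xs) , refl
  commute (suc N) xs@(x ∷ xs′) ys@(y ∷ ys′) (s≤s l≤N) eq with ℕ.≤-total (length xs) (length ys)
  ... | inj₁ xs≤ys with w , eq₁ , _ ← ++-prefix xs ys eq xs≤ys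
    with z , i , j , eq₂ , eq₃ ← commute N xs w
      (ℕ.≤-trans (ℕ.≤-trans (ℕ.≤-reflexive (sym (length-suffix xs eq₁))) (ℕ.m≤n+m (length ys) (length xs′))) l≤N) (cancel-prefix eq eq₁) =
    z , i , i + j , eq₂ , trans eq₁ (trans (cong₂ _++_ eq₂ eq₃) (sym (pow-+ i j z)))
  ... | inj₂ ys≤xs with w , eq₁ , _ ← ++-prefix ys xs (sym eq) ys≤xs
    with z , i , j , eq₂ , eq₃ ← commute N ys w
      (ℕ.≤-trans (ℕ.≤-trans (ℕ.≤-reflexive (trans (sym (length-suffix ys eq₁)) (ℕ.+-comm 1 (length xs′)))) (ℕ.+-monoʳ-≤ (length xs′) (s≤s z≤n))) l≤N)
      (cancel-prefix (sym eq) eq₁) =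
    z , i + j , i , trans eq₁ (trans (cong₂ _++_ eq₂ eq₃) (sym (pow-+ i j z))) , eq₂

  -- Write w for the common power. Both c d and d c extend to the word w w, and they have equal
  -- lengths, so they are the same prefix of it.
  equal-powers-commute : ∀ i j (c d : List A) → pow (suc i) c ≡ pow (suc j) d → c ++ d ≡ d ++ c
  equal-powers-commute i j c d eq =
    let w , eq₁ , _ = ++-prefix (c ++ d) (d ++ c) both (ℕ.≤-reflexive same-length) in sym (trans eq₁ (trans (cong ((c ++ d) ++_) (empty w eq₁)) (List.++-identityʳ (c ++ d))))
    where
    same-length : length (c ++ d) ≡ length (d ++ c)
    same-length = trans (List.length-++ c) (trans (ℕ.+-comm (length c) (length d)) (sym (List.length-++ d)))
    empty : ∀ w → d ++ c ≡ (c ++ d) ++ w → w ≡ []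
    empty [] _ = refl
    empty (x ∷ w) eq = ⊥-elim (ℕ.m≢1+m+n (length (c ++ d)) (trans (trans same-length (cong length eq))
      (trans (List.length-++ (c ++ d)) (ℕ.+-suc (length (c ++ d)) (length w)))))
    left : ∀ (c d : List A) i j → pow (suc i) c ≡ pow (suc j) d → (c ++ d) ++ (pow j d ++ pow i c) ≡ pow (suc i) c ++ pow (suc i) c
    left c d i j eq = begin
      (c ++ d) ++ (pow j d ++ pow i c)       ≡⟨ List.++-assoc c d _ ⟩
      c ++ (d ++ (pow j d ++ pow i c))       ≡⟨ cong (c ++_) (List.++-assoc d (pow j d) (pow i c)) ⟨
      c ++ (pow (suc j) d ++ pow i c)        ≡⟨ cong (λ v → c ++ (v ++ pow i c)) eq ⟨
      c ++ (pow (suc i) c ++ pow i c)        ≡⟨ List.++-assoc c (pow (suc i) c) (pow i c) ⟨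
      (c ++ pow (suc i) c) ++ pow i c        ≡⟨ cong (_++ pow i c) (pow-comm (suc i) c) ⟩
      (pow (suc i) c ++ c) ++ pow i c        ≡⟨ List.++-assoc (pow (suc i) c) c (pow i c) ⟩
      pow (suc i) c ++ pow (suc i) c         ∎
      where open ≡-Reasoning
    both : (c ++ d) ++ (pow j d ++ pow i c) ≡ (d ++ c) ++ (pow i c ++ pow j d)
    both = trans (left c d i j eq) (trans (cong₂ _++_ eq eq) (sym (left d c j i (sym eq))))

  pow-shift : ∀ m e (z : List A) → pow m (e ∷ z) ++ [ e ] ≡ e ∷ pow m (z ++ [ e ])
  pow-shift zero    e z = refl
  pow-shift (suc m) e z = cong (e ∷_) (trans (List.++-assoc z (pow m (e ∷ z)) [ e ])
    (trans (cong (z ++_) (pow-shift m e z)) (sym (List.++-assoc z [ e ] (pow m (z ++ [ e ]))))))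

  -- Letters are moved from front to back one by one; by `pow-shift` each move turns the m-th power
  -- of a word into the m-th power of its rotation.
  rotate-pow : ∀ ys xs m (c : List A) → ys ++ xs ≡ pow m c → ∃ λ d → xs ++ ys ≡ pow m d
  rotate-pow [] xs m c eq = c , trans (List.++-identityʳ xs) eq
  rotate-pow (e ∷ ys) xs m [] eq = case trans eq (pow-[] m) of λ ()
  rotate-pow (e ∷ ys) xs (suc m) (e′ ∷ z) eq with refl ← List.∷-injectiveˡ eq
    with d , eq′ ← rotate-pow ys (xs ++ [ e ]) (suc m) (z ++ [ e ])
      (trans (sym (List.++-assoc ys xs [ e ])) (List.∷-injectiveʳ (trans (cong (_++ [ e ]) eq) (pow-shift (suc m) e z)))) =
    d , trans (sym (List.++-assoc xs [ e ] ys)) eq′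

  -- Conjugacy of words. Without the index that `Rotation` carries, symmetry is immediate and
  -- transitivity is a comparison of two cuts.
  Rot : List A → List A → Set a
  Rot c w = ∃ λ x → ∃ λ z → c ≡ x ++ z × w ≡ z ++ x

  Rot-refl : ∀ c → Rot c c
  Rot-refl c = [] , c , refl , sym (List.++-identityʳ c)

  Rot-sym : ∀ {c w} → Rot c w → Rot w c
  Rot-sym (x , z , eq , eq′) = z , x , eq′ , eq

  Rot-trans : ∀ {c w d} → Rot c w → Rot w d → Rot c d
  Rot-trans {c} {w} {d} (x , z , refl , refl) (x′ , z′ , eq , refl) with ℕ.≤-total (length z) (length x′)
  ... | inj₁ z≤x′ with v , refl , refl ← ++-prefix z x′ eq z≤x′ = v , z′ ++ z , List.++-assoc v z′ z , sym (List.++-assoc z′ z v)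
  ... | inj₂ x′≤z with v , refl , refl ← ++-prefix x′ z (sym eq) x′≤z = x ++ x′ , v , sym (List.++-assoc x x′ v) , List.++-assoc v x x′

  drop-++-exact : ∀ (xs ys : List A) → drop (length xs) (xs ++ ys) ≡ ys
  drop-++-exact []       ys = refl
  drop-++-exact (x ∷ xs) ys = drop-++-exact xs ys

  take-++-exact : ∀ (xs ys : List A) → take (length xs) (xs ++ ys) ≡ xs
  take-++-exact []       ys = refl
  take-++-exact (x ∷ xs) ys = cong (x ∷_) (take-++-exact xs ys)

  rot : ℕ → List A → List A
  rot k c = drop k c ++ take k c

  rot-Rot : ∀ k c → Rot c (rot k c)
  rot-Rot k c = take k c , drop k c , sym (List.take++drop≡id k c) , refl

  rot-++ : ∀ (xs ys : List A) → rot (length xs) (xs ++ ys) ≡ ys ++ xs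
  rot-++ xs ys = cong₂ _++_ (drop-++-exact xs ys) (take-++-exact xs ys)

  split-at : ∀ k (c : List A) → k ≤ length c → ∃ λ x → ∃ λ z → c ≡ x ++ z × length x ≡ k
  split-at zero    c       _         = [] , c , refl , refl
  split-at (suc k) (e ∷ c) (s≤s k≤l) with x , z , refl , refl ← split-at k c k≤l = e ∷ x , z , refl , refl

  unique-⊆⇒length-≤ : ∀ {xs ys : List A} → Unique xs → (∀ {x} → x ∈ xs → x ∈ ys) → length xs ≤ length ys
  unique-⊆⇒length-≤ {[]} _ _ = z≤n
  unique-⊆⇒length-≤ {x ∷ xs} (x∉xs ∷ uniq) xs⊆ys with ys₁ , ys₂ , refl ← ∈-∃++ (xs⊆ys (here refl)) =
    subst (suc (length xs) ≤_) (sym (trans (List.length-++ ys₁) (trans (ℕ.+-suc (length ys₁) (length ys₂)) (cong suc (sym (List.length-++ ys₁))))))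
      (s≤s (unique-⊆⇒length-≤ uniq λ v∈xs → remove v∈xs (∈-++⁻ ys₁ (xs⊆ys (there v∈xs)))))
    where
    remove : ∀ {v} → v ∈ xs → v ∈ ys₁ ⊎ v ∈ x ∷ ys₂ → v ∈ ys₁ ++ ys₂
    remove v∈xs (inj₁ v∈ys₁) = ∈-++⁺ˡ v∈ys₁
    remove v∈xs (inj₂ (here refl)) = ⊥-elim (All.lookup x∉xs v∈xs refl)
    remove v∈xs (inj₂ (there v∈ys₂)) = ∈-++⁺ʳ ys₁ v∈ys₂

  -- All counting below takes this form: two duplicate-free lists with the same members.
  unique-same-length : ∀ {xs ys : List A} → Unique xs → Unique ys → (∀ {x} → x ∈ xs → x ∈ ys) → (∀ {x} → x ∈ ys → x ∈ xs) → length xs ≡ length ys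
  unique-same-length u v f g = ℕ.≤-antisym (unique-⊆⇒length-≤ u f) (unique-⊆⇒length-≤ v g)

  module _ {ℓ} {R : A → A → Set ℓ} (R? : ∀ x z → Dec (R x z)) where
    deduplicate-apart : ∀ xs → AllPairs (λ x z → ¬ R x z) (deduplicate R? xs)
    deduplicate-apart []       = []
    deduplicate-apart (x ∷ xs) = All.all-filter (¬? ∘ R? x) (deduplicate R? xs) ∷ AllPairs.filter⁺ (¬? ∘ R? x) (deduplicate-apart xs)

    ∈-deduplicate : ∀ xs {v} → v ∈ deduplicate R? xs → v ∈ xs
    ∈-deduplicate (x ∷ xs) (here eq) = here eq
    ∈-deduplicate (x ∷ xs) (there v∈) = there (∈-deduplicate xs (proj₁ (∈-filter⁻ (¬? ∘ R? x) v∈)))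

    representative : (∀ x → R x x) → (∀ {x z w} → R x z → R z w → R x w) →
      ∀ xs {v} → v ∈ xs → ∃ λ c → c ∈ deduplicate R? xs × R c v
    representative R-refl R-trans (x ∷ xs) (here refl) = x , here refl , R-refl x
    representative R-refl R-trans (x ∷ xs) (there v∈) with c , c∈ , Rcv ← representative R-refl R-trans xs v∈ | R? x c
    ... | yes Rxc = x , here refl , R-trans Rxc Rcv
    ... | no ¬Rxc = c , there (∈-filter⁺ (¬? ∘ R? x) c∈ ¬Rxc) , Rcv

-- Cycles, primitive roots and classes.

module Cycles (Y : Digraph) where
  open Digraph Y

  Path : V → List E → V → Set
  Path a []       b = a ≡ b
  Path a (e ∷ es) b = o e ≡ a × Path (t e) es b

  Path-++⁺ : ∀ {a b c} xs {ys} → Path a xs b → Path b ys c → Path a (xs ++ ys) c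
  Path-++⁺ []       refl   q = q
  Path-++⁺ (e ∷ xs) (eq , p) q = eq , Path-++⁺ xs p q

  Path-++⁻ : ∀ {a c} xs {ys} → Path a (xs ++ ys) c → ∃ λ b → Path a xs b × Path b ys c
  Path-++⁻ []       p        = _ , refl , p
  Path-++⁻ (e ∷ xs) (eq , p) = let b , q , q′ = Path-++⁻ xs p in b , (eq , q) , q′

  Closed : List E → Set
  Closed []       = ⊥
  Closed (e ∷ es) = Path (t e) es (o e)

  private
    linked⇒path : ∀ e es f → Linked (λ f g → t f ≡ o g) (e ∷ es ++ [ f ]) → Path (t e) es (o f)
    linked⇒path e []       f (eq ∷ _)  = eq
    linked⇒path e (g ∷ es) f (eq ∷ lk) = sym eq , linked⇒path g es f lk

    path⇒linked : ∀ e es f → Path (t e) es (o f) → Linked (λ f g → t f ≡ o g) (e ∷ es ++ [ f ])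
    path⇒linked e []       f eq       = eq ∷ [-]
    path⇒linked e (g ∷ es) f (eq , p) = sym eq ∷ path⇒linked g es f p

  cycle⇒closed : ∀ w → IsCycle Y w → Closed w
  cycle⇒closed (e ∷ es) = linked⇒path e es e

  closed⇒cycle : ∀ w → Closed w → IsCycle Y w
  closed⇒cycle (e ∷ es) = path⇒linked e es e

  private
    Loop : V → List E → Set
    Loop a w = Path a w a

    closed⇒loop : ∀ w → Closed w → ∃ λ a → Loop a w
    closed⇒loop (e ∷ es) p = o e , refl , p

    loop⇒closed : ∀ {a} e es → Loop a (e ∷ es) → Closed (e ∷ es)
    loop⇒closed e es (refl , p) = p

    loop-pow : ∀ k {a} c → Loop a c → Loop a (pow k c)
    loop-pow zero    c p = refl
    loop-pow (suc k) c p = Path-++⁺ c p (loop-pow k c p)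

    pow-loop : ∀ k {a} e z → Loop a (pow (suc k) (e ∷ z)) → Loop a (e ∷ z)
    pow-loop k {a} e z p with Path-++⁻ (e ∷ z) p
    pow-loop zero    e z p | b , q , refl = q
    pow-loop (suc k) e z p | b , (refl , q) , (refl , q′) = refl , q

  closed-pow : ∀ k c → Closed c → Closed (pow (suc k) c)
  closed-pow k c@(e ∷ z) p = let a , l = closed⇒loop c p in loop⇒closed e (z ++ pow k c) (loop-pow (suc k) c l)

  pow-closed : ∀ k c → Closed (pow k c) → Closed c
  pow-closed (suc k) (e ∷ z) p = let a , l = closed⇒loop (pow (suc k) (e ∷ z)) p in loop⇒closed e z (pow-loop k e z l)
  pow-closed (suc k) []      p = case subst Closed (pow-[] k) p of λ ()

  closed-rot : ∀ x z → Closed (x ++ z) → Closed (z ++ x)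
  closed-rot []       z p = subst Closed (sym (List.++-identityʳ z)) p
  closed-rot (e ∷ x)  [] p = subst Closed (List.++-identityʳ (e ∷ x)) p
  closed-rot (e ∷ x) (f ∷ z) p =
    let a , l = closed⇒loop (e ∷ x ++ f ∷ z) p
        b , q , q′ = Path-++⁻ (e ∷ x) l
    in loop⇒closed f (z ++ e ∷ x) (Path-++⁺ (f ∷ z) q′ q)

  Primitive : List E → Set
  Primitive w = IsCycle Y w × ¬ IsMultiple Y w

  primitive? : ∀ w → Dec (Primitive w)
  primitive? w = isCycle? Y w ×-dec ¬? (isMultiple? Y w)

  primitive-nonempty : ∀ {c} → Primitive c → c ≢ []
  primitive-nonempty (() , _) refl

  primitive-power : ∀ {c} → Primitive c → ∀ i z → c ≡ pow i z → c ≡ z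
  primitive-power (cyc , _) zero z refl = ⊥-elim cyc
  primitive-power _ (suc zero) z eq = trans eq (List.++-identityʳ z)
  primitive-power {c} (cyc , ¬mult) (suc (suc i)) z eq = ⊥-elim (¬mult (suc (suc i) , z , s≤s (s≤s z≤n) ,
    closed⇒cycle z (pow-closed (suc (suc i)) z (subst Closed eq (cycle⇒closed c cyc))) , eq))

  -- Words with a common power commute, hence are powers of one word, and a primitive word is a
  -- power of another only trivially.
  primitive-unique : ∀ {c d} → Primitive c → Primitive d → ∀ i j → pow (suc i) c ≡ pow (suc j) d → c ≡ d
  primitive-unique {c} {d} pc pd i j eq =
    let z , k , l , eq₁ , eq₂ = commute (length c + length d) c d ℕ.≤-refl (equal-powers-commute i j c d eq)
    in trans (primitive-power pc k z eq₁) (sym (primitive-power pd l z eq₂))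

  -- If x and z commuted they would be nonzero powers of one word, and x z would be a proper
  -- multiple of it.
  primitive-rotations : ∀ x z → x ≢ [] → z ≢ [] → Primitive (x ++ z) → x ++ z ≢ z ++ x
  primitive-rotations x z x≢[] z≢[] prim eq = absurd (commute (length x + length z) x z ℕ.≤-refl eq)
    where
    absurd : (∃ λ w → ∃ λ i → ∃ λ j → x ≡ pow i w × z ≡ pow j w) → ⊥
    absurd (w , zero  , j     , eq₁ , eq₂) = x≢[] eq₁
    absurd (w , suc i , zero  , eq₁ , eq₂) = z≢[] eq₂
    absurd (w , suc i , suc j , eq₁ , eq₂) = proj₂ prim (suc i + suc j , w , ℕ.+-mono-≤ (s≤s {0} {i} z≤n) (s≤s {0} {j} z≤n) ,
      closed⇒cycle w (pow-closed (suc i + suc j) w (subst Closed whole (cycle⇒closed (x ++ z) (proj₁ prim)))) , whole)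
      where
      whole : x ++ z ≡ pow (suc i + suc j) w
      whole = trans (cong₂ _++_ eq₁ eq₂) (sym (pow-+ (suc i) (suc j) w))

  primitive-rot : ∀ {c w} → Rot c w → Primitive c → Primitive w
  primitive-rot (x , z , refl , refl) (cyc , ¬mult) = closed⇒cycle (z ++ x) (closed-rot x z closed) , λ (m , d , 2≤m , _ , eq) →
    let d′ , eq′ = rotate-pow z x m d eq in
    ¬mult (m , d′ , 2≤m , closed⇒cycle d′ (pow-closed m d′ (subst Closed eq′ closed)) , eq′)
    where
    closed : Closed (x ++ z)
    closed = cycle⇒closed (x ++ z) cyc

  Root : List E → Set
  Root w = ∃ λ c → ∃ λ k → Primitive c × w ≡ pow (suc k) c

  -- A multiple is replaced by its base, which is strictly shorter; N bounds the recursion.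
  root : ∀ N w → length w ≤ N → IsCycle Y w → Root w
  root zero [] _ ()
  root (suc N) w l≤N cyc with isMultiple? Y w
  ... | no ¬mult = w , 0 , (cyc , ¬mult) , sym (List.++-identityʳ w)
  ... | yes (suc (suc m) , [] , _ , () , _)
  ... | yes (suc zero , d , s≤s () , _)
  ... | yes (suc (suc m) , d@(_ ∷ d′) , _ , cyc′ , refl) =
    let c , k , prim , eq = root N d (ℕ.≤-pred (ℕ.≤-trans (shorter d′) l≤N)) cyc′ in
    c , k + suc m * suc k , prim , trans (cong (pow (suc (suc m))) eq) (sym (pow-* (suc (suc m)) (suc k) c))
    where
    shorter : ∀ {f} d′ → suc (length (f ∷ d′)) ≤ length (pow (suc (suc m)) (f ∷ d′))
    shorter {f} d′ = ℕ.≤-trans (ℕ.≤-trans (s≤s (ℕ.m≤n+m (length (f ∷ d′)) (length d′)))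
      (ℕ.+-monoʳ-≤ (length (f ∷ d′)) (ℕ.m≤m+n (length (f ∷ d′)) (m * length (f ∷ d′))))) (ℕ.≤-reflexive (sym (length-pow (suc (suc m)) (f ∷ d′))))

  Rotation⇒Rot : ∀ {c w} → Rotation Y c w → Rot c w
  Rotation⇒Rot {c} (k , refl) = rot-Rot (toℕ k) c

  Rot⇒Rotation : ∀ {c w} → Rot c w → Rotation Y c w
  Rot⇒Rotation (x , z , refl , refl) = fromℕ< l< , sym (trans (cong (λ k → rot k (x ++ z)) (Fin.toℕ-fromℕ< l<)) (rot-++ x z))
    where
    l< : length x < suc (length (x ++ z))
    l< = s≤s (ℕ.≤-trans (ℕ.m≤m+n (length x) (length z)) (ℕ.≤-reflexive (sym (List.length-++ x))))

  edges-unique : Unique edges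
  edges-unique = Unique.map⁺ (Inverse-injective) (Unique.allFin⁺ size)
    where
    Inverse-injective : ∀ {i j} → Inverse.from enumE i ≡ Inverse.from enumE j → i ≡ j
    Inverse-injective eq = trans (sym (Inverse.inverseˡ enumE refl)) (trans (cong (Inverse.to enumE) eq) (Inverse.inverseˡ enumE refl))

  ∈-edges : ∀ e → e ∈ edges
  ∈-edges e = subst (_∈ edges) (Inverse.inverseʳ enumE refl) (∈-map⁺ (Inverse.from enumE) (∈-allFin (Inverse.to enumE e)))

  words-unique : ∀ l → Unique (words Y l)
  words-unique zero    = [] ∷ []
  words-unique (suc l) = Unique.cartesianProductWith⁺ _∷_ (λ eq → List.∷-injective eq) edges-unique (words-unique l)

  ∈-words : ∀ w → w ∈ words Y (length w)
  ∈-words []       = here refl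
  ∈-words (e ∷ es) = ∈-cartesianProductWith⁺ _∷_ (∈-edges e) (∈-words es)

  words-length : ∀ l {w} → w ∈ words Y l → length w ≡ l
  words-length zero (here refl) = refl
  words-length (suc l) w∈ with e , es , _ , es∈ , refl ← ∈-cartesianProductWith⁻ _∷_ edges (words Y l) w∈ = cong suc (words-length l es∈)

  cycles primitives : ℕ → List (List E)
  cycles l = filter (isCycle? Y) (words Y l)
  primitives l = filter primitive? (words Y l)

  ∈-primitives : ∀ {w l} → Primitive w → length w ≡ l → w ∈ primitives l
  ∈-primitives {w} prim refl = ∈-filter⁺ primitive? (∈-words w) prim

  primitives-∈ : ∀ l {w} → w ∈ primitives l → Primitive w × length w ≡ l
  primitives-∈ l w∈ = let w∈words , prim = ∈-filter⁻ primitive? {xs = words Y l} w∈ in prim , words-length l w∈words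

  primitives-unique : ∀ l → Unique (primitives l)
  primitives-unique l = Unique.filter⁺ primitive? (words-unique l)

  private
    rotations : ℕ → List E → List (List E)
    rotations l c = applyUpTo (λ k → rot k c) l

    rotations-unique : ∀ {l c} → Primitive c → length c ≡ l → Unique (rotations l c)
    rotations-unique {c = c} prim refl = Unique.applyUpTo⁺₁ (λ k → rot k c) (length c) distinct
      where
      distinct : ∀ {i j} → i < j → j < length c → rot i c ≢ rot j c
      -- Cut the word as x m z with i = |x| and j = |x m|. Equality of the two rotations says that m
      -- commutes with z x, against `primitive-rotations`.
      distinct {i} {j} i<j j<l eq with q , z , refl , refl ← split-at j c (ℕ.<⇒≤ j<l)
        with x , m , refl , refl ← split-at i q (ℕ.<⇒≤ i<j) =
        primitive-rotations m (z ++ x) m≢[] zx≢[] (primitive-rot (x , m ++ z , List.++-assoc x m z , sym (List.++-assoc m z x)) prim) (begin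
          m ++ z ++ x                               ≡⟨ List.++-assoc m z x ⟨
          (m ++ z) ++ x                             ≡⟨ rot-++ x (m ++ z) ⟨
          rot (length x) (x ++ m ++ z)              ≡⟨ cong (rot (length x)) (List.++-assoc x m z) ⟨
          rot (length x) ((x ++ m) ++ z)            ≡⟨ eq ⟩
          rot (length (x ++ m)) ((x ++ m) ++ z)     ≡⟨ rot-++ (x ++ m) z ⟩
          z ++ x ++ m                               ≡⟨ List.++-assoc z x m ⟨
          (z ++ x) ++ m                             ∎)
        where
        open ≡-Reasoning
        m≢[] : m ≢ []
        m≢[] refl = ℕ.<-irrefl (sym (cong length (List.++-identityʳ x))) i<j
        zx≢[] : z ++ x ≢ []
        zx≢[] zx≡ with refl ← List.++-conicalˡ z x zx≡ = ℕ.<-irrefl (sym (cong length (List.++-identityʳ (x ++ m)))) j<l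

    ∈-rotations : ∀ {l c w} → Rot c w → length c ≡ l → c ≢ [] → w ∈ rotations l c
    ∈-rotations (x , [] , refl , refl) refl c≢[] = subst (_∈ rotations (length (x ++ [])) (x ++ []))
      (trans (List.++-identityʳ (x ++ [])) (List.++-identityʳ x)) (zeroth (x ++ []) c≢[])
      where
      zeroth : ∀ c → c ≢ [] → c ++ [] ∈ rotations (length c) c
      zeroth []      c≢[] = ⊥-elim (c≢[] refl)
      zeroth (e ∷ c) c≢[] = here refl
    ∈-rotations (x , f ∷ z , refl , refl) refl c≢[] = subst (_∈ rotations (length (x ++ f ∷ z)) (x ++ f ∷ z)) (rot-++ x (f ∷ z))
      (∈-applyUpTo⁺ (λ k → rot k (x ++ f ∷ z)) (ℕ.≤-trans (ℕ.m<m+n (length x) (s≤s z≤n)) (ℕ.≤-reflexive (sym (List.length-++ x)))))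

    apart⇒disjoint : ∀ l {cs} → AllPairs (λ c d → ¬ Rotation Y c d) cs →
      AllPairs (λ xs ys → ∀ {w} → ¬ (w ∈ xs × w ∈ ys)) (map (rotations l) cs)
    apart⇒disjoint l apart = AllPairs.map⁺ (AllPairs.map disjoint apart)
      where
      disjoint : ∀ {c d} → ¬ Rotation Y c d → ∀ {w} → ¬ (w ∈ rotations l c × w ∈ rotations l d)
      disjoint {c} {d} ¬R (w∈c , w∈d) with i , _ , refl ← ∈-applyUpTo⁻ (λ k → rot k c) w∈c
        with j , _ , eq ← ∈-applyUpTo⁻ (λ k → rot k d) w∈d =
        ¬R (Rot⇒Rotation (Rot-trans (rot-Rot i c) (subst (λ w → Rot w d) (sym eq) (Rot-sym (rot-Rot j d)))))

    length-concatMap-rotations : ∀ l cs → length (concatMap (rotations l) cs) ≡ length cs * l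
    length-concatMap-rotations l []       = refl
    length-concatMap-rotations l (c ∷ cs) = trans (List.length-++ (rotations l c))
      (cong₂ _+_ (List.length-applyUpTo (λ k → rot k c) l) (length-concatMap-rotations l cs))

  classes-∈ : ∀ l {c} → c ∈ primitiveClasses Y l → Primitive c × length c ≡ l
  classes-∈ l c∈ = primitives-∈ l (∈-deduplicate (rotation? Y) (primitives l) c∈)

  -- A primitive word of length l has exactly l distinct rotations, all primitive, and different
  -- representatives have disjoint orbits.
  length-primitives : ∀ l → length (primitives l) ≡ length (primitiveClasses Y l) * l
  length-primitives l = trans (unique-same-length (primitives-unique l) all-unique to from) (length-concatMap-rotations l (primitiveClasses Y l))
    where
    all-unique : Unique (concatMap (rotations l) (primitiveClasses Y l))
    all-unique = Unique.concat⁺ (All.map⁺ (All.tabulate λ c∈ → let prim , len = classes-∈ l c∈ in rotations-unique prim len))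
      (apart⇒disjoint l (deduplicate-apart (rotation? Y) (primitives l)))
    to : ∀ {w} → w ∈ primitives l → w ∈ concatMap (rotations l) (primitiveClasses Y l)
    to w∈ = let c , c∈ , R = representative (rotation? Y) (λ c → Rot⇒Rotation (Rot-refl c))
                  (λ R R′ → Rot⇒Rotation (Rot-trans (Rotation⇒Rot R) (Rotation⇒Rot R′))) (primitives l) w∈
                prim , len = classes-∈ l c∈
            in ∈-concatMap⁺ (rotations l) (lose c∈ (∈-rotations (Rotation⇒Rot R) len (primitive-nonempty prim)))
    from : ∀ {w} → w ∈ concatMap (rotations l) (primitiveClasses Y l) → w ∈ primitives l
    from {w} w∈ with c , c∈ , w∈c ← find (∈-concatMap⁻ (rotations l) {xs = primitiveClasses Y l} w∈)
      with k , _ , refl ← ∈-applyUpTo⁻ (λ k → rot k c) w∈c =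
      let prim , len = classes-∈ l c∈ in
      ∈-primitives (primitive-rot (rot-Rot k c) prim) (trans (Rot-length (rot-Rot k c)) len)
      where
      Rot-length : ∀ {c w : List E} → Rot c w → length w ≡ length c
      Rot-length (x , z , refl , refl) = trans (List.length-++ z) (trans (ℕ.+-comm (length z) (length x)) (sym (List.length-++ x)))

-- Logarithmic derivatives of geometric series.

∂-neg : ∀ f → ∂ (-ˢ f) ≗ˢ -ˢ ∂ f
∂-neg f n = sym (ℤ.neg-distribʳ-* (+ n) (f n))

-- F D has derivative TFD - FTD = 0, so all coefficients beyond the constant one vanish, ℤ being
-- torsion-free.
∂-unique : ∀ {F D T} → F 0 ≡ 1ℤ → D 0 ≡ 1ℤ → ∂ F ≗ˢ T ⊛ F → ∂ D ≗ˢ (-ˢ T) ⊛ D → F ⊛ D ≗ˢ one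
∂-unique {F} {D} {T} F₀ D₀ ∂F ∂D zero = trans (ℤ.+-identityʳ (F 0 *ᶻ D 0)) (cong₂ _*ᶻ_ F₀ D₀)
∂-unique {F} {D} {T} F₀ D₀ ∂F ∂D (suc n) = *-cancel-zero {+ suc n} (λ ()) (begin
  ∂ (F ⊛ D) (suc n)                                  ≡⟨ ∂-⊛ F D (suc n) ⟩
  (∂ F ⊛ D) (suc n) +ᶻ (F ⊛ ∂ D) (suc n)             ≡⟨ cong₂ _+ᶻ_ (⊛-cong {g = D} ∂F (λ _ → refl) (suc n)) (⊛-cong {F} (λ _ → refl) ∂D (suc n)) ⟩
  ((T ⊛ F) ⊛ D) (suc n) +ᶻ (F ⊛ ((-ˢ T) ⊛ D)) (suc n) ≡⟨ cancel T F D (suc n) ⟩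
  0ℤ                                                 ∎)
  where
  open ≡-Reasoning
  cancel : ∀ T F D → (T ⊛ F) ⊛ D +ˢ F ⊛ ((-ˢ T) ⊛ D) ≗ˢ 0ˢ
  cancel = RationalSeries.cancel seriesRing

constant : ℤ → Series
constant a zero    = a
constant a (suc n) = 0ℤ

constant-⊛ : ∀ a f → constant a ⊛ f ≗ˢ (λ n → a *ᶻ f n)
constant-⊛ a f zero    = ℤ.+-identityʳ (a *ᶻ f 0)
constant-⊛ a f (suc n) = trans (cong (a *ᶻ f (suc n) +ᶻ_) (⊛-zeroˡ f n)) (ℤ.+-identityʳ _)

shift : ℕ → Series → Series
shift zero    f n       = f n
shift (suc l) f zero    = 0ℤ
shift (suc l) f (suc n) = shift l f n

shift-⊛ : ∀ l f g → shift l f ⊛ g ≗ˢ shift l (f ⊛ g)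
shift-⊛ zero    f g n       = refl
shift-⊛ (suc l) f g zero    = trans (ℤ.+-identityʳ _) (ℤ.*-zeroˡ (g 0))
shift-⊛ (suc l) f g (suc n) = trans (cong₂ _+ᶻ_ (ℤ.*-zeroˡ (g (suc n))) (shift-⊛ l f g n)) (ℤ.+-identityˡ _)

shift-cong : ∀ l {f g} → f ≗ˢ g → shift l f ≗ˢ shift l g
shift-cong zero    eq n       = eq n
shift-cong (suc l) eq zero    = refl
shift-cong (suc l) eq (suc n) = shift-cong l eq n

shift-< : ∀ l f n → n < l → shift l f n ≡ 0ℤ
shift-< (suc l) f zero    _         = refl
shift-< (suc l) f (suc n) (s≤s n<l) = shift-< l f n n<l

shift-+ : ∀ l f k → shift l f (l + k) ≡ f k
shift-+ zero    f k = refl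
shift-+ (suc l) f k = shift-+ l f k

∂-shift : ∀ l → ∂ (shift l one) ≗ˢ (λ n → + l *ᶻ shift l one n)
∂-shift zero    zero    = refl
∂-shift zero    (suc n) = ℤ.*-zeroʳ (+ suc n)
∂-shift (suc l) zero    = sym (ℤ.*-zeroʳ (+ suc l))
∂-shift (suc l) (suc n) = trans (lemma (+ n) (shift l one n)) (trans (cong (shift l one n +ᶻ_) (∂-shift l n)) (sym (lemma (+ l) (shift l one n))))
  where
  lemma : ∀ n x → (1ℤ +ᶻ n) *ᶻ x ≡ x +ᶻ n *ᶻ x
  lemma = solve-∀

geometric-∣ : ∀ {l n} → l ℕ∣.∣ n → geometric l n ≡ 1ℤ
geometric-∣ {l} {n} l∣n = cong (if_then 1ℤ else 0ℤ) (dec-true (l ℕ∣.∣? n) l∣n)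

geometric-∤ : ∀ {l n} → ¬ l ℕ∣.∣ n → geometric l n ≡ 0ℤ
geometric-∤ {l} {n} l∤n = cong (if_then 1ℤ else 0ℤ) (dec-false (l ℕ∣.∣? n) l∤n)

geometric-< : ∀ l n → n < l → geometric l n ≡ one n
geometric-< l zero    n<l = geometric-∣ (l ℕ∣.∣0)
geometric-< l (suc n) n<l = geometric-∤ (λ l∣n → ℕ.<⇒≱ n<l (ℕ∣.∣⇒≤ l∣n))

geometric-+ : ∀ l k → geometric l (l + k) ≡ geometric l k
geometric-+ l k with l ℕ∣.∣? k
... | yes l∣k = geometric-∣ (ℕ∣.∣m∣n⇒∣m+n ℕ∣.∣-refl l∣k)
... | no l∤k = geometric-∤ (λ l∣l+k → l∤k (ℕ∣.∣m+n∣m⇒∣n l∣l+k ℕ∣.∣-refl))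

geometric-unfold : ∀ l → geometric (suc l) ≗ˢ one +ˢ shift (suc l) one ⊛ geometric (suc l)
geometric-unfold l n = trans (by-size (ℕ.<-≤-connex n (suc l)))
  (cong (one n +ᶻ_) (sym (trans (shift-⊛ (suc l) one (geometric (suc l)) n) (shift-cong (suc l) (⊛-identityˡ (geometric (suc l))) n))))
  where
  by-size : n < suc l ⊎ suc l ≤ n → geometric (suc l) n ≡ one n +ᶻ shift (suc l) (geometric (suc l)) n
  by-size (inj₁ n<l) = trans (geometric-< (suc l) n n<l) (sym (trans (cong (one n +ᶻ_) (shift-< (suc l) (geometric (suc l)) n n<l)) (ℤ.+-identityʳ (one n))))
  by-size (inj₂ l≤n) = subst (λ n → geometric (suc l) n ≡ one n +ᶻ shift (suc l) (geometric (suc l)) n) (ℕ.m+[n∸m]≡n l≤n)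
    (trans (geometric-+ (suc l) (n ∸ suc l)) (sym (trans (ℤ.+-identityˡ _) (shift-+ (suc l) (geometric (suc l)) (n ∸ suc l)))))

-- u d/du of -log (1 - uˡ)
ψ : ℕ → Series
ψ l n = + l *ᶻ (geometric l n +ᶻ - one n)

private
  constant-ψ : ∀ l → constant (+ l) ⊛ (geometric l +ˢ -ˢ one) ≗ˢ ψ l
  constant-ψ l = constant-⊛ (+ l) (geometric l +ˢ -ˢ one)

  ∂U : ∀ l → ∂ (shift l one) ≗ˢ constant (+ l) ⊛ shift l one
  ∂U l n = trans (∂-shift l n) (sym (constant-⊛ (+ l) (shift l one) n))

∂-geometric : ∀ l → ∂ (geometric (suc l)) ≗ˢ ψ (suc l) ⊛ geometric (suc l)
∂-geometric l = 𝒮.trans (RationalSeries.∂-reciprocal seriesRing ∂ ∂-cong ∂-+ˢ ∂-⊛ ∂-one ∂-neg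
  (constant (+ suc l)) (shift (suc l) one) (geometric (suc l)) (∂U (suc l)) (geometric-unfold l))
  (⊛-cong (constant-ψ (suc l)) λ _ → refl)

∂-1-u^ : ∀ l → ∂ (one +ˢ -ˢ shift (suc l) one) ≗ˢ (-ˢ ψ (suc l)) ⊛ (one +ˢ -ˢ shift (suc l) one)
∂-1-u^ l = 𝒮.trans (RationalSeries.∂-1-U seriesRing ∂ ∂-cong ∂-+ˢ ∂-⊛ ∂-one ∂-neg
  (constant (+ suc l)) (shift (suc l) one) (geometric (suc l)) (∂U (suc l)) (geometric-unfold l))
  (⊛-cong (λ n → cong -_ (constant-ψ (suc l) n)) λ _ → refl)

ψ-∣ : ∀ {l n} → l ℕ∣.∣ suc n → ψ l (suc n) ≡ + l
ψ-∣ {l} l∣n = trans (cong (λ g → + l *ᶻ (g +ᶻ 0ℤ)) (geometric-∣ l∣n)) (ℤ.*-identityʳ (+ l))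

ψ-∤ : ∀ {l n} → ¬ l ℕ∣.∣ suc n → ψ l (suc n) ≡ 0ℤ
ψ-∤ {l} l∤n = trans (cong (λ g → + l *ᶻ (g +ᶻ 0ℤ)) (geometric-∤ l∤n)) (ℤ.*-zeroʳ (+ l))

ψ-0 : ∀ l → ψ l 0 ≡ 0ℤ
ψ-0 l = trans (cong (λ g → + l *ᶻ (g +ᶻ - 1ℤ)) (geometric-∣ (l ℕ∣.∣0))) (ℤ.*-zeroʳ (+ l))

product : List Series → Series
product = foldr _⊛_ one

product-++ : ∀ fs gs → product (fs ++ gs) ≗ˢ product fs ⊛ product gs
product-++ []       gs = 𝒮.sym (⊛-identityˡ (product gs))
product-++ (f ∷ fs) gs = 𝒮.trans (⊛-cong {f} (λ _ → refl) (product-++ fs gs)) (𝒮.sym (⊛-assoc f (product fs) (product gs)))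

product-≡one : ∀ N fs → All (λ f → ∀ i → i ≤ N → f i ≡ one i) fs → ∀ i → i ≤ N → product fs i ≡ one i
product-≡one N []       []         i i≤N = refl
product-≡one N (f ∷ fs) (eq ∷ eqs) i i≤N = trans
  (sum-cong-≗ {suc i} λ k → cong₂ _*ᶻ_ (eq (toℕ k) (ℕ.≤-trans (ℕ.≤-pred (Fin.toℕ<n k)) i≤N))
    (product-≡one N fs eqs (i ∸ toℕ k) (ℕ.≤-trans (ℕ.m∸n≤m i (toℕ k)) i≤N)))
  (⊛-identityˡ one i)

-- The logarithmic derivative of the zeta function.

module Zeta (Y : Digraph) where
  open Digraph Y
  open Cycles Y

  private
    pow-injective : ∀ k {c d : List E} → pow (suc k) c ≡ pow (suc k) d → c ≡ d
    pow-injective k {c} {d} eq = cancel (++-prefix c d eq (ℕ.≤-reflexive lengths))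
      where
      lengths : length c ≡ length d
      lengths = ℕ.*-cancelˡ-≡ (length c) (length d) (suc k)
        (trans (sym (length-pow (suc k) c)) (trans (cong length eq) (length-pow (suc k) d)))
      cancel : (∃ λ w → d ≡ c ++ w × _) → c ≡ d
      cancel ([] , eq , _) = sym (trans eq (List.++-identityʳ c))
      cancel (f ∷ w , eq , _) = ⊥-elim (ℕ.m≢1+m+n (length c) (trans lengths (trans (cong length eq) (trans (List.length-++ c) (ℕ.+-suc (length c) (length w))))))

    powers : ∀ {m d} → Dec (d ℕ∣.∣ m) → List (List E)
    powers {d = d} (yes (ℕ∣.divides k _)) = map (pow k) (primitives d)
    powers (no _) = []

    -- The cycles of length m whose primitive root has length d.
    block : ℕ → ℕ → List (List E)
    block m d = powers (d ℕ∣.∣? m)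

    powers-unique : ∀ {m d} (d∣?m : Dec (d ℕ∣.∣ suc m)) → Unique (powers d∣?m)
    powers-unique {d = d} (yes (ℕ∣.divides (suc k) _)) = Unique.map⁺ (pow-injective k) (primitives-unique d)
    powers-unique (no _) = []

    powers-∈ : ∀ {m d w} (d∣?m : Dec (d ℕ∣.∣ suc m)) → w ∈ powers d∣?m →
      ∃ λ c → ∃ λ k → Primitive c × length c ≡ d × w ≡ pow (suc k) c × suc m ≡ suc k * d
    powers-∈ {d = d} (yes (ℕ∣.divides (suc k) eq)) w∈ =
      let c , c∈ , w≡ = ∈-map⁻ (pow (suc k)) w∈
          prim , len = primitives-∈ d c∈
      in c , k , prim , len , w≡ , eq

    ∈-powers : ∀ {m d c k} (d∣?m : Dec (d ℕ∣.∣ suc m)) → Primitive c → length c ≡ d → suc m ≡ k * d → pow k c ∈ powers d∣?m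
    ∈-powers {c = c} {k} (no d∤m) prim len eq = ⊥-elim (d∤m (ℕ∣.divides k eq))
    ∈-powers {d = zero} {c} {k} (yes _) prim len eq = case trans eq (ℕ.*-zeroʳ k) of λ ()
    ∈-powers {d = suc d} {c} {k} (yes (ℕ∣.divides k′ eq′)) prim len eq
      with refl ← ℕ.*-cancelʳ-≡ k k′ (suc d) (trans (sym eq) eq′) = ∈-map⁺ (pow k) (∈-primitives prim len)

    -- The d rotations of each class match the coefficient d of `ψ d` at multiples of d, so a block
    -- counts what its Euler factors contribute.
    length-powers : ∀ {m d} (d∣?m : Dec (d ℕ∣.∣ suc m)) → + length (powers d∣?m) ≡ + length (primitiveClasses Y d) *ᶻ ψ d (suc m)
    length-powers {m} {d} (yes d∣m@(ℕ∣.divides k _)) = trans (cong +_ (trans (List.length-map (pow k) (primitives d)) (length-primitives d)))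
      (trans (ℤ.pos-* (length (primitiveClasses Y d)) d) (cong (+ length (primitiveClasses Y d) *ᶻ_) (sym (ψ-∣ d∣m))))
    length-powers {m} {d} (no d∤m) = sym (trans (cong (+ length (primitiveClasses Y d) *ᶻ_) (ψ-∤ d∤m)) (ℤ.*-zeroʳ (+ length (primitiveClasses Y d))))

  lengths≤ : ℕ → List ℕ
  lengths≤ n = map suc (upTo n)

  -- Every cycle is a power of a unique primitive one.
  length-cycles : ∀ m n → suc m ≤ n → length (cycles (suc m)) ≡ length (concatMap (block (suc m)) (lengths≤ n))
  length-cycles m n m<n = unique-same-length (Unique.filter⁺ (isCycle? Y) (words-unique (suc m))) all-unique to from
    where
    all-unique : Unique (concatMap (block (suc m)) (lengths≤ n))
    all-unique = Unique.concat⁺ (All.map⁺ (All.tabulate λ {d} _ → powers-unique (d ℕ∣.∣? suc m)))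
      (AllPairs.map⁺ (AllPairs.map disjoint (Unique.map⁺ ℕ.suc-injective (Unique.upTo⁺ n))))
      where
      disjoint : ∀ {d d′} → d ≢ d′ → ∀ {w} → ¬ (w ∈ block (suc m) d × w ∈ block (suc m) d′)
      disjoint {d} {d′} d≢d′ (w∈ , w∈′) =
        let c , k , prim , len , eq , _ = powers-∈ (d ℕ∣.∣? suc m) w∈
            c′ , k′ , prim′ , len′ , eq′ , _ = powers-∈ (d′ ℕ∣.∣? suc m) w∈′
        in d≢d′ (trans (sym len) (trans (cong length (primitive-unique prim prim′ k k′ (trans (sym eq) eq′))) len′))
    to : ∀ {w} → w ∈ cycles (suc m) → w ∈ concatMap (block (suc m)) (lengths≤ n)
    to {w} w∈ = from-root (root (length w) w ℕ.≤-refl cyc)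
      where
      w∈words = proj₁ (∈-filter⁻ (isCycle? Y) {xs = words Y (suc m)} w∈)
      cyc = proj₂ (∈-filter⁻ (isCycle? Y) {xs = words Y (suc m)} w∈)
      from-root : Root w → w ∈ concatMap (block (suc m)) (lengths≤ n)
      from-root ([] , k , prim , _) = ⊥-elim (primitive-nonempty prim refl)
      from-root (c@(_ ∷ c′) , k , prim , refl) = ∈-concatMap⁺ (block (suc m)) (lose (∈-map⁺ suc (∈-upTo⁺ c′<n))
        (∈-powers {k = suc k} (length c ℕ∣.∣? suc m) prim refl len))
        where
        len : suc m ≡ suc k * length c
        len = trans (sym (words-length (suc m) w∈words)) (length-pow (suc k) c)
        c′<n : length c′ < n
        c′<n = ℕ.≤-trans (ℕ.m≤m+n (length c) (k * length c)) (ℕ.≤-trans (ℕ.≤-reflexive (sym len)) m<n)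
    from : ∀ {w} → w ∈ concatMap (block (suc m)) (lengths≤ n) → w ∈ cycles (suc m)
    from {w} w∈ with d , _ , w∈d ← find (∈-concatMap⁻ (block (suc m)) {xs = lengths≤ n} w∈)
      with c , k , prim , refl , refl , eq ← powers-∈ (d ℕ∣.∣? suc m) w∈d =
      subst (λ l → pow (suc k) c ∈ cycles l) (trans (length-pow (suc k) c) (sym eq))
        (∈-filter⁺ (isCycle? Y) (∈-words (pow (suc k) c)) (closed⇒cycle (pow (suc k) c) (closed-pow k c (cycle⇒closed c (proj₁ prim)))))

  private
    -- The logarithmic derivative of the product of the Euler factors of the given cycles.
    Ψ : List (List E) → Series
    Ψ []       n = 0ℤ
    Ψ (c ∷ cs) n = ψ (length c) n +ᶻ Ψ cs n

    Ψ-++ : ∀ cs ds n → Ψ (cs ++ ds) n ≡ Ψ cs n +ᶻ Ψ ds n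
    Ψ-++ []       ds n = sym (ℤ.+-identityˡ (Ψ ds n))
    Ψ-++ (c ∷ cs) ds n = trans (cong (ψ (length c) n +ᶻ_) (Ψ-++ cs ds n)) (sym (ℤ.+-assoc (ψ (length c) n) (Ψ cs n) (Ψ ds n)))

    Ψ-0 : ∀ cs → Ψ cs 0 ≡ 0ℤ
    Ψ-0 []       = refl
    Ψ-0 (c ∷ cs) = cong₂ _+ᶻ_ (ψ-0 (length c)) (Ψ-0 cs)

    Ψ-constant : ∀ l cs n → (∀ {c} → c ∈ cs → length c ≡ l) → Ψ cs n ≡ + length cs *ᶻ ψ l n
    Ψ-constant l []       n eq = refl
    Ψ-constant l (c ∷ cs) n eq = trans (cong₂ (λ k x → ψ k n +ᶻ x) (eq (here refl)) (Ψ-constant l cs n (eq ∘ there)))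
      (lemma (ψ l n) (+ length cs))
      where
      lemma : ∀ x k → x +ᶻ k *ᶻ x ≡ (1ℤ +ᶻ k) *ᶻ x
      lemma = solve-∀

    Ψ-blocks : ∀ m ds → Ψ (concatMap (primitiveClasses Y) ds) (suc m) ≡ + length (concatMap (block (suc m)) ds)
    Ψ-blocks m []       = refl
    Ψ-blocks m (d ∷ ds) = trans (Ψ-++ (primitiveClasses Y d) _ (suc m)) (trans
      (cong₂ _+ᶻ_ (trans (Ψ-constant d (primitiveClasses Y d) (suc m) (proj₂ ∘ classes-∈ d)) (sym (length-powers (d ℕ∣.∣? suc m)))) (Ψ-blocks m ds))
      (trans (sym (ℤ.pos-+ (length (block (suc m) d)) _)) (cong +_ (sym (List.length-++ (block (suc m) d))))))

    ∂-product : ∀ cs → All (λ c → c ≢ []) cs → ∂ (product (map (geometric ∘ length) cs)) ≗ˢ Ψ cs ⊛ product (map (geometric ∘ length) cs)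
    ∂-product [] [] = 𝒮.trans ∂-one (𝒮.sym (⊛-zeroˡ one))
    ∂-product ([] ∷ cs) (c≢[] ∷ _) = ⊥-elim (c≢[] refl)
    ∂-product ((e ∷ c) ∷ cs) (_ ∷ all) = 𝒮.trans (∂-⊛ g Π) (𝒮.trans
      (𝒮.+-cong (⊛-cong {g = Π} (∂-geometric (length c)) (λ _ → refl)) (⊛-cong {g} (λ _ → refl) (∂-product cs all)))
      (RationalSeries.collect seriesRing (ψ (suc (length c))) g Π (Ψ cs)))
      where
      g Π : Series
      g = geometric (suc (length c))
      Π = product (map (geometric ∘ length) cs)

    classes≤ : ℕ → List (List E)
    classes≤ n = concatMap (primitiveClasses Y) (lengths≤ n)

    partial : ℕ → Series
    partial n = product (map (geometric ∘ length) (classes≤ n))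

    classes≤-suc : ∀ n → classes≤ (suc n) ≡ classes≤ n ++ primitiveClasses Y (suc n)
    classes≤-suc n = trans (cong (concatMap (primitiveClasses Y)) (trans (cong (map suc) (sym (List.upTo-∷ʳ n))) (List.map-++ suc (upTo n) [ n ])))
      (trans (List.concatMap-++ (primitiveClasses Y) (lengths≤ n) [ suc n ]) (cong (classes≤ n ++_) (List.++-identityʳ _)))

    partial-suc : ∀ n i → i ≤ n → partial (suc n) i ≡ partial n i
    partial-suc n i i≤n = begin
      partial (suc n) i
        ≡⟨ cong (λ fs → product fs i) (trans (cong (map (geometric ∘ length)) (classes≤-suc n)) (List.map-++ (geometric ∘ length) (classes≤ n) new)) ⟩
      product (map (geometric ∘ length) (classes≤ n) ++ map (geometric ∘ length) new) i
        ≡⟨ product-++ (map (geometric ∘ length) (classes≤ n)) (map (geometric ∘ length) new) i ⟩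
      (partial n ⊛ product (map (geometric ∘ length) new)) i
        ≡⟨ sum-cong-≗ {suc i} (λ k → cong (partial n (toℕ k) *ᶻ_) (product-≡one n (map (geometric ∘ length) new) trivial (i ∸ toℕ k) (ℕ.≤-trans (ℕ.m∸n≤m i (toℕ k)) i≤n))) ⟩
      (partial n ⊛ one) i
        ≡⟨ trans (⊛-comm (partial n) one i) (⊛-identityˡ (partial n) i) ⟩
      partial n i ∎
      where
      open ≡-Reasoning
      new : List (List E)
      new = primitiveClasses Y (suc n)
      trivial : All (λ f → ∀ i → i ≤ n → f i ≡ one i) (map (geometric ∘ length) new)
      trivial = All.map⁺ (All.tabulate λ {c} c∈ i i≤n → trans (cong (λ l → geometric l i) (proj₂ (classes-∈ (suc n) c∈))) (geometric-< (suc n) i (s≤s i≤n)))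

    -- Each coefficient of `zeta Y` is read off from its own finite product. By stability the single
    -- product up to n serves all coefficients up to n, as a convolution requires.
    partial-stable : ∀ i k → partial (k + i) i ≡ zeta Y i
    partial-stable i zero    = refl
    partial-stable i (suc k) = trans (partial-suc (k + i) i (ℕ.m≤n+m i k)) (partial-stable i k)

  closedWalks : Series
  closedWalks n = + length (cycles n)

  ∂-zeta : ∂ (zeta Y) ≗ˢ closedWalks ⊛ zeta Y
  ∂-zeta n = trans (∂-product (classes≤ n) nonempty n)
    (sum-cong-≗ {suc n} λ k → cong₂ _*ᶻ_ (walks (toℕ k) (ℕ.≤-pred (Fin.toℕ<n k)))
      (trans (cong (λ m → partial m (n ∸ toℕ k)) (sym (ℕ.m+[n∸m]≡n (ℕ.≤-pred (Fin.toℕ<n k))))) (partial-stable (n ∸ toℕ k) (toℕ k))))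
    where
    nonempty : All (λ c → c ≢ []) (classes≤ n)
    nonempty = All.tabulate λ c∈ → let d , _ , c∈d = find (∈-concatMap⁻ (primitiveClasses Y) {xs = lengths≤ n} c∈) in primitive-nonempty (proj₁ (classes-∈ d c∈d))
    walks : ∀ i → i ≤ n → Ψ (classes≤ n) i ≡ closedWalks i
    walks zero    _   = Ψ-0 (classes≤ n)
    walks (suc i) i<n = trans (Ψ-blocks i (lengths≤ n)) (cong +_ (sym (length-cycles i n i<n)))

  zeta-0 : zeta Y 0 ≡ 1ℤ
  zeta-0 = refl

-- Counting closed walks by traces.

⟦_⟧ : ∀ {ℓ} {P : Set ℓ} → Dec P → ℤ
⟦ P? ⟧ = if does P? then 1ℤ else 0ℤ

⟦⟧-cong : ∀ {ℓ ℓ′} {P : Set ℓ} {Q : Set ℓ′} (P? : Dec P) (Q? : Dec Q) → (P → Q) → (Q → P) → ⟦ P? ⟧ ≡ ⟦ Q? ⟧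
⟦⟧-cong (yes p) (yes q) _ _ = refl
⟦⟧-cong (yes p) (no ¬q) f _ = ⊥-elim (¬q (f p))
⟦⟧-cong (no ¬p) (yes q) _ g = ⊥-elim (¬p (g q))
⟦⟧-cong (no ¬p) (no ¬q) _ _ = refl

sum-𝟙ˡ : ∀ {n} (f : Vecℤ n) i → ∑[ j < n ] (𝟙 i j *ᶻ f j) ≡ f i
sum-𝟙ˡ f i = trans (sum-single i (λ j → 𝟙 i j *ᶻ f j) (λ j j≢i → trans (cong (_*ᶻ f j) (𝟙-off i j (j≢i ∘ sym))) (ℤ.*-zeroˡ (f j))))
  (trans (cong (_*ᶻ f i) (𝟙-diag i)) (ℤ.*-identityˡ (f i)))

module _ {a ℓ} {A : Set a} {P : A → Set ℓ} (P? : ∀ x → Dec (P x)) where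
  count : List A → ℤ
  count xs = + length (filter P? xs)

  count-∷ : ∀ x xs → count (x ∷ xs) ≡ ⟦ P? x ⟧ +ᶻ count xs
  count-∷ x xs with P? x
  ... | yes _ = refl
  ... | no _  = sym (ℤ.+-identityˡ (count xs))

  count-++ : ∀ xs ys → count (xs ++ ys) ≡ count xs +ᶻ count ys
  count-++ xs ys = trans (cong (+_ ∘ length) (List.filter-++ P? xs ys)) (trans (cong +_ (List.length-++ (filter P? xs))) (ℤ.pos-+ (length (filter P? xs)) _))

  count-tabulate : ∀ {b} {B : Set b} (f : B → A) {n} (g : Fin n → B) → count (map f (tabulate g)) ≡ ∑[ k < n ] ⟦ P? (f (g k)) ⟧
  count-tabulate f {zero}  g = refl
  count-tabulate f {suc n} g = trans (count-∷ (f (g zero)) _) (cong (⟦ P? (f (g zero)) ⟧ +ᶻ_) (count-tabulate f (g ∘ suc)))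

  count-map : ∀ {b} {B : Set b} (f : B → A) xs → count (map f xs) ≡ + length (filter (P? ∘ f) xs)
  count-map f []       = refl
  count-map f (x ∷ xs) with P? (f x)
  ... | yes _ = trans (ℤ.pos-+ 1 (length (filter P? (map f xs)))) (trans (cong (1ℤ +ᶻ_) (count-map f xs)) (sym (ℤ.pos-+ 1 (length (filter (P? ∘ f) xs)))))
  ... | no _  = count-map f xs

count-cong : ∀ {a ℓ ℓ′} {A : Set a} {P : A → Set ℓ} {Q : A → Set ℓ′} (P? : ∀ x → Dec (P x)) (Q? : ∀ x → Dec (Q x)) →
  (∀ x → P x → Q x) → (∀ x → Q x → P x) → ∀ xs → count P? xs ≡ count Q? xs
count-cong P? Q? f g xs = cong (+_ ∘ length) (List.filter-≐ P? Q? ((λ {x} → f x) , (λ {x} → g x)) xs)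

count-×-dec : ∀ {a ℓ ℓ′} {A : Set a} {P : Set ℓ} {Q : A → Set ℓ′} (P? : Dec P) (Q? : ∀ x → Dec (Q x)) xs →
  count (λ x → P? ×-dec Q? x) xs ≡ ⟦ P? ⟧ *ᶻ count Q? xs
count-×-dec (yes p) Q? xs = trans (count-cong _ Q? (λ _ → proj₂) (λ _ → p ,_) xs) (sym (ℤ.*-identityˡ _))
count-×-dec (no ¬p) Q? xs = trans (cong (+_ ∘ length) (List.filter-none (λ x → no ¬p ×-dec Q? x) (All.tabulate {xs = xs} λ _ → ¬p ∘ proj₁))) (sym (ℤ.*-zeroˡ (count Q? xs)))

count-product : ∀ {a b ℓ} {A : Set a} {B : Set b} {P : List A → Set ℓ} (P? : ∀ x → Dec (P x)) (f : B → A) {n} (g : Fin n → B) ws →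
  count P? (cartesianProductWith _∷_ (map f (tabulate g)) ws) ≡ ∑[ k < n ] count (λ w → P? (f (g k) ∷ w)) ws
count-product P? f {zero}  g ws = refl
count-product P? f {suc n} g ws = trans (count-++ P? (map (f (g zero) ∷_) ws) _)
  (cong₂ _+ᶻ_ (count-map P? (f (g zero) ∷_) ws) (count-product P? f (g ∘ suc) ws))

module ClosedWalks (Y : Digraph) where
  open Digraph Y
  open Cycles Y
  open Zeta Y using (closedWalks)
  open Action (adjacency Y)
  open Twist (adjacency Y)

  index : V → Fin order
  index = Inverse.to enumV

  edge : Fin size → E
  edge = Inverse.from enumE

  source target : Fin size → Fin order
  source k = index (o (edge k))
  target k = index (t (edge k))

  private
    index-injective : ∀ {v w} → index v ≡ index w → v ≡ w
    index-injective eq = trans (sym (Inverse.inverseʳ enumV refl)) (trans (cong vertex eq) (Inverse.inverseʳ enumV refl))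

    index-vertex : ∀ i → index (vertex i) ≡ i
    index-vertex i = Inverse.inverseˡ enumV refl

    ⟦≟V⟧ : ∀ v w → ⟦ v ≟V w ⟧ ≡ e (index v) (index w)
    ⟦≟V⟧ v w = ⟦⟧-cong (v ≟V w) (index v Fin.≟ index w) (cong index) index-injective

    ⟦×⟧ : ∀ {ℓ ℓ′} {P : Set ℓ} {Q : Set ℓ′} (P? : Dec P) (Q? : Dec Q) → ⟦ P? ×-dec Q? ⟧ ≡ ⟦ P? ⟧ *ᶻ ⟦ Q? ⟧
    ⟦×⟧ (yes _) (yes _) = refl
    ⟦×⟧ (yes _) (no _)  = refl
    ⟦×⟧ (no _)  Q?      = sym (ℤ.*-zeroˡ ⟦ Q? ⟧)

  adjacency-sum : ∀ i j → adjacency Y i j ≡ ∑[ k < size ] (e (source k) j *ᶻ e (target k) i)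
  adjacency-sum i j = trans (count-tabulate (λ f → (o f ≟V vertex j) ×-dec (t f ≟V vertex i)) edge (λ k → k))
    (sum-cong-≗ λ k → trans (⟦×⟧ (o (edge k) ≟V vertex j) (t (edge k) ≟V vertex i))
      (cong₂ _*ᶻ_ (entry (o (edge k)) j) (entry (t (edge k)) i)))
    where
    entry : ∀ v i → ⟦ v ≟V vertex i ⟧ ≡ e (index v) i
    entry v i = trans (⟦≟V⟧ v (vertex i)) (cong (e (index v)) (index-vertex i))

  -- Splits walks of length l + 1 according to their first edge.
  powᵛ-edges : ∀ l a b → powᵛ (suc l) (e a) b ≡ ∑[ k < size ] (e (source k) a *ᶻ powᵛ l (e (target k)) b)
  powᵛ-edges l a b = begin
    powᵛ (suc l) (e a) b
      ≡⟨ powᵛ-suc l (e a) b ⟨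
    powᵛ l (adjacency Y *ᵛ e a) b
      ≡⟨ powᵛ-cong l column b ⟩
    powᵛ l (comb (λ k → e (source k) a) (λ k → e (target k))) b
      ≡⟨ powᵛ-comb l (λ k → e (source k) a) (λ k → e (target k)) b ⟩
    ∑[ k < size ] (e (source k) a *ᶻ powᵛ l (e (target k)) b) ∎
    where
    open ≡-Reasoning
    column : ∀ v → (adjacency Y *ᵛ e a) v ≡ comb (λ k → e (source k) a) (λ k → e (target k)) v
    column v = trans (sum-cong-≗ λ j → ℤ.*-comm (adjacency Y v j) (e a j)) (trans (sum-𝟙ˡ (adjacency Y v) a) (adjacency-sum v a))

  adjacency-*ᵛ : ∀ z i → (adjacency Y *ᵛ z) i ≡ ∑[ k < size ] (e (target k) i *ᶻ z (source k))
  adjacency-*ᵛ z i = begin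
    ∑[ j < order ] (adjacency Y i j *ᶻ z j)
      ≡⟨ sum-cong-≗ (λ j → trans (cong (_*ᶻ z j) (adjacency-sum i j)) (*-distribʳ-sum (z j) (λ k → e (source k) j *ᶻ e (target k) i))) ⟩
    ∑[ j < order ] ∑[ k < size ] (e (source k) j *ᶻ e (target k) i *ᶻ z j)
      ≡⟨ ∑-comm (λ j k → e (source k) j *ᶻ e (target k) i *ᶻ z j) ⟩
    ∑[ k < size ] ∑[ j < order ] (e (source k) j *ᶻ e (target k) i *ᶻ z j)
      ≡⟨ sum-cong-≗ (λ k → trans (sum-cong-≗ λ j → ℤ.*-assoc (e (source k) j) (e (target k) i) (z j))
           (sum-𝟙ˡ (λ j → e (target k) i *ᶻ z j) (source k))) ⟩
    ∑[ k < size ] (e (target k) i *ᶻ z (source k)) ∎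
    where open ≡-Reasoning

  private
    path? : ∀ a w b → Dec (Path a w b)
    path? a []       b = a ≟V b
    path? a (f ∷ fs) b = (o f ≟V a) ×-dec path? (t f) fs b

    walks : V → ℕ → V → ℤ
    walks a l b = count (λ w → path? a w b) (words Y l)

    walks-power : ∀ l a b → walks a l b ≡ powᵛ l (e (index a)) (index b)
    walks-power zero a b = trans (count-∷ (λ w → path? a w b) [] []) (trans (ℤ.+-identityʳ ⟦ a ≟V b ⟧) (⟦≟V⟧ a b))
    walks-power (suc l) a b = begin
      walks a (suc l) b
        ≡⟨ count-product (λ w → path? a w b) edge (λ k → k) (words Y l) ⟩
      ∑[ k < size ] count (λ w → (o (edge k) ≟V a) ×-dec path? (t (edge k)) w b) (words Y l)
        ≡⟨ sum-cong-≗ (λ k → trans (count-×-dec (o (edge k) ≟V a) (λ w → path? (t (edge k)) w b) (words Y l))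
             (cong₂ _*ᶻ_ (⟦≟V⟧ (o (edge k)) a) (walks-power l (t (edge k)) b))) ⟩
      ∑[ k < size ] (e (source k) (index a) *ᶻ powᵛ l (e (target k)) (index b))
        ≡⟨ powᵛ-edges l (index a) (index b) ⟨
      powᵛ (suc l) (e (index a)) (index b) ∎
      where open ≡-Reasoning

  -- A cycle with first edge k is k followed by a path from its target to its source. Grouping the
  -- edges by their source a yields the diagonal entries of the power.
  closedWalks-trace : ∀ l → closedWalks (suc l) ≡ traceᴬ (suc l)
  closedWalks-trace l = begin
    closedWalks (suc l)
      ≡⟨ count-product (isCycle? Y) edge (λ k → k) (words Y l) ⟩
    ∑[ k < size ] count (λ w → isCycle? Y (edge k ∷ w)) (words Y l)
      ≡⟨ sum-cong-≗ (λ k → trans (count-cong (λ w → isCycle? Y (edge k ∷ w)) (λ w → path? (t (edge k)) w (o (edge k)))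
           (λ w → cycle⇒closed (edge k ∷ w)) (λ w → closed⇒cycle (edge k ∷ w)) (words Y l)) (walks-power l (t (edge k)) (o (edge k)))) ⟩
    ∑[ k < size ] powᵛ l (e (target k)) (source k)
      ≡⟨ sum-cong-≗ (λ k → sum-𝟙ˡ (λ a → powᵛ l (e (target k)) a) (source k)) ⟨
    ∑[ k < size ] ∑[ a < order ] (e (source k) a *ᶻ powᵛ l (e (target k)) a)
      ≡⟨ ∑-comm (λ k a → e (source k) a *ᶻ powᵛ l (e (target k)) a) ⟩
    ∑[ a < order ] ∑[ k < size ] (e (source k) a *ᶻ powᵛ l (e (target k)) a)
      ≡⟨ sum-cong-≗ (λ a → powᵛ-edges l a a) ⟨
    traceᴬ (suc l) ∎
    where open ≡-Reasoning

-- Cyclic groups with a chosen generator, and the layers of the derived digraph.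

module Generator (q : ℕ) .{{_ : NonZero q}} (t s : ℕ) (ts≡1 : (t * s) % q ≡ 1 % q) where
  toℕ-mod : ∀ a → toℕ (a mod q) ≡ a % q
  toℕ-mod a = Fin.toℕ-fromℕ< (ℕ%.m%n<n a q)

  %-congˡ-+ : ∀ {i j} k → i % q ≡ j % q → (i + k) % q ≡ (j + k) % q
  %-congˡ-+ {i} {j} k eq = trans (ℕ%.%-distribˡ-+ i k q) (trans (cong (λ x → (x + k % q) % q) eq) (sym (ℕ%.%-distribˡ-+ j k q)))

  %-congˡ-* : ∀ {i j} k → i % q ≡ j % q → (i * k) % q ≡ (j * k) % q
  %-congˡ-* {i} {j} k eq = trans (ℕ%.%-distribˡ-* i k q) (trans (cong (λ x → (x * (k % q)) % q) eq) (sym (ℕ%.%-distribˡ-* j k q)))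

  private
    toℕ% : ∀ (σ : Fin q) → toℕ σ % q ≡ toℕ σ
    toℕ% σ = ℕ%.m<n⇒m%n≡m (Fin.toℕ<n σ)

    *-ts : ∀ k → (k * (t * s)) % q ≡ k % q
    *-ts k = trans (cong (_% q) (ℕ.*-comm k (t * s))) (trans (%-congˡ-* k ts≡1) (cong (_% q) (ℕ.*-identityˡ k)))

    -- Multiplication by q - 1 serves as negation modulo q, in place of a truncated subtraction.
    complement : ∀ a → a + (q ∸ 1) * a ≡ a * q
    complement a = trans (cong (_* a) (ℕ.suc-pred q)) (ℕ.*-comm q a)

  %-cancelʳ-+ : ∀ i j k → (i + k) % q ≡ (j + k) % q → i % q ≡ j % q
  %-cancelʳ-+ i j k eq = trans (sym (absorb i)) (trans (%-congˡ-+ ((q ∸ 1) * k) eq) (absorb j))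
    where
    absorb : ∀ i → (i + k + (q ∸ 1) * k) % q ≡ i % q
    absorb i = trans (cong (_% q) (trans (ℕ.+-assoc i k ((q ∸ 1) * k)) (cong (λ x → i + x) (complement k)))) (ℕ%.[m+kn]%n≡m%n i k q)

  -- The layer reached from 0 after k edges. As t is invertible modulo q, all layers occur, and
  -- `log` is the discrete logarithm.
  pos : ℕ → Fin q
  pos k = (k * t) mod q

  log : Fin q → ℕ
  log σ = (toℕ σ * s) % q

  step : Fin q → Fin q
  step σ = (toℕ σ + t) mod q

  pos-cong : ∀ {i j} → i % q ≡ j % q → pos i ≡ pos j
  pos-cong {i} {j} eq = Fin.toℕ-injective (trans (toℕ-mod (i * t)) (trans (%-congˡ-* t eq) (sym (toℕ-mod (j * t)))))

  step-pos : ∀ k → step (pos k) ≡ pos (suc k)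
  step-pos k = Fin.toℕ-injective (trans (toℕ-mod (toℕ (pos k) + t)) (trans (%-congˡ-+ t (trans (cong (_% q) (toℕ-mod (k * t))) (ℕ%.m%n%n≡m%n (k * t) q)))
    (trans (cong (_% q) (ℕ.+-comm (k * t) t)) (sym (toℕ-mod (suc k * t))))))

  step-injective : ∀ {σ ρ} → step σ ≡ step ρ → σ ≡ ρ
  step-injective {σ} {ρ} eq = Fin.toℕ-injective (trans (sym (toℕ% σ)) (trans (%-cancelʳ-+ (toℕ σ) (toℕ ρ) t
    (trans (sym (toℕ-mod (toℕ σ + t))) (trans (cong toℕ eq) (toℕ-mod (toℕ ρ + t))))) (toℕ% ρ)))

  log-pos : ∀ k → log (pos k) ≡ k % q
  log-pos k = trans (%-congˡ-* s (trans (cong (_% q) (toℕ-mod (k * t))) (ℕ%.m%n%n≡m%n (k * t) q)))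
    (trans (cong (_% q) (ℕ.*-assoc k t s)) (*-ts k))

  pos-log : ∀ σ → pos (log σ) ≡ σ
  pos-log σ = Fin.toℕ-injective (begin
    toℕ (pos (log σ))             ≡⟨ toℕ-mod (log σ * t) ⟩
    (log σ * t) % q               ≡⟨ %-congˡ-* t (ℕ%.m%n%n≡m%n (toℕ σ * s) q) ⟩
    (toℕ σ * s * t) % q           ≡⟨ cong (_% q) (trans (ℕ.*-assoc (toℕ σ) s t) (cong (λ x → toℕ σ * x) (ℕ.*-comm s t))) ⟩
    (toℕ σ * (t * s)) % q         ≡⟨ *-ts (toℕ σ) ⟩
    toℕ σ % q                     ≡⟨ toℕ% σ ⟩
    toℕ σ                         ∎)
    where open ≡-Reasoning

  pos-injective : ∀ {i j} → pos i ≡ pos j → i % q ≡ j % q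
  pos-injective {i} {j} eq = trans (sym (log-pos i)) (trans (cong log eq) (log-pos j))

  -- The position m steps before σ.
  before : ℕ → Fin q → ℕ
  before m σ = log σ + (q ∸ 1) * m

  pos-before : ∀ m σ → pos (m + before m σ) ≡ σ
  pos-before m σ = trans (pos-cong (trans (cong (_% q) rearrange) (ℕ%.[m+kn]%n≡m%n (log σ) m q))) (pos-log σ)
    where
    rearrange : m + (log σ + (q ∸ 1) * m) ≡ log σ + m * q
    rearrange = trans (sym (ℕ.+-assoc m (log σ) _)) (trans (cong (_+ (q ∸ 1) * m) (ℕ.+-comm m (log σ)))
      (trans (ℕ.+-assoc (log σ) m _) (cong (λ x → log σ + x) (complement m))))

  before-∣ : ∀ m σ → q ℕ∣.∣ m → σ ≡ pos (before m σ)
  before-∣ m σ (ℕ∣.divides c refl) = sym (trans (pos-cong (trans (cong (λ x → (log σ + x) % q) (sym (ℕ.*-assoc (q ∸ 1) c q))) (ℕ%.[m+kn]%n≡m%n (log σ) ((q ∸ 1) * c) q))) (pos-log σ))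

  ∣-before : ∀ m σ → σ ≡ pos (before m σ) → q ℕ∣.∣ m
  ∣-before m σ eq = ℕ∣.m%n≡0⇒n∣m m q (trans (%-cancelʳ-+ m 0 (before m σ) (pos-injective (trans (pos-before m σ) eq))) (ℕ%.m<n⇒m%n≡m (ℕ.>-nonZero⁻¹ q)))

sum-++ : ∀ m n (f : Vecℤ (m + n)) → sum f ≡ ∑[ i < m ] f (i Fin.↑ˡ n) +ᶻ ∑[ j < n ] f (m Fin.↑ʳ j)
sum-++ zero    n f = sym (ℤ.+-identityˡ (sum f))
sum-++ (suc m) n f = trans (cong (f zero +ᶻ_) (sum-++ m n (f ∘ suc))) (sym (ℤ.+-assoc (f zero) _ _))

sum-combine : ∀ m n (f : Vecℤ (m * n)) → sum f ≡ ∑[ i < m ] ∑[ j < n ] f (combine i j)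
sum-combine zero    n f = refl
sum-combine (suc m) n f = trans (sum-++ n (m * n) f) (cong (∑[ j < n ] f (j Fin.↑ˡ (m * n)) +ᶻ_) (sum-combine m n (λ i → f (n Fin.↑ʳ i))))

𝟙-combine : ∀ {m n} (a c : Fin m) (b d : Fin n) → 𝟙 (combine a b) (combine c d) ≡ 𝟙 a c *ᶻ 𝟙 b d
𝟙-combine a c b d = by-cases (a Fin.≟ c) (b Fin.≟ d)
  where
  by-cases : Dec (a ≡ c) → Dec (b ≡ d) → 𝟙 (combine a b) (combine c d) ≡ 𝟙 a c *ᶻ 𝟙 b d
  by-cases (yes refl) (yes refl) = trans (𝟙-diag (combine a b)) (sym (cong₂ _*ᶻ_ (𝟙-diag a) (𝟙-diag b)))
  by-cases (no a≢c) _ = trans (𝟙-off (combine a b) (combine c d) (a≢c ∘ Fin.combine-injectiveˡ a b c d))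
    (sym (trans (cong (_*ᶻ 𝟙 b d) (𝟙-off a c a≢c)) (ℤ.*-zeroˡ (𝟙 b d))))
  by-cases (yes _) (no b≢d) = trans (𝟙-off (combine a b) (combine c d) (b≢d ∘ Fin.combine-injectiveʳ a b c d))
    (sym (trans (cong (𝟙 a c *ᶻ_) (𝟙-off b d b≢d)) (ℤ.*-zeroʳ (𝟙 a c))))

module ConstantVoltage (p : ℕ) .{{_ : NonZero p}} (X : Digraph) (τ : ℤₚ p) (unit : IsUnit τ) (n : ℕ) where
  open Digraph X using (order; size)

  Y : Digraph
  Y = derived X (const τ) n

  q : ℕ
  q = p ^ n

  private instance
    q≢0 : NonZero q
    q≢0 = ℕ.m^n≢0 p n

  private
    tₙ sₙ : ℕ
    tₙ = toℕ (residue τ n)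
    sₙ = toℕ (residue (proj₁ unit) n)

    inverse : (tₙ * sₙ) % q ≡ 1 % q
    inverse = trans (sym (Fin.toℕ-fromℕ< (ℕ%.m%n<n (tₙ * sₙ) q))) (trans (cong toℕ (proj₂ unit n)) (Fin.toℕ-fromℕ< (ℕ%.m%n<n 1 q)))

  open Generator q tₙ sₙ inverse public

  private
    module CX = ClosedWalks X
    module CY = ClosedWalks Y
    module AX = Action (adjacency X)
    module AY = Action (adjacency Y)
    module TX = Twist (adjacency X)
    module TY = Twist (adjacency Y)

  slice : Vecℤ (order * q) → Fin q → Vecℤ order
  slice z σ v = z (combine v σ)

  -- Every edge leads from a layer to the next one and projects to an edge of X; as `step` is
  -- injective, only layer σ feeds layer `step σ`.
  slice-adjacency-step : ∀ z σ v → slice (adjacency Y *ᵛ z) (step σ) v ≡ (adjacency X *ᵛ slice z σ) v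
  slice-adjacency-step z σ v = begin
    (adjacency Y *ᵛ z) i
      ≡⟨ CY.adjacency-*ᵛ z i ⟩
    sum (λ k → 𝟙 (CY.target k) i *ᶻ z (CY.source k))
      ≡⟨ sum-combine size q (λ k → 𝟙 (CY.target k) i *ᶻ z (CY.source k)) ⟩
    ∑[ k < size ] ∑[ κ < q ] (𝟙 (CY.target (combine k κ)) i *ᶻ z (CY.source (combine k κ)))
      ≡⟨ sum-cong-≗ (λ k → trans (sum-cong-≗ λ κ → entry k κ) (sum-𝟙ˡ (λ κ → 𝟙 (CX.target k) v *ᶻ slice z κ (CX.source k)) σ)) ⟩
    ∑[ k < size ] (𝟙 (CX.target k) v *ᶻ slice z σ (CX.source k))
      ≡⟨ CX.adjacency-*ᵛ (slice z σ) v ⟨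
    (adjacency X *ᵛ slice z σ) v ∎
    where
    open ≡-Reasoning
    i : Fin (order * q)
    i = combine v (step σ)
    shuffle : ∀ a b c → a *ᶻ b *ᶻ c ≡ b *ᶻ (a *ᶻ c)
    shuffle = solve-∀
    source-combine : ∀ k κ → CY.source (combine k κ) ≡ combine (CX.source k) κ
    source-combine k κ = cong (λ (k , κ) → combine (CX.source k) κ) (Fin.remQuot-combine k κ)
    target-combine : ∀ k κ → CY.target (combine k κ) ≡ combine (CX.target k) (step κ)
    target-combine k κ = cong (λ (k , κ) → combine (CX.target k) (step κ)) (Fin.remQuot-combine k κ)
    𝟙-step : ∀ κ → 𝟙 (step κ) (step σ) ≡ 𝟙 σ κ
    𝟙-step κ = ⟦⟧-cong (step κ Fin.≟ step σ) (σ Fin.≟ κ) (sym ∘ step-injective) (cong step ∘ sym)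
    entry : ∀ k κ → 𝟙 (CY.target (combine k κ)) i *ᶻ z (CY.source (combine k κ)) ≡
      𝟙 σ κ *ᶻ (𝟙 (CX.target k) v *ᶻ slice z κ (CX.source k))
    entry k κ = trans (cong₂ (λ a b → 𝟙 a i *ᶻ z b) (target-combine k κ) (source-combine k κ))
      (trans (cong (_*ᶻ slice z κ (CX.source k)) (trans (𝟙-combine (CX.target k) v (step κ) (step σ)) (cong (𝟙 (CX.target k) v *ᶻ_) (𝟙-step κ))))
      (shuffle (𝟙 (CX.target k) v) (𝟙 σ κ) (slice z κ (CX.source k))))

  slice-adjacency : ∀ z k v → slice (adjacency Y *ᵛ z) (pos (suc k)) v ≡ (adjacency X *ᵛ slice z (pos k)) v
  slice-adjacency z k v = trans (cong (λ σ → slice (adjacency Y *ᵛ z) σ v) (sym (step-pos k))) (slice-adjacency-step z (pos k) v)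

  private
    slice-power : ∀ m z k v → slice (AY.powᵛ m z) (pos (m + k)) v ≡ AX.powᵛ m (slice z (pos k)) v
    slice-power zero    z k v = refl
    slice-power (suc m) z k v = trans (slice-adjacency (AY.powᵛ m z) (m + k) v) (AX.*ᵛ-cong (slice-power m z k) v)

    powᵛ-scale : ∀ m c w v → AX.powᵛ m (λ j → c *ᶻ w j) v ≡ c *ᶻ AX.powᵛ m w v
    powᵛ-scale zero    c w v = refl
    powᵛ-scale (suc m) c w v = trans (AX.*ᵛ-cong (powᵛ-scale m c w) v) (AX.*ᵛ-scale c (AX.powᵛ m w) v)

    -- After m steps, layer σ carries Aᵐ applied to the slice m layers earlier. For a unit vector at
    -- layer σ that slice is nonzero only if m steps go round the cycle of layers, that is, if q
    -- divides m.
    diagonal : ∀ m v σ → AY.powᵛ m (TY.e (combine v σ)) (combine v σ) ≡ geometric q m *ᶻ AX.powᵛ m (TX.e v) v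
    diagonal m v σ = begin
      slice (AY.powᵛ m (TY.e (combine v σ))) σ v
        ≡⟨ cong (λ ρ → slice (AY.powᵛ m (TY.e (combine v σ))) ρ v) (pos-before m σ) ⟨
      slice (AY.powᵛ m (TY.e (combine v σ))) (pos (m + before m σ)) v
        ≡⟨ slice-power m (TY.e (combine v σ)) (before m σ) v ⟩
      AX.powᵛ m (slice (TY.e (combine v σ)) (pos (before m σ))) v
        ≡⟨ TX.powᵛ-cong m (λ w → trans (𝟙-combine v w σ (pos (before m σ))) (ℤ.*-comm (TX.e v w) _)) v ⟩
      AX.powᵛ m (λ w → 𝟙 σ (pos (before m σ)) *ᶻ TX.e v w) v
        ≡⟨ powᵛ-scale m (𝟙 σ (pos (before m σ))) (TX.e v) v ⟩
      𝟙 σ (pos (before m σ)) *ᶻ AX.powᵛ m (TX.e v) v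
        ≡⟨ cong (_*ᶻ AX.powᵛ m (TX.e v) v) (⟦⟧-cong (σ Fin.≟ pos (before m σ)) (q ℕ∣.∣? m) (∣-before m σ) (before-∣ m σ)) ⟩
      geometric q m *ᶻ AX.powᵛ m (TX.e v) v ∎
      where open ≡-Reasoning

    sum-constant : ∀ k c → ∑[ i < k ] c ≡ + k *ᶻ c
    sum-constant zero    c = refl
    sum-constant (suc k) c = trans (cong (c +ᶻ_) (sum-constant k c)) (lemma c (+ k))
      where
      lemma : ∀ c k → c +ᶻ k *ᶻ c ≡ (1ℤ +ᶻ k) *ᶻ c
      lemma = solve-∀

  trace-derived : ∀ m → TY.traceᴬ m ≡ (+ q *ᶻ geometric q m) *ᶻ TX.traceᴬ m
  trace-derived m = begin
    TY.traceᴬ m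
      ≡⟨ sum-combine order q (λ i → AY.powᵛ m (TY.e i) i) ⟩
    ∑[ v < order ] ∑[ σ < q ] AY.powᵛ m (TY.e (combine v σ)) (combine v σ)
      ≡⟨ sum-cong-≗ (λ v → trans (sum-cong-≗ (diagonal m v)) (trans (sum-constant q (geometric q m *ᶻ AX.powᵛ m (TX.e v) v))
           (sym (ℤ.*-assoc (+ q) (geometric q m) (AX.powᵛ m (TX.e v) v))))) ⟩
    ∑[ v < order ] ((+ q *ᶻ geometric q m) *ᶻ AX.powᵛ m (TX.e v) v)
      ≡⟨ *-distribˡ-sum (+ q *ᶻ geometric q m) (λ v → AX.powᵛ m (TX.e v) v) ⟨
    (+ q *ᶻ geometric q m) *ᶻ TX.traceᴬ m ∎
    where open ≡-Reasoning

  closedWalks-derived : ∀ m → Zeta.closedWalks Y m ≡ ψ q m *ᶻ TX.traceᴬ m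
  -- The empty word is not a cycle, in agreement with the subtraction of `one` in `ψ`.
  closedWalks-derived zero    = sym (trans (cong (_*ᶻ TX.traceᴬ 0) (ψ-0 q)) (ℤ.*-zeroˡ (TX.traceᴬ 0)))
  closedWalks-derived (suc m) = trans (CY.closedWalks-trace m) (trans (trace-derived (suc m))
    (cong (λ g → (+ q *ᶻ g) *ᶻ TX.traceᴬ (suc m)) (sym (ℤ.+-identityʳ (geometric q (suc m))))))

-- The Bowen-Franks group of the derived digraph.

1-u^ : ℕ → Polynomial
1-u^ q = 1ᴾ +ᴾ -ᴾ (u ^ᴾ q)

act-1-u^ : ∀ {r} (A : Matrix r r) q v i → Action.act A (1-u^ q) v i ≡ v i -ᶻ Action.powᵛ A q v i
act-1-u^ A q v i = begin
  act (1ᴾ +ᴾ -ᴾ (u ^ᴾ q)) v i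
    ≡⟨ lemma (act (1ᴾ +ᴾ -ᴾ (u ^ᴾ q)) v i) (act (u ^ᴾ q) v i) ⟩
  (act (1ᴾ +ᴾ -ᴾ (u ^ᴾ q)) v i +ᶻ act (u ^ᴾ q) v i) -ᶻ act (u ^ᴾ q) v i
    ≡⟨ cong₂ _-ᶻ_ (trans (sym (act-+ (1ᴾ +ᴾ -ᴾ (u ^ᴾ q)) (u ^ᴾ q) v i)) (trans (act-≈ cancel v i) (act-1 v i))) (act-u^ q v i) ⟩
  v i -ᶻ powᵛ q v i ∎
  where
  open Action A
  open ≡-Reasoning
  lemma : ∀ a b → a ≡ (a +ᶻ b) -ᶻ b
  lemma = solve-∀
  cancel : (1ᴾ +ᴾ -ᴾ (u ^ᴾ q)) +ᴾ u ^ᴾ q ≈ᴾ 1ᴾ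
  cancel = 𝒫.trans (𝒫.+-assoc 1ᴾ (-ᴾ (u ^ᴾ q)) (u ^ᴾ q)) (𝒫.trans (𝒫.+-congˡ {1ᴾ} (𝒫.-‿inverseˡ (u ^ᴾ q))) (𝒫.+-identityʳ 1ᴾ))

ActImage : ∀ {r} → Matrix r r → Polynomial → Subset r
ActImage A P x = ∃ λ w → ∀ j → x j ≡ Action.act A P w j

module BowenFranks (p : ℕ) .{{_ : NonZero p}} (X : Digraph) (τ : ℤₚ p) (unit : IsUnit τ) (n : ℕ) where
  open Digraph X using (order)
  open ConstantVoltage p X τ unit n
  open Action (adjacency X)

  private
    instance
      q≢0 : NonZero q
      q≢0 = ℕ.m^n≢0 p n

    A : Matrix order order
    A = adjacency X

    M : Matrix (order * q) (order * q)
    M = BF-matrix (derived X (const τ) n)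

    M-*ᵛ : ∀ z i → (M *ᵛ z) i ≡ z i -ᶻ (adjacency Y *ᵛ z) i
    M-*ᵛ z i = trans (sum-cong-≗ λ j → lemma (Id i j) (adjacency Y i j) (z j))
      (trans (sym (sum-combination 1ℤ (- 1ℤ) (λ j → Id i j *ᶻ z j) (λ j → adjacency Y i j *ᶻ z j)))
      (trans (cong (λ x → 1ℤ *ᶻ x +ᶻ - 1ℤ *ᶻ (adjacency Y *ᵛ z) i) (sum-𝟙ˡ z i)) (lemma′ (z i) ((adjacency Y *ᵛ z) i))))
      where
      lemma : ∀ a b x → (a -ᶻ b) *ᶻ x ≡ 1ℤ *ᶻ (a *ᶻ x) +ᶻ - 1ℤ *ᶻ (b *ᶻ x)
      lemma = solve-∀
      lemma′ : ∀ a b → 1ℤ *ᶻ a +ᶻ - 1ℤ *ᶻ b ≡ a -ᶻ b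
      lemma′ = solve-∀

  -- ℤ^(rq) / (1 - A_Y) ≅ ℤ^r / (1 - A^q), by x ↦ Σ_{k < q} A^k x_(-kτ) where x_σ is the slice of x at σ.
  horner-slices : Vecℤ (order * q) → ℕ → Vecℤ order
  horner-slices x zero    v = 0ℤ
  horner-slices x (suc k) v = (A *ᵛ horner-slices x k) v +ᶻ slice x (pos (suc k)) v

  private
    L : Vecℤ (order * q) → Vecℤ order
    L x = horner-slices x q

    horner-comb : ∀ {l} (a : Vecℤ l) g k v → horner-slices (comb a g) k v ≡ comb a (λ i → horner-slices (g i) k) v
    horner-comb a g zero    v = sym (sum-zero λ i → ℤ.*-zeroʳ (a i))
    horner-comb a g (suc k) v = trans (cong (_+ᶻ comb a g (combine v (pos (suc k)))) (trans (*ᵛ-cong (horner-comb a g k) v) (*ᵛ-comb a (λ i → horner-slices (g i) k) v)))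
      (trans (sym (∑-distrib-+ (λ i → a i *ᶻ (A *ᵛ horner-slices (g i) k) v) (λ i → a i *ᶻ g i (combine v (pos (suc k))))))
        (sum-cong-≗ λ i → sym (ℤ.*-distribˡ-+ (a i) _ _)))

    -- On slices, x = (1 - A_Y) z reads x at k + 1 = (z at k + 1) - A (z at k), and the Horner sum
    -- telescopes. For k = q the two slices of z coincide and 1 - A^q appears.
    horner-image : ∀ x z → (∀ i → x i ≡ (M *ᵛ z) i) → ∀ k v → horner-slices x k v ≡ slice z (pos k) v +ᶻ - 1ℤ *ᶻ powᵛ k (slice z (pos 0)) v
    horner-image x z eq zero v = lemma (slice z (pos 0) v)
      where
      lemma : ∀ a → 0ℤ ≡ a +ᶻ - 1ℤ *ᶻ a
      lemma = solve-∀
    horner-image x z eq (suc k) v = begin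
      (A *ᵛ horner-slices x k) v +ᶻ slice x (pos (suc k)) v
        ≡⟨ cong₂ _+ᶻ_ (trans (*ᵛ-cong (horner-image x z eq k) v) (trans (*ᵛ-+ (slice z (pos k)) (λ w → - 1ℤ *ᶻ powᵛ k (slice z (pos 0)) w) v)
             (cong ((A *ᵛ slice z (pos k)) v +ᶻ_) (*ᵛ-scale (- 1ℤ) (powᵛ k (slice z (pos 0))) v))))
             (trans (eq (combine v (pos (suc k)))) (trans (M-*ᵛ z (combine v (pos (suc k)))) (cong (slice z (pos (suc k)) v -ᶻ_) (slice-adjacency z k v)))) ⟩
      ((A *ᵛ slice z (pos k)) v +ᶻ - 1ℤ *ᶻ powᵛ (suc k) (slice z (pos 0)) v) +ᶻ (slice z (pos (suc k)) v -ᶻ (A *ᵛ slice z (pos k)) v)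
        ≡⟨ lemma ((A *ᵛ slice z (pos k)) v) (powᵛ (suc k) (slice z (pos 0)) v) (slice z (pos (suc k)) v) ⟩
      slice z (pos (suc k)) v +ᶻ - 1ℤ *ᶻ powᵛ (suc k) (slice z (pos 0)) v ∎
      where
      open ≡-Reasoning
      lemma : ∀ a b c → (a +ᶻ - 1ℤ *ᶻ b) +ᶻ (c -ᶻ a) ≡ c +ᶻ - 1ℤ *ᶻ b
      lemma = solve-∀

    pos-q : pos q ≡ pos 0
    pos-q = pos-cong (trans (ℕ%.n%n≡0 q) (sym (ℕ%.m<n⇒m%n≡m (ℕ.>-nonZero⁻¹ q))))

    preserve : ∀ x → Image M x → ActImage A (1-u^ q) (L x)
    preserve x (z , eq) = slice z (pos 0) , λ v → trans (horner-image x z eq q v)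
      (trans (cong (λ σ → slice z σ v +ᶻ - 1ℤ *ᶻ powᵛ q (slice z (pos 0)) v) pos-q)
      (trans (cong (slice z (pos 0) v +ᶻ_) (ℤ.-1*i≡-i (powᵛ q (slice z (pos 0)) v))) (sym (act-1-u^ A q (slice z (pos 0)) v))))

    -- z is rebuilt layer by layer from z at 0 = w by solving that recursion forwards. It closes up
    -- after q layers exactly because L x = w - A^q w.
    module Reflect (x : Vecℤ (order * q)) (w : Vecℤ order) (Lx : ∀ v → L x v ≡ act (1-u^ q) w v) where
      f : ℕ → Vecℤ order
      f k v = horner-slices x k v +ᶻ powᵛ k w v

      f-suc : ∀ k v → f (suc k) v ≡ (A *ᵛ f k) v +ᶻ slice x (pos (suc k)) v
      f-suc k v = trans (lemma ((A *ᵛ horner-slices x k) v) (slice x (pos (suc k)) v) (powᵛ (suc k) w v)) (cong (_+ᶻ slice x (pos (suc k)) v) (sym (*ᵛ-+ (horner-slices x k) (powᵛ k w) v)))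
        where
        lemma : ∀ a b c → (a +ᶻ b) +ᶻ c ≡ (a +ᶻ c) +ᶻ b
        lemma = solve-∀

      f-q : ∀ v → f q v ≡ f 0 v
      f-q v = trans (cong (_+ᶻ powᵛ q w v) (trans (Lx v) (act-1-u^ A q w v))) (lemma (w v) (powᵛ q w v))
        where
        lemma : ∀ a b → (a -ᶻ b) +ᶻ b ≡ 0ℤ +ᶻ a
        lemma = solve-∀

      z : Vecℤ (order * q)
      z i = f (log (proj₂ (remQuot {order} q i))) (proj₁ (remQuot {order} q i))

      z-slice : ∀ σ v → slice z σ v ≡ f (log σ) v
      z-slice σ v = cong (λ (v , σ) → f (log σ) v) (Fin.remQuot-combine v σ)

      z-pos : ∀ k → k ≤ q → ∀ v → slice z (pos k) v ≡ f k v
      z-pos k k≤q v = trans (z-slice (pos k) v) (trans (cong (λ l → f l v) (log-pos k)) (by-cases (ℕ.m≤n⇒m<n∨m≡n k≤q)))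
        where
        by-cases : k < q ⊎ k ≡ q → f (k % q) v ≡ f k v
        by-cases (inj₁ k<q) = cong (λ l → f l v) (ℕ%.m<n⇒m%n≡m k<q)
        by-cases (inj₂ refl) = trans (cong (λ l → f l v) (ℕ%.n%n≡0 q)) (sym (f-q v))

      -- Layers are numbered 1, ..., q here and not from 0, since the equation at a layer refers to
      -- the preceding number.
      position : ∀ σ → ∃ λ k → k < q × σ ≡ pos (suc k)
      position σ = by-log (log σ) refl
        where
        by-log : ∀ l → log σ ≡ l → ∃ λ k → k < q × σ ≡ pos (suc k)
        by-log zero eq = q ∸ 1 , ℕ.≤-reflexive (ℕ.suc-pred q) , trans (sym (pos-log σ)) (trans (cong pos eq)
          (trans (sym pos-q) (cong pos (sym (ℕ.suc-pred q)))))
        by-log (suc k) eq = k , ℕ.<⇒≤ (subst (_< q) eq (ℕ%.m%n<n _ q)) , trans (sym (pos-log σ)) (cong pos eq)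

      x≡Mz : ∀ i → x i ≡ (M *ᵛ z) i
      x≡Mz i = let v , σ , eq = Fin.combine-surjective {order} {q} i
                   k , k<q , eq′ = position σ
        in subst (λ i → x i ≡ (M *ᵛ z) i) (trans (cong (combine v) (sym eq′)) eq) (begin
          slice x (pos (suc k)) v
            ≡⟨ lemma (slice x (pos (suc k)) v) ((A *ᵛ f k) v) ⟩
          ((A *ᵛ f k) v +ᶻ slice x (pos (suc k)) v) -ᶻ (A *ᵛ f k) v
            ≡⟨ cong₂ _-ᶻ_ (trans (z-pos (suc k) k<q v) (f-suc k v)) (trans (slice-adjacency z k v) (*ᵛ-cong (z-pos k (ℕ.<⇒≤ k<q)) v)) ⟨
          slice z (pos (suc k)) v -ᶻ slice (adjacency Y *ᵛ z) (pos (suc k)) v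
            ≡⟨ M-*ᵛ z (combine v (pos (suc k))) ⟨
          (M *ᵛ z) (combine v (pos (suc k))) ∎)
        where
        open ≡-Reasoning
        lemma : ∀ a b → a ≡ (b +ᶻ a) -ᶻ b
        lemma = solve-∀

    reflect : ∀ x → ActImage A (1-u^ q) (L x) → ∃ λ c → c ≢ 0ℤ × Image M (λ j → c *ᶻ x j)
    reflect x (w , Lx) = 1ℤ , (λ ()) , Reflect.z x w Lx , λ i → trans (ℤ.*-identityˡ (x i)) (Reflect.x≡Mz x w Lx i)

    onto : ∀ (y : Vecℤ order) → ∃ λ x → ∃ λ c → c ≢ 0ℤ × (∀ v → L x v ≡ c *ᶻ y v)
    onto y = x , 1ℤ , (λ ()) , λ v → trans (at-q v) (sym (ℤ.*-identityˡ (y v)))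
      where
      -- Supported on layer `pos 0`, which is `pos q`: it enters the Horner sum last, with no factor
      -- A.
      x : Vecℤ (order * q)
      x i = 𝟙 (pos 0) (proj₂ (remQuot {order} q i)) *ᶻ y (proj₁ (remQuot {order} q i))
      x-slice : ∀ σ v → slice x σ v ≡ 𝟙 (pos 0) σ *ᶻ y v
      x-slice σ v = cong (λ (v , σ) → 𝟙 (pos 0) σ *ᶻ y v) (Fin.remQuot-combine v σ)
      zeros : ∀ k → k < q → ∀ v → horner-slices x k v ≡ 0ℤ
      zeros zero    _   v = refl
      zeros (suc k) k<q v = cong₂ _+ᶻ_ (trans (*ᵛ-cong (zeros k (ℕ.<-trans (ℕ.n<1+n k) k<q)) v) (*ᵛ-0 v))
        (trans (x-slice (pos (suc k)) v) (trans (cong (_*ᶻ y v) (𝟙-off (pos 0) (pos (suc k)) pos≢)) (ℤ.*-zeroˡ (y v))))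
        where
        pos≢ : pos 0 ≢ pos (suc k)
        pos≢ eq = case trans (sym (ℕ%.m<n⇒m%n≡m (ℕ.>-nonZero⁻¹ q))) (trans (pos-injective eq) (ℕ%.m<n⇒m%n≡m k<q)) of λ ()
      at-suc : ∀ k → suc k ≡ q → ∀ v → horner-slices x (suc k) v ≡ y v
      at-suc k eq v = trans (cong₂ _+ᶻ_ (trans (*ᵛ-cong (zeros k (ℕ.≤-reflexive eq)) v) (*ᵛ-0 v))
        (trans (x-slice (pos (suc k)) v) (trans (cong (λ σ → 𝟙 (pos 0) σ *ᶻ y v) (trans (cong pos eq) pos-q))
          (trans (cong (_*ᶻ y v) (𝟙-diag (pos 0))) (ℤ.*-identityˡ (y v)))))) (ℤ.+-identityˡ (y v))
      at-q : ∀ v → L x v ≡ y v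
      at-q v = subst (λ k → horner-slices x k v ≡ y v) (ℕ.suc-pred q) (at-suc (q ∸ 1) (ℕ.suc-pred q) v)

  ActImage-resp : ∀ P → Respects≗ (ActImage A P)
  ActImage-resp P eq (w , eq′) = w , λ j → trans (sym (eq j)) (eq′ j)

  HasRank⇔ : ∀ b → HasRank (BF (derived X (const τ) n)) b ⇔ RankMod (ActImage A (1-u^ q)) b
  HasRank⇔ b = mk⇔ (Transferred.to ∘ Equivalence.to (BF-HasRank⇔RankMod (derived X (const τ) n) b)) (Equivalence.from (BF-HasRank⇔RankMod (derived X (const τ) n) b) ∘ Transferred.from)
    where
    module Transferred = Transfer {order * q} {order} {Image M} {ActImage A (1-u^ q)}
      (λ {x} {y} → Image-resp M {x} {y}) (λ {x} {y} → ActImage-resp (1-u^ q) {x} {y}) L (λ a g → horner-comb a g q) preserve reflect onto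

  rank-exists : ∃ λ b → HasRank (BF (derived X (const τ) n)) b
  rank-exists = let b , rank = Image-rank M in b , Equivalence.from (BF-HasRank⇔RankMod (derived X (const τ) n) b) rank

-- The zeta function of the derived digraph.

coeff-u : coeff u ≗ˢ shift 1 one
coeff-u zero          = refl
coeff-u (suc zero)    = refl
coeff-u (suc (suc n)) = refl

shift-shift : ∀ n f → shift 1 (shift n f) ≗ˢ shift (suc n) f
shift-shift n f zero    = refl
shift-shift n f (suc k) = refl

coeff-u^ : ∀ n → coeff (u ^ᴾ n) ≗ˢ shift n one
coeff-u^ zero    = coeff-1
coeff-u^ (suc n) = 𝒮.trans (coeff-* u (u ^ᴾ n)) (𝒮.trans (⊛-cong coeff-u (coeff-u^ n)) (𝒮.trans (shift-⊛ 1 one (shift n one))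
  (𝒮.trans (shift-cong 1 (⊛-identityˡ (shift n one))) (shift-shift n one))))

coeff-1-u^ : ∀ n → coeff (1-u^ n) ≗ˢ one +ˢ -ˢ shift n one
coeff-1-u^ n k = trans (coeff-+ 1ᴾ (-ᴾ (u ^ᴾ n)) k) (cong₂ _+ᶻ_ (coeff-1 k) (trans (coeff-map (-_) refl (u ^ᴾ n) k) (cong -_ (coeff-u^ n k))))

∂-coeff-1-u^ : ∀ q → .{{NonZero q}} → ∂ (coeff (1-u^ q)) ≗ˢ (-ˢ ψ q) ⊛ coeff (1-u^ q)
∂-coeff-1-u^ (suc q) = 𝒮.trans (∂-cong (coeff-1-u^ (suc q))) (𝒮.trans (∂-1-u^ q) (⊛-cong {f = -ˢ ψ (suc q)} (λ _ → refl) (𝒮.sym (coeff-1-u^ (suc q)))))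

module TowerZeta (p : ℕ) .{{_ : NonZero p}} (X : Digraph) (τ : ℤₚ p) (unit : IsUnit τ) (n : ℕ) where
  open ConstantVoltage p X τ unit n
  open Twist (adjacency X)

  private instance
    q≢0 : NonZero q
    q≢0 = ℕ.m^n≢0 p n

  coeff-D-0 : coeff (D (1-u^ q)) 0 ≡ 1ℤ
  coeff-D-0 = trans (coeff-D (1-u^ q) 0) (det-twist-0 (coeff (1-u^ q)) (trans (coeff-1-u^ q 0)
    (cong (λ x → 1ℤ +ᶻ - x) (shift-< q one 0 (ℕ.>-nonZero⁻¹ q)))))

  -- Both factors have constant term 1. The logarithmic derivative of the zeta function counts
  -- closed walks, with coefficients `ψ q m` tr(Aᵐ); Jacobi's formula for 1 - u^q gives the negative
  -- for the determinant.
  zeta-D : zeta (derived X (const τ) n) ⊛ coeff (D (1-u^ q)) ≗ˢ one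
  zeta-D = ∂-unique {zeta Y} {coeff (D (1-u^ q))} {Zeta.closedWalks Y} (Zeta.zeta-0 Y) coeff-D-0 (Zeta.∂-zeta Y)
    (𝒮.trans (∂-cong (coeff-D (1-u^ q))) (𝒮.trans (∂-det-twist (coeff (1-u^ q)) (-ˢ ψ q) (∂-coeff-1-u^ q))
      (⊛-cong (λ m → trans (sym (ℤ.neg-distribˡ-* (ψ q m) (traceᴬ m))) (cong -_ (sym (closedWalks-derived m)))) (𝒮.sym (coeff-D (1-u^ q))))))

-- Orders at u = 1.

coeff-y^ : ∀ l → coeff (y ^ᴾ l) ≗ˢ coeff y ^ˢ l
coeff-y^ zero    = coeff-1
coeff-y^ (suc l) = 𝒮.trans (coeff-* y (y ^ᴾ l)) (⊛-cong {coeff y} (λ _ → refl) (coeff-y^ l))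

-- The constant term -1 of y is a unit, so the coefficients of P are recovered from those of y P one
-- after another.
y*-injective : ∀ P Q → y *ᴾ P ≈ᴾ y *ᴾ Q → P ≈ᴾ Q
y*-injective P Q (coeffwise eq) = coeffwise go
  where
  head : ∀ P → coeff (y *ᴾ P) 0 ≡ - coeff P 0
  head P = trans (coeff-* y P 0) (trans (ℤ.+-identityʳ (- 1ℤ *ᶻ coeff P 0)) (ℤ.-1*i≡-i (coeff P 0)))
  tail : ∀ P n → coeff (y *ᴾ P) (suc n) ≡ - coeff P (suc n) +ᶻ coeff P n
  tail P n = trans (coeff-* y P (suc n)) (cong₂ _+ᶻ_ (ℤ.-1*i≡-i (coeff P (suc n)))
    (trans (⊛-cong {g = coeff P} coeff-1 (λ _ → refl) n) (⊛-identityˡ (coeff P) n)))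
  go : ∀ n → coeff P n ≡ coeff Q n
  go zero    = ℤ.neg-injective (trans (sym (head P)) (trans (eq 0) (head Q)))
  go (suc n) = trans (recover (coeff P (suc n)) (coeff P n)) (trans
    (cong₂ _-ᶻ_ (go n) (trans (sym (tail P n)) (trans (eq (suc n)) (tail Q n)))) (sym (recover (coeff Q (suc n)) (coeff Q n))))
    where
    recover : ∀ a b → a ≡ b -ᶻ (- a +ᶻ b)
    recover = solve-∀

-- Common factors y are cancelled; if one remained on one side only, evaluation at 1 would give zero
-- there but not on the other side.
order-unique : ∀ a b R S → eval R 1ℤ ≢ 0ℤ → eval S 1ℤ ≢ 0ℤ → y ^ᴾ a *ᴾ R ≈ᴾ y ^ᴾ b *ᴾ S → a ≡ b
order-unique zero    zero    R S R≢0 S≢0 eq = refl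
order-unique zero    (suc b) R S R≢0 S≢0 eq = ⊥-elim (R≢0 (trans (sym (eval-cong 1ℤ (𝒫.*-identityˡ R)))
  (trans (eval-cong 1ℤ eq) (trans (eval-* 1ℤ (y ^ᴾ suc b) S) (cong (_*ᶻ eval S 1ℤ) (eval-^ 1ℤ y (suc b) refl (s≤s z≤n)))))))
order-unique (suc a) zero    R S R≢0 S≢0 eq = ⊥-elim (S≢0 (trans (sym (eval-cong 1ℤ (𝒫.*-identityˡ S)))
  (trans (sym (eval-cong 1ℤ eq)) (trans (eval-* 1ℤ (y ^ᴾ suc a) R) (cong (_*ᶻ eval R 1ℤ) (eval-^ 1ℤ y (suc a) refl (s≤s z≤n)))))))
order-unique (suc a) (suc b) R S R≢0 S≢0 eq = cong suc (order-unique a b R S R≢0 S≢0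
  (y*-injective (y ^ᴾ a *ᴾ R) (y ^ᴾ b *ᴾ S) (𝒫.trans (𝒫.sym (𝒫.*-assoc y (y ^ᴾ a) R)) (𝒫.trans eq (𝒫.*-assoc y (y ^ᴾ b) S)))))

FactoredAt1 : Polynomial → Set
FactoredAt1 P = ∃ λ l → ∃ λ Q → P ≈ᴾ y ^ᴾ l *ᴾ Q × eval Q 1ℤ ≢ 0ℤ

factor : ∀ N P → length P ≤ N → ¬ P ≈ᴾ [] → FactoredAt1 P
factor zero [] _ P≉0 = ⊥-elim (P≉0 𝒫.refl)
factor (suc N) [] _ P≉0 = ⊥-elim (P≉0 𝒫.refl)
factor (suc N) P@(a ∷ P′) (s≤s l≤N) P≉0 = by-cases (eval P 1ℤ ℤ.≟ 0ℤ)
  where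
  divisible : eval P 1ℤ ≡ 0ℤ → P ≈ᴾ y *ᴾ quot P
  divisible eq = 𝒫.trans (quot-spec P) (𝒫.trans (𝒫.+-congʳ (𝒫.trans (⟨⟩-cong eq) ⟨0⟩)) (𝒫.+-identityˡ (y *ᴾ quot P)))
  extend : P ≈ᴾ y *ᴾ quot P → FactoredAt1 (quot P) → FactoredAt1 P
  extend P≈ (l , Q , eq , Q≢0) = suc l , Q , 𝒫.trans P≈ (𝒫.trans (𝒫.*-congˡ {y} eq) (𝒫.sym (𝒫.*-assoc y (y ^ᴾ l) Q))) , Q≢0
  by-cases : Dec (eval P 1ℤ ≡ 0ℤ) → FactoredAt1 P
  by-cases (no neq) = 0 , P , 𝒫.sym (𝒫.*-identityˡ P) , neq
  by-cases (yes eq) = extend (divisible eq) (factor N (quot P) (ℕ.≤-trans (ℕ.≤-reflexive (length-quot a P′)) l≤N)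
    (λ q≈0 → P≉0 (𝒫.trans (divisible eq) (𝒫.trans (𝒫.*-congˡ {y} q≈0) (𝒫.zeroʳ y)))))

-- Cross-multiplying two presentations eliminates F and leaves an identity of polynomials, where
-- powers of y can be compared.
HasOrderAt-unique : ∀ {F k k′} → HasOrderAt 1ℤ F k → HasOrderAt 1ℤ F k′ → k ≡ k′
HasOrderAt-unique {F} (m , l , P , Q , P≢0 , Q≢0 , eq , k≡) (m′ , l′ , P′ , Q′ , P′≢0 , Q′≢0 , eq′ , k′≡) =
  trans k≡ (trans (difference m l m′ l′ orders) (sym k′≡))
  where
  coeff-form : ∀ a b R S → coeff ((y ^ᴾ (a + b)) *ᴾ (R *ᴾ S)) ≗ˢ (coeff y ^ˢ a ⊛ coeff y ^ˢ b) ⊛ (coeff R ⊛ coeff S)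
  coeff-form a b R S = 𝒮.trans (coeff-* (y ^ᴾ (a + b)) (R *ᴾ S)) (⊛-cong
    (𝒮.trans (coeff-≡ (^ᴾ-homo-* y a b)) (𝒮.trans (coeff-* (y ^ᴾ a) (y ^ᴾ b)) (⊛-cong (coeff-y^ a) (coeff-y^ b)))) (coeff-* R S))
  eval-≢0 : ∀ R S → eval R 1ℤ ≢ 0ℤ → eval S 1ℤ ≢ 0ℤ → eval (R *ᴾ S) 1ℤ ≢ 0ℤ
  eval-≢0 R S R≢0 S≢0 e = *-nonzero R≢0 S≢0 (trans (sym (eval-* 1ℤ R S)) e)
  orders : l + m′ ≡ l′ + m
  orders = order-unique (l + m′) (l′ + m) (Q *ᴾ P′) (Q′ *ᴾ P) (eval-≢0 Q P′ Q≢0 P′≢0) (eval-≢0 Q′ P Q′≢0 P≢0)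
    (coeffwise (𝒮.trans (coeff-form l m′ Q P′) (𝒮.trans (RationalSeries.cross-multiply seriesRing {coeff y ^ˢ l} {coeff y ^ˢ l′} {coeff Q} {coeff Q′} {F} {coeff y ^ˢ m} {coeff y ^ˢ m′} {coeff P} {coeff P′} eq eq′) (𝒮.sym (coeff-form l′ m Q′ P)))))
  difference : ∀ m l m′ l′ → l + m′ ≡ l′ + m → + m -ᶻ + l ≡ + m′ -ᶻ + l′
  difference m l m′ l′ eq = trans (lemma (+ m) (+ l) (+ l′)) (trans (cong (λ x → x -ᶻ + l -ᶻ + l′) (trans (sym (ℤ.pos-+ l′ m)) (trans (cong +_ (sym eq)) (ℤ.pos-+ l m′))))
    (lemma′ (+ m′) (+ l) (+ l′)))
    where
    lemma : ∀ m l l′ → m -ᶻ l ≡ (l′ +ᶻ m) -ᶻ l -ᶻ l′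
    lemma = solve-∀
    lemma′ : ∀ m′ l l′ → (l +ᶻ m′) -ᶻ l -ᶻ l′ ≡ m′ -ᶻ l′
    lemma′ = solve-∀

reciprocal-order : ∀ F P → coeff P 0 ≡ 1ℤ → F ⊛ coeff P ≗ˢ one → ∃ λ k → HasOrderAt 1ℤ F k
reciprocal-order F P P₀ FP = from-factor (factor (length P) P ℕ.≤-refl (λ P≈0 → case trans (sym P₀) (coeff-≡ P≈0 0) of λ ()))
  where
  from-factor : FactoredAt1 P → ∃ λ k → HasOrderAt 1ℤ F k
  from-factor (l , Q , P≈ , Q≢0) = + 0 -ᶻ + l , 0 , l , 1ᴾ , Q , (λ ()) , Q≢0 , equation , refl
    where
    equation : (coeff y ^ˢ l ⊛ coeff Q) ⊛ F ≗ˢ one ⊛ coeff 1ᴾ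
    equation = 𝒮.trans (⊛-cong {g = F} (𝒮.trans (⊛-cong {g = coeff Q} (𝒮.sym (coeff-y^ l)) (λ _ → refl)) (𝒮.trans (𝒮.sym (coeff-* (y ^ᴾ l) Q)) (𝒮.sym (coeff-≡ P≈)))) (λ _ → refl))
      (𝒮.trans (⊛-comm (coeff P) F) (𝒮.trans FP (𝒮.trans (𝒮.sym coeff-1) (𝒮.sym (⊛-identityˡ (coeff 1ᴾ))))))

-- A factor that does not vanish at 1 is absorbed into the denominator Q.
HasOrderAt-multiple : ∀ F F′ R {k} → eval R 1ℤ ≢ 0ℤ → coeff R ⊛ F′ ≗ˢ F → HasOrderAt 1ℤ F k → HasOrderAt 1ℤ F′ k
HasOrderAt-multiple F F′ R R≢0 eq (m , l , P , Q , P≢0 , Q≢0 , eq′ , k≡) = m , l , P , Q *ᴾ R , P≢0 ,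
  (λ e → *-nonzero Q≢0 R≢0 (trans (sym (eval-* 1ℤ Q R)) e)) , 𝒮.trans equation eq′ , k≡
  where
  equation : (coeff y ^ˢ l ⊛ coeff (Q *ᴾ R)) ⊛ F′ ≗ˢ (coeff y ^ˢ l ⊛ coeff Q) ⊛ F
  equation = 𝒮.trans (⊛-cong {g = F′} (𝒮.trans (⊛-cong {coeff y ^ˢ l} (λ _ → refl) (coeff-* Q R)) (𝒮.sym (⊛-assoc (coeff y ^ˢ l) (coeff Q) (coeff R)))) (λ _ → refl))
    (𝒮.trans (⊛-assoc (coeff y ^ˢ l ⊛ coeff Q) (coeff R) F′) (⊛-cong {coeff y ^ˢ l ⊛ coeff Q} (λ _ → refl) eq))

-- The totient of a prime power.

module TotientBound (p : ℕ) (pp : Prime p) (n : ℕ) where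
  private
    instance
      p≢0 : NonZero p
      p≢0 = prime⇒nonZero pp

    coprimes : ℕ → ℕ
    coprimes N = length (filter (λ k → coprime? k (p ^ suc n)) (map suc (upTo N)))

    last : ℕ → ℕ
    last N = length (filter (λ k → coprime? k (p ^ suc n)) [ suc N ])

    coprimes-suc : ∀ N → coprimes (suc N) ≡ coprimes N + last N
    coprimes-suc N = trans (cong (λ xs → length (filter (λ k → coprime? k (p ^ suc n)) xs))
        (trans (cong (map suc) (sym (List.upTo-∷ʳ N))) (List.map-++ suc (upTo N) [ N ])))
      (trans (cong length (List.filter-++ (λ k → coprime? k (p ^ suc n)) (map suc (upTo N)) [ suc N ])) (List.length-++ (filter _ (map suc (upTo N)))))

    last-multiple : ∀ N → p ℕ∣.∣ suc N → last N ≡ 0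
    last-multiple N p∣N = cong length (List.filter-reject (λ k → coprime? k (p ^ suc n)) {xs = []} λ coprime →
      ℕ.<⇒≢ (ℕ.nonTrivial⇒n>1 p {{prime⇒nonTrivial pp}}) (sym (coprime (p∣N , ℕ∣.divides (p ^ n) (ℕ.*-comm p (p ^ n))))))

    coprimes-+ : ∀ N k → coprimes (k + N) ≤ coprimes N + k
    coprimes-+ N zero    = ℕ.≤-reflexive (sym (ℕ.+-identityʳ (coprimes N)))
    coprimes-+ N (suc k) = ℕ.≤-trans (ℕ.≤-reflexive (coprimes-suc (k + N))) (ℕ.≤-trans
      (ℕ.+-mono-≤ (coprimes-+ N k) (List.length-filter (λ k → coprime? k (p ^ suc n)) [ suc (k + N) ]))
      (ℕ.≤-reflexive (trans (ℕ.+-assoc (coprimes N) k 1) (cong (λ x → coprimes N + x) (ℕ.+-comm k 1)))))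

    -- Each block of p consecutive integers ends in a multiple of p, which leaves at most p - 1
    -- candidates.
    coprimes-blocks : ∀ k → coprimes (k * p) ≤ k * (p ∸ 1)
    coprimes-blocks zero    = z≤n
    coprimes-blocks (suc k) = begin
      coprimes (p + k * p)                               ≡⟨ cong (λ m → coprimes (m + k * p)) (ℕ.suc-pred p) ⟨
      coprimes (suc (p ∸ 1 + k * p))                     ≡⟨ coprimes-suc (p ∸ 1 + k * p) ⟩
      coprimes (p ∸ 1 + k * p) + last (p ∸ 1 + k * p)    ≡⟨ cong (λ x → coprimes (p ∸ 1 + k * p) + x) (last-multiple (p ∸ 1 + k * p) (ℕ∣.divides (suc k) (cong (_+ k * p) (ℕ.suc-pred p)))) ⟩
      coprimes (p ∸ 1 + k * p) + 0                       ≡⟨ ℕ.+-identityʳ _ ⟩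
      coprimes (p ∸ 1 + k * p)                           ≤⟨ coprimes-+ (k * p) (p ∸ 1) ⟩
      coprimes (k * p) + (p ∸ 1)                         ≤⟨ ℕ.+-monoˡ-≤ (p ∸ 1) (coprimes-blocks k) ⟩
      k * (p ∸ 1) + (p ∸ 1)                              ≡⟨ ℕ.+-comm (k * (p ∸ 1)) (p ∸ 1) ⟩
      suc k * (p ∸ 1)                                    ∎
      where open ℕ.≤-Reasoning

  -- An upper bound suffices: it turns r < φ(pⁿ⁺¹) into r < d.
  φ-≤ : φ (p ^ suc n) ≤ (p ∸ 1) * p ^ n
  φ-≤ = ℕ.≤-trans (ℕ.≤-reflexive (cong coprimes (ℕ.*-comm p (p ^ n)))) (ℕ.≤-trans (coprimes-blocks (p ^ n)) (ℕ.≤-reflexive (ℕ.*-comm (p ^ n) (p ∸ 1))))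

HasDefect-unique : ∀ {Y d d′} → HasDefect Y d → HasDefect Y d′ → d ≡ d′
HasDefect-unique {Y} (k , b , order , rank , d≡) (k′ , b′ , order′ , rank′ , d′≡) = trans d≡ (trans
  (cong₂ (λ k b → (- k) -ᶻ + b) (HasOrderAt-unique {zeta Y} order order′) (HasRank-unique (BF Y) rank rank′)) (sym d′≡))

-- The defect along the tower.

module DefectTower (p : ℕ) .{{_ : NonZero p}} (pp : Prime p) (X : Digraph) (τ : ℤₚ p) (unit : IsUnit τ) where
  open Digraph X using (order)

  defect-exists : ∀ n → ∃ λ d → HasDefect (derived X (const τ) n) d
  defect-exists n =
    let k , ord = reciprocal-order (zeta (derived X (const τ) n)) (Twist.D (adjacency X) (1-u^ (p ^ n))) (TowerZeta.coeff-D-0 p X τ unit n) (TowerZeta.zeta-D p X τ unit n)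
        b , rank = BowenFranks.rank-exists p X τ unit n
    in (- k) -ᶻ + b , k , b , ord , rank , refl

  module _ (n : ℕ) (r<d : order < (p ∸ 1) * p ^ n) where
    open Eisenstein p pp using (Φ)
    open Action (adjacency X)
    open Twist (adjacency X)
    open Injective (adjacency X) (Φ n) (CyclotomicKernel.Φ-injective p pp n (adjacency X) r<d) using (act-onto; eval-D≢0)

    private
      factorization : 1-u^ (p ^ suc n) ≈ᴾ 1-u^ (p ^ n) *ᴾ Φ n
      factorization = 𝒫.sym (𝒫.trans (geo-telescope p (u ^ᴾ (p ^ n))) (𝒫.+-congˡ {1ᴾ} (𝒫.-‿cong
        (𝒫.trans (^ᴾ-assocʳ u (p ^ n) p) (𝒫.reflexive (cong (u ^ᴾ_) (ℕ.*-comm (p ^ n) p)))))))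

      act-factorization : ∀ w j → act (1-u^ (p ^ suc n)) w j ≡ act (1-u^ (p ^ n)) (act (Φ n) w) j
      act-factorization w j = trans (act-≈ factorization w j) (act-* (1-u^ (p ^ n)) (Φ n) w j)

      preserve : ∀ x → ActImage (adjacency X) (1-u^ (p ^ suc n)) x → ActImage (adjacency X) (1-u^ (p ^ n)) x
      preserve x (w , eq) = act (Φ n) w , λ j → trans (eq j) (act-factorization w j)

      -- Φ(A) maps onto a set containing K ℤʳ, so K w = Φ(A) w′ and K x lies in the smaller image:
      -- the two quotients differ by torsion.
      reflect : ∀ x → ActImage (adjacency X) (1-u^ (p ^ n)) x → ∃ λ c → c ≢ 0ℤ × ActImage (adjacency X) (1-u^ (p ^ suc n)) (λ j → c *ᶻ x j)
      reflect x (w , eq) = let K , K≢0 , onto = act-onto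
                               w′ , eq′ = onto w
        in K , K≢0 , w′ , λ j → trans (cong (K *ᶻ_) (eq j)) (trans (sym (act-scaleʳ (1-u^ (p ^ n)) K w j))
             (trans (sym (act-cong (1-u^ (p ^ n)) eq′ j)) (sym (act-factorization w′ j))))

      onto : ∀ (y : Vecℤ order) → ∃ λ x → ∃ λ c → c ≢ 0ℤ × (∀ j → x j ≡ c *ᶻ y j)
      onto y = y , 1ℤ , (λ ()) , λ j → sym (ℤ.*-identityˡ (y j))

      ranks : ∀ {b} → RankMod (ActImage (adjacency X) (1-u^ (p ^ n))) b → RankMod (ActImage (adjacency X) (1-u^ (p ^ suc n))) b
      ranks = Transfer.from {order} {order} {ActImage (adjacency X) (1-u^ (p ^ suc n))} {ActImage (adjacency X) (1-u^ (p ^ n))}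
        (BowenFranks.ActImage-resp p X τ unit n (1-u^ (p ^ suc n))) (BowenFranks.ActImage-resp p X τ unit n (1-u^ (p ^ n)))
        (λ x → x) (λ a g j → refl) preserve reflect onto

      -- The zeta functions are reciprocals of determinants whose quotient is det Φ(uA). As det Φ(A)
      -- is nonzero, the orders at u = 1 agree.
      zetas : coeff (D (Φ n)) ⊛ zeta (derived X (const τ) (suc n)) ≗ˢ zeta (derived X (const τ) n)
      zetas = RationalSeries.quotient seriesRing {zeta (derived X (const τ) n)} {zeta (derived X (const τ) (suc n))}
        {coeff (D (1-u^ (p ^ n)))} {coeff (D (1-u^ (p ^ suc n)))} {coeff (D (Φ n))} (TowerZeta.zeta-D p X τ unit n) (TowerZeta.zeta-D p X τ unit (suc n))
        (𝒮.trans (coeff-≡ (𝒫.trans (D-cong factorization) (D-* (1-u^ (p ^ n)) (Φ n)))) (coeff-* (D (1-u^ (p ^ n))) (D (Φ n))))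

    defect-step : ∀ {d} → HasDefect (derived X (const τ) n) d → HasDefect (derived X (const τ) (suc n)) d
    defect-step (k , b , ord , rank , d≡) = k , b ,
      HasOrderAt-multiple (zeta (derived X (const τ) n)) (zeta (derived X (const τ) (suc n))) (D (Φ n)) eval-D≢0 zetas ord ,
      Equivalence.from (BowenFranks.HasRank⇔ p X τ unit (suc n) b) (ranks (Equivalence.to (BowenFranks.HasRank⇔ p X τ unit n b) rank)) , d≡

-- Since `HasDefect` is a relation, the function δ is first pinned down as its only solution. The
-- comparison of levels n and n - 1 is indexed by the lower level, so that no subtraction occurs.
lemma7p9 : ∀ (p : ℕ) .{{_ : NonZero p}} → Prime p →
    ∀ (X : Digraph) → Digraph.StronglyConnected X →
    ∀ (τ : ℤₚ p) → IsUnit τ →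
    ∃ λ (δ : ℕ → ℤ) →
    ((∀ (n : ℕ) (d : ℤ) → HasDefect (derived X (const τ) n) d ⇔ d ≡ δ n)
    × (∀ (n : ℕ) → φ (p ^ suc n) > Digraph.order X → δ (suc n) ≡ δ n)
    × (∃[ B ] (∀ (n : ℕ) → ∣ δ n ∣ ≤ B))
    × (p ∸ 1 > Digraph.order X → ∀ (m n : ℕ) → δ m ≡ δ n))
lemma7p9 p pp X _ τ unit = δ , characterization , (λ n r<φ → step n (ℕ.<-≤-trans r<φ (TotientBound.φ-≤ p pp n))) , bounded , constant-δ
  where
  open DefectTower p pp X τ unit
  r : ℕ
  r = Digraph.order X

  δ : ℕ → ℤ
  δ n = proj₁ (defect-exists n)

  characterization : ∀ n d → HasDefect (derived X (const τ) n) d ⇔ d ≡ δ n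
  characterization n d = mk⇔ (λ h → HasDefect-unique {derived X (const τ) n} h (proj₂ (defect-exists n)))
    (λ eq → subst (HasDefect (derived X (const τ) n)) (sym eq) (proj₂ (defect-exists n)))

  step : ∀ n → r < (p ∸ 1) * p ^ n → δ (suc n) ≡ δ n
  step n r<d = HasDefect-unique {derived X (const τ) (suc n)} (proj₂ (defect-exists (suc n))) (defect-step n r<d (proj₂ (defect-exists n)))

  0<p-1 : 0 < p ∸ 1
  0<p-1 = ℕ.m<n⇒0<n∸m (ℕ.nonTrivial⇒n>1 p {{prime⇒nonTrivial pp}})

  n<pⁿ : ∀ n → n < p ^ n
  n<pⁿ zero    = s≤s z≤n
  n<pⁿ (suc n) = ℕ.<-≤-trans (ℕ.≤-<-trans (n<pⁿ n) (ℕ.m<m*n (p ^ n) p {{ℕ.m^n≢0 p n}} (ℕ.nonTrivial⇒n>1 p {{prime⇒nonTrivial pp}}))) (ℕ.≤-reflexive (ℕ.*-comm (p ^ n) p))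

  -- A crude threshold: from level r on, p^(k + r) > k + r ≥ r. Finitely many levels remain, and
  -- boundedness follows.
  large : ∀ k → r < (p ∸ 1) * p ^ (k + r)
  large k = ℕ.≤-<-trans (ℕ.m≤n+m r k) (ℕ.<-≤-trans (n<pⁿ (k + r)) (ℕ.m≤n*m (p ^ (k + r)) (p ∸ 1) {{ℕ.>-nonZero 0<p-1}}))

  eventually-constant : ∀ k → δ (k + r) ≡ δ r
  eventually-constant zero    = refl
  eventually-constant (suc k) = trans (step (k + r) (large k)) (eventually-constant k)

  bounded-below : ∀ N → ∃ λ B → ∀ n → n ≤ N → ∣ δ n ∣ ≤ B
  bounded-below zero    = ∣ δ 0 ∣ , λ { zero _ → ℕ.≤-refl }
  bounded-below (suc N) = let B , bound = bounded-below N in B ℕ.⊔ ∣ δ (suc N) ∣ , λ n n≤N → case ℕ.m≤n⇒m<n∨m≡n n≤N of λ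
    { (inj₁ n<N) → ℕ.≤-trans (bound n (ℕ.≤-pred n<N)) (ℕ.m≤m⊔n B ∣ δ (suc N) ∣)
    ; (inj₂ refl) → ℕ.m≤n⊔m B ∣ δ (suc N) ∣ }

  bounded : ∃[ B ] (∀ n → ∣ δ n ∣ ≤ B)
  bounded = let B , bound = bounded-below r in B , λ n → case ℕ.≤-total n r of λ
    { (inj₁ n≤r) → bound n n≤r
    ; (inj₂ r≤n) → subst (λ m → ∣ δ m ∣ ≤ B) (ℕ.m∸n+n≡m r≤n) (subst (λ d → ∣ d ∣ ≤ B) (sym (eventually-constant (n ∸ r))) (bound r ℕ.≤-refl)) }

  constant-δ : p ∸ 1 > r → ∀ m n → δ m ≡ δ n
  constant-δ r<p-1 m n = trans (to-zero m) (sym (to-zero n))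
    where
    to-zero : ∀ n → δ n ≡ δ 0
    to-zero zero    = refl
    to-zero (suc n) = trans (step n (ℕ.<-≤-trans r<p-1 (ℕ.m≤m*n (p ∸ 1) (p ^ n) {{ℕ.m^n≢0 p n}}))) (to-zero n)
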